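{- Let $n\ge 1$. For every nonnesting matching $M\in \mathrm{NN}_{2n}$ and every noncrossing matching $M'\in \mathrm{NC}_{2n}$, the entry $a_{MM'}$ of the transition matrix from the Specht basis to the web basis of the Specht module $\mathcal{S}^{(n,n)}$ is equal to the number of web permutations $\sigma\in\mathfrak{S}_n$ such that $D(\sigma)\subseteq D(M)$ and $M(\sigma)=M'$.
   Context: **Matchings.** $[2n]=\{1,\dots,2n\}$; $\mathfrak{S}_m$ is the symmetric group on $[m]$. A matching on $[2n]$ is a set partition of $[2n]$ into blocks (arcs) of size 2; $\mathrm{Mat}_{2n}$ is the set of all of them. A matching is noncrossing if it has no two arcs $\{a,c\},\{b,d\}$ with $a<b<c<d$, and nonnesting if it has no two arcs $\{a,d\},\{b,c\}$ with $a<b<c<d$. $\mathrm{NC}_{2n}$ and $\mathrm{NN}_{2n}$ are the sets of noncrossing and nonnesting matchings on $[2n]$. For an arc $\{i,j\}$ with $i<j$, $i$ is called an opener and $j$ a closer. **Specht basis.** $\mathcal{S}^{(n,n)}$ is the (complex) Specht module of $\mathfrak{S}_{2n}$ indexed by the partition $(n,n)$, with its Specht basis $\{v_T\}$ of standard polytabloids, $T$ running over standard Young tableaux of shape $(n,n)$ (i.e. $2\times n$ arrays with entries $[2n]$, rows and columns increasing; $v_T=\sum_{\pi}\mathrm{sgn}(\pi)\{\pi T\}$, sum over the column stabilizer of $T$, where $\{\cdot\}$ denotes the row tabloid). Joining by an arc the two entries in each column of $T$ gives a bijection from these tableaux to $\mathrm{NN}_{2n}$; write $v_M:=v_T$ if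 $M\in\mathrm{NN}_{2n}$ corresponds to $T$. **Web basis.** Let $z=(z_{i,j})$ be a $2\times 2n$ matrix of indeterminates, $\Delta_{ij}=z_{1,i}z_{2,j}-z_{1,j}z_{2,i}$ for $1\le i<j\le 2n$, and $\Delta_M=\prod_{\{i,j\}\in M,\ i<j}\Delta_{ij}$ for $M\in\mathrm{Mat}_{2n}$. Let $W_n$ be the $\mathbb{C}$-span of all $\Delta_M$, $M\in \mathrm{Mat}_{2n}$. The set $\{\Delta_M: M\in\mathrm{NC}_{2n}\}$ is a basis of $W_n$ (the web basis). $\mathfrak{S}_{2n}$ acts on $W_n$ by permuting the columns of $z$, $\sigma\cdot\Delta_M(z)=\Delta_M(z\sigma^{ -1})$ with $\sigma$ viewed as a permutation matrix (so that $\sigma\cdot\Delta_{ij}=\Delta_{\sigma(i)\sigma(j)}$, where $\Delta_{ji}=-\Delta_{ij}$), and $W_n\cong\mathcal{S}^{(n,n)}$ as $\mathfrak{S}_{2n}$-modules. Let $M_0=\{\{1,2\},\{3,4\},\dots,\{2n-1,2n\}\}$, let $\varphi:W_n\to\mathcal{S}^{(n,n)}$ be the unique $\mathfrak{S}_{2n}$-isomorphism with $\varphi(\Delta_{M_0})=v_{M_0}$, and put $w_{M'}=\varphi(\Delta_{M'})$ for $M'\in\mathrm{NC}_{2n}$. The numbers $a_{MM'}$ are defined by $v_M=\sum_{M'\in\mathrm{NC}_{2n}}a_{MM'}w_{M'}$ for $M\in\mathrm{NN}_{2n}$. **Dyck paths.** A Dyck path of length $2n$ is a lattice path from $(0,0)$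 to $(n,n)$ with $n$ north steps $\mathsf{N}=(0,1)$ and $n$ east steps $\mathsf{E}=(1,0)$ that does not go below the line $y=x$. Dyck paths are partially ordered by $\subseteq$, inclusion of the regions below the paths. For a matching $M$ on $[2n]$, $D(M)$ is the Dyck path obtained by reading $1,2,\dots,2n$ and recording $\mathsf{N}$ for each opener and $\mathsf{E}$ for each closer. **Cells.** In the $n\times n$ grid with corners $(0,0),(n,0),(0,n),(n,n)$, the cell $(i,j)$ is the unit cell whose upper-right corner is $(i,j)$. For $\sigma\in\mathfrak{S}_n$, $D(\sigma)$ is the minimum (with respect to $\subseteq$) Dyck path such that all cells $(i,\sigma(i))$, $1\le i\le n$, lie below the path. **Grid configurations.** For $\sigma\in\mathfrak{S}_n$, a cell $(i,j)$ is a crossing of $\sigma$ if $\sigma(i)<j$ and $i<\sigma^{ -1}(j)$; $\mathrm{Cr}(\sigma)$ is the set of crossings. For $E\subseteq\mathrm{Cr}(\sigma)$, the grid configuration $G(\sigma,E)$ is the following drawing: mark each cell $(i,\sigma(i))$, and from the marked cell draw a horizontal line to the left boundary of the grid and a vertical line to the top boundary (so the strand turns at the marked cell); then in each cell of $E$ replace the crossing of a horizontal and a vertical line by an elbow, i.e. by one arc joining the midpoints of the left and bottom edges of the cell and one arc joining the midpoints of the right and top edges. Label the unit intervals of the left boundary $1,\dots,n$ from bottom to top and those of the top boundary $n+1,\dots,2n$ from left to right. Each strand joins two boundary intervals; $M(\sigma,E)$ is the matching on $[2n]$ whose arcs are the pairs of labels joined by strands. Put $M(\sigma):=M(\sigma,\mathrm{Cr}(\sigma))$,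 a noncrossing matching. **Web permutations.** Order cells by $(x,y)\succeq(x',y')$ iff $x\le x'$ and $y\ge y'$. The (remaining) crossings of $G(\sigma,E)$ are the elements of $\mathrm{Cr}(\sigma)\setminus E$. If $c=(i,j)$ is a $\succeq$-maximal remaining crossing of $G(\sigma,E)$, resolving $c$ produces two grid configurations: $G(\sigma,E\cup\{c\})$ (smoothing) and $G(\sigma',E)$ (switching), where $\sigma'(i)=j$, $\sigma'(\sigma^{ -1}(j))=\sigma(i)$, and $\sigma'(k)=\sigma(k)$ for $k\ne i,\sigma^{ -1}(j)$ (one has $E\subseteq\mathrm{Cr}(\sigma')$). Start from $G(\mathrm{id},\emptyset)$, $\mathrm{id}\in\mathfrak{S}_n$, and repeatedly replace each grid configuration having a remaining crossing by the two obtained by resolving a maximal one, until all are of the form $G(\sigma,\mathrm{Cr}(\sigma))$. The permutations $\sigma$ occurring are the web permutations of $[n]$ (the result does not depend on the choices of maximal crossings). -}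

module Defs where

open import Level using (Level; 0ℓ; _⊔_) renaming (suc to lsuc)
open import Algebra.Bundles using (CommutativeRing; CommutativeMonoid; Ring)
open import Algebra.Apartness.Bundles using (HeytingField; HeytingCommutativeRing)
open import Algebra.Module.Bundles using (LeftModule)
open import Algebra.Module.Bundles.Raw using (RawLeftModule)
import Algebra.Module.Morphism.Structures as ModuleMorphism
import Algebra.Module.Morphism.LeftModuleMonomorphism as Mono
import Algebra.Module.Properties.LeftModule as LeftModuleProperties
import Algebra.Properties.CommutativeMonoid.Sum as Sum
import Algebra.Properties.Monoid.Mult as Mult
import Algebra.Properties.Ring as RingProperties
open import Data.Bool.Base using (Bool; true; false; not; _∧_; if_then_else_)
open import Data.Empty using (⊥-elim)
open import Data.Fin.Base using
  (Fin; zero; suc; toℕ; fromℕ; inject₁; opposite; remQuot; combine; finToFun; _<_; _≤_)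
open import Data.Fin.Patterns using (0F; 1F)
open import Data.Fin.Permutation as Perm
  using (Permutation′; permutation; cast-id; ↔⇒≡; _⟨$⟩ʳ_; _⟨$⟩ˡ_)
open import Data.Fin.Properties as Fin using (_≟_; _<?_; all?; *↔×)
open import Data.List.Base as List using (List; []; _∷_; allFin; mapMaybe; filter)
open import Data.List.Membership.Propositional using (_∈_)
open import Data.List.Membership.Propositional.Properties using (∈-filter⁺; ∈-filter⁻; ∈-allFin; ∈-lookup)
import Data.List.Relation.Unary.All as All
open import Data.List.Relation.Unary.AllPairs as AllPairs using (AllPairs; []; _∷_)
import Data.List.Relation.Unary.AllPairs.Properties as AllPairs
import Data.List.Relation.Unary.Any as Any
open import Data.List.Relation.Unary.Any.Properties using (lookup-index)
open import Data.Maybe.Base as Maybe using (Maybe)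
open import Data.Nat.Base as ℕ using (ℕ; _*_; _^_)
import Data.Nat.Properties as ℕ
open import Data.Product.Base using (Σ; ∃; ∃-syntax; Σ-syntax; _×_; _,_; proj₁; proj₂)
open import Data.Product.Algebra using (×-comm)
open import Function.Base using (_∘_; _on_)
open import Function.Bundles using (_↔_; _⇔_; Inverse; Func; mk↔ₛ′; mk⇔)
open import Function.Construct.Composition using (_↔-∘_)
open import Function.Construct.Symmetry using (↔-sym)
open import Relation.Binary.Bundles using (Setoid)
open import Relation.Binary.Core using (Rel)
open import Relation.Binary.Structures using (IsEquivalence)
open import Relation.Binary.Definitions using (tri<; tri≈; tri>)
import Relation.Binary.Construct.On as On
open import Relation.Binary.Construct.Closure.Equivalence using (EqClosure)
open import Relation.Binary.PropositionalEquality
  using (_≡_; _≢_; _≗_; refl; sym; trans; cong; cong₂; subst; subst₂)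
  renaming (setoid to ≡-setoid)
open import Relation.Nullary using (¬_; Dec; yes; no; does)
open import Relation.Nullary.Decidable using (dec⇒maybe; ¬?; _→-dec_; dec-true; dec-false; does-⇔)
open import Relation.Unary using (Pred; ∅; _∪_; ｛_｝; _≐_; _⊆_; _∉_)

-- The set [2n] is Fin (2 * n).  A partition into blocks of size two is
-- given by the map exchanging the two elements of every block.
record Matching (n : ℕ) : Set where
  field
    partner     : Fin (2 * n) → Fin (2 * n)
    involutive  : ∀ i → partner (partner i) ≡ i
    no-fixpoint : ∀ i → partner i ≢ i

open Matching public

matchingSetoid : ℕ → Setoid 0ℓ 0ℓ
matchingSetoid n = record
  { Carrier       = Matching n
  ; _≈_           = λ M M′ → partner M ≗ partner M′
  ; isEquivalence = record
    { refl  = λ _ → refl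
    ; sym   = λ p i → sym (p i)
    ; trans = λ p q i → trans (p i) (q i)
    }
  }

Noncrossing Nonnesting : ∀ {n} → Matching n → Set
Noncrossing M = ∀ a b c d → a < b → b < c → c < d → partner M a ≡ c → partner M b ≢ d
Nonnesting  M = ∀ a b c d → a < b → b < c → c < d → partner M a ≡ d → partner M b ≢ c

NC NN : ℕ → Set
NC n = Σ (Matching n) Noncrossing
NN n = Σ (Matching n) Nonnesting

NC-setoid : ℕ → Setoid 0ℓ 0ℓ
NC-setoid n = On.setoid (matchingSetoid n) (proj₁ {B = Noncrossing})

noncrossing? : ∀ {n} (M : Matching n) → Dec (Noncrossing M)
noncrossing? M = all? λ a → all? λ b → all? λ c → all? λ d →
  (a <? b) →-dec ((b <? c) →-dec ((c <? d) →-dec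
    ((partner M a ≟ c) →-dec ¬? (partner M b ≟ d))))

toMatching : ∀ {n} → (Fin (2 * n) → Fin (2 * n)) → Maybe (Matching n)
toMatching f = Maybe.zipWith (λ inv nofix → record
    { partner = f ; involutive = inv ; no-fixpoint = nofix })
  (dec⇒maybe (all? λ i → f (f i) ≟ i))
  (dec⇒maybe (all? λ i → ¬? (f i ≟ i)))

-- Every noncrossing matching, exactly once: finToFun enumerates all
-- maps [2n] → [2n] without repetition.
noncrossings : ∀ n → List (NC n)
noncrossings n =
  mapMaybe (λ M → Maybe.map (M ,_) (dec⇒maybe (noncrossing? M)))
    (mapMaybe toMatching
      (List.map finToFun (allFin ((2 * n) ^ (2 * n)))))

-- The matching with arcs {σ(i), σ(j)} for the arcs {i, j} of M.
permuteMatching : ∀ {n} → Permutation′ (2 * n) → Matching n → Matching n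
permuteMatching σ M = record
  { partner     = λ i → σ ⟨$⟩ʳ partner M (σ ⟨$⟩ˡ i)
  ; involutive  = λ i → trans
      (cong (λ x → σ ⟨$⟩ʳ partner M x) (Perm.inverseˡ σ))
      (trans (cong (σ ⟨$⟩ʳ_) (involutive M _)) (Perm.inverseʳ σ))
  ; no-fixpoint = λ i eq → no-fixpoint M (σ ⟨$⟩ˡ i)
      (trans (sym (Perm.inverseˡ σ)) (cong (σ ⟨$⟩ˡ_) eq))
  }

-- A bijective filling; the position (r , k) is in row r and column k.
Tableau : ℕ → Set
Tableau n = (Fin 2 × Fin n) ↔ Fin (2 * n)

entry : ∀ {n} → Tableau n → Fin 2 → Fin n → Fin (2 * n)
entry T r k = Inverse.to T (r , k)

rowOf : ∀ {n} → Tableau n → Fin (2 * n) → Fin 2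
rowOf T i = proj₁ (Inverse.from T i)

Standard : ∀ {n} → Tableau n → Set
Standard T = (∀ r {k l} → k < l → entry T r k < entry T r l)
           × (∀ k → entry T 0F k < entry T 1F k)

permuteEntries : ∀ {n} → Permutation′ (2 * n) → Tableau n → Tableau n
permuteEntries σ T = σ ↔-∘ T

opposite-≢ : (r : Fin 2) → opposite r ≢ r
opposite-≢ 0F ()
opposite-≢ 1F ()

opposite² : (r : Fin 2) → opposite (opposite r) ≡ r
opposite² = Fin.opposite-involutive

columnMatching : ∀ {n} → Tableau n → Matching n
columnMatching T = record
  { partner     = λ i → let (r , k) = from i in to (opposite r , k)
  ; involutive  = λ i → let (r , k) = from i in
      trans (cong (λ x → to (opposite (proj₁ x) , proj₂ x)) (Inverse.strictlyInverseʳ T _))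
      (trans (cong (λ s → to (s , k)) (opposite² r)) (Inverse.strictlyInverseˡ T i))
  ; no-fixpoint = λ i eq → let (r , k) = from i in
      opposite-≢ r (cong proj₁
        (trans (sym (Inverse.strictlyInverseʳ T (opposite r , k))) (cong from eq)))
  }
  where open Inverse T using (to; from)

lookup-increasing : ∀ {m} {xs : List (Fin m)} → AllPairs _<_ xs →
                    ∀ {k l} → k < l → List.lookup xs k < List.lookup xs l
lookup-increasing (x<xs ∷ _)  {zero}  {suc l} _   = All.lookup x<xs (∈-lookup l)
lookup-increasing (_ ∷ pairs) {suc k} {suc l} k<l = lookup-increasing pairs (ℕ.s<s⁻¹ k<l)

-- The inverse of the bijection T ↦ columnMatching T from standard
-- tableaux to nonnesting matchings: the first row lists the openers in
-- increasing order.
module _ {n : ℕ} (M : Matching n) (nonnesting : Nonnesting M) where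
  private
    p = partner M

    opener? = λ i → i <? p i

    openers : List (Fin (2 * n))
    openers = filter opener? (allFin (2 * n))

    m : ℕ
    m = List.length openers

    op : Fin m → Fin (2 * n)
    op = List.lookup openers

    op-opener : ∀ k → op k < p (op k)
    op-opener k = proj₂ (∈-filter⁻ opener? {xs = allFin (2 * n)} (∈-lookup {xs = openers} k))

    op-increasing : ∀ {k l} → k < l → op k < op l
    op-increasing = lookup-increasing
      (AllPairs.filter⁺ opener? (AllPairs.tabulate⁺-< (λ i<j → i<j)))

    op-injective : ∀ {k l} → op k ≡ op l → k ≡ l
    op-injective {k} {l} eq with Fin.<-cmp k l
    ... | tri< k<l _ _ = ⊥-elim (Fin.<⇒≢ (op-increasing k<l) eq)
    ... | tri≈ _ k≡l _ = k≡l
    ... | tri> _ _ l<k = ⊥-elim (Fin.<⇒≢ (op-increasing l<k) (sym eq))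

    index : ∀ i → i < p i → Fin m
    index i i<pi = Any.index (∈-filter⁺ opener? (∈-allFin i) i<pi)

    op-index : ∀ i i<pi → op (index i i<pi) ≡ i
    op-index i i<pi = sym (lookup-index (∈-filter⁺ opener? (∈-allFin i) i<pi))

    closer : ∀ {i} → ¬ (i < p i) → p i < p (p i)
    closer {i} i≮pi with Fin.<-cmp i (p i)
    ... | tri< i<pi _ _ = ⊥-elim (i≮pi i<pi)
    ... | tri≈ _ i≡pi _ = ⊥-elim (no-fixpoint M i (sym i≡pi))
    ... | tri> _ _ pi<i = subst (p i <_) (sym (involutive M i)) pi<i

    to : Fin 2 × Fin m → Fin (2 * n)
    to (0F , k) = op k
    to (1F , k) = p (op k)

    from : Fin (2 * n) → Fin 2 × Fin m
    from i with opener? i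
    ... | yes i<pi = 0F , index i i<pi
    ... | no  i≮pi = 1F , index (p i) (closer i≮pi)

    to-from : ∀ i → to (from i) ≡ i
    to-from i with opener? i
    ... | yes i<pi = op-index i i<pi
    ... | no  i≮pi = trans (cong p (op-index (p i) _)) (involutive M i)

    opener≢closer : ∀ k l → op k ≢ p (op l)
    opener≢closer k l eq = Fin.<-asym (op-opener l)
      (subst₂ _<_ eq (trans (cong p eq) (involutive M _)) (op-opener k))

    to-injective : ∀ x y → to x ≡ to y → x ≡ y
    to-injective (0F , k) (0F , l) eq = cong (0F ,_) (op-injective eq)
    to-injective (0F , k) (1F , l) eq = ⊥-elim (opener≢closer k l eq)
    to-injective (1F , k) (0F , l) eq = ⊥-elim (opener≢closer l k (sym eq))
    to-injective (1F , k) (1F , l) eq = cong (1F ,_) (op-injective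
      (trans (sym (involutive M _)) (trans (cong p eq) (involutive M _))))

    Filling : ℕ → Set
    Filling l = Σ[ T ∈ ((Fin 2 × Fin l) ↔ Fin (2 * n)) ]
        (∀ {j k} → j < k → Inverse.to T (0F , j) < Inverse.to T (0F , k))
      × (∀ k → Inverse.to T (0F , k) < Inverse.to T (1F , k))
      × (∀ k → Inverse.to T (1F , k) ≡ p (Inverse.to T (0F , k)))

    filling : Filling n
    filling = subst Filling m≡n (T′ , op-increasing , op-opener , λ _ → refl)
      where
      T′ : (Fin 2 × Fin m) ↔ Fin (2 * n)
      T′ = mk↔ₛ′ to from to-from (λ x → to-injective _ _ (to-from (to x)))

      m≡n : m ≡ n
      m≡n = ℕ.*-cancelˡ-≡ m n 2 (↔⇒≡ (T′ ↔-∘ *↔×))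

  standardTableau : Σ[ T ∈ Tableau n ] Standard T × (partner (columnMatching T) ≗ p)
  standardTableau with filling
  ... | T , row₀ , column , arc = T , (rows , column) , joins
    where
    p-increasing : ∀ {i j} → i < j → j < p j → p i < p j
    p-increasing {i} {j} i<j j<pj with Fin.<-cmp (p i) (p j)
    ... | tri< pi<pj _ _ = pi<pj
    ... | tri≈ _ pi≡pj _ = ⊥-elim (Fin.<⇒≢ i<j
          (trans (sym (involutive M i)) (trans (cong p pi≡pj) (involutive M j))))
    ... | tri> _ _ pj<pi = ⊥-elim (nonnesting i j (p j) (p i) i<j j<pj pj<pi refl refl)

    rows : ∀ r {k l} → k < l → entry T r k < entry T r l
    rows 0F k<l = row₀ k<l
    rows 1F {k} {l} k<l = subst₂ _<_ (sym (arc k)) (sym (arc l))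
      (p-increasing (row₀ k<l) (subst (entry T 0F l <_) (arc l) (column l)))

    swapped : ∀ r k → entry T (opposite r) k ≡ p (entry T r k)
    swapped 0F k = arc k
    swapped 1F k = sym (trans (cong p (arc k)) (involutive M _))

    joins : ∀ i → partner (columnMatching T) i ≡ p i
    joins i = trans (swapped _ _) (cong p (Inverse.strictlyInverseˡ T i))

-- M₀ = {{1,2},{3,4},…,{2n-1,2n}}, obtained from the tableau with
-- columns (2k-1, 2k).
M₀-tableau : ∀ n → Tableau n
M₀-tableau n = cast-id (ℕ.*-comm n 2) ↔-∘ (↔-sym *↔× ↔-∘ ×-comm (Fin 2) (Fin n))

M₀ : ∀ n → NN n
M₀ n = columnMatching (M₀-tableau n) , nonnesting
  where
  T = M₀-tableau n

  toℕ-entry : ∀ r k → toℕ (entry T r k) ≡ 2 * toℕ k ℕ.+ toℕ r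
  toℕ-entry r k = trans (Fin.toℕ-cast (ℕ.*-comm n 2) (combine k r)) (Fin.toℕ-combine k r)

  close : ∀ i → toℕ (partner (columnMatching T) i) ℕ.≤ ℕ.suc (toℕ i)
  close i = subst (λ x → toℕ (entry T (opposite r) k) ℕ.≤ ℕ.suc (toℕ x))
    (Inverse.strictlyInverseˡ T i) (bound r)
    where
    k = proj₂ (Inverse.from T i)
    r = rowOf T i
    bound : ∀ r → toℕ (entry T (opposite r) k) ℕ.≤ ℕ.suc (toℕ (entry T r k))
    bound r rewrite toℕ-entry (opposite r) k | toℕ-entry r k = ℕ.≤-trans
      (ℕ.+-monoʳ-≤ (2 * toℕ k) (ℕ.≤-trans (ℕ.s≤s⁻¹ (Fin.toℕ<n (opposite r))) (ℕ.s≤s ℕ.z≤n)))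
      (ℕ.≤-reflexive (ℕ.+-suc (2 * toℕ k) (toℕ r)))

  nonnesting : Nonnesting (columnMatching T)
  nonnesting a b c d a<b b<c c<d pa≡d _ = ℕ.<⇒≱
    (ℕ.<-trans (ℕ.s≤s a<b) (ℕ.≤-<-trans b<c c<d))
    (subst (λ x → toℕ x ℕ.≤ ℕ.suc (toℕ a)) pa≡d (close a))

data Step : Set where
  N E : Step

Path : Set
Path = List Step

-- The lattice point (x , y) reached from (0,0).
endpoint : Path → ℕ × ℕ
endpoint []      = 0 , 0
endpoint (N ∷ s) = let (x , y) = endpoint s in x , ℕ.suc y
endpoint (E ∷ s) = let (x , y) = endpoint s in ℕ.suc x , y

Dyck : ℕ → Path → Set
Dyck n p = endpoint p ≡ (n , n)
         × (∀ t → let (x , y) = endpoint (List.take t p) in x ℕ.≤ y)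

-- (i , j) is the cell in column i and row j; indices start at 0, so its
-- upper-left corner is the point (i , j + 1).
Cell : ℕ → Set
Cell n = Fin n × Fin n

-- A cell lies below a path iff its upper-left corner is on or vertically
-- below a lattice point of the path.
Below : ∀ {n} → Path → Pred (Cell n) 0ℓ
Below p (i , j) = ∃[ t ] let (x , y) = endpoint (List.take t p) in
  x ≡ toℕ i × toℕ j ℕ.< y

-- Inclusion of the regions below two paths in the n × n grid.
RegionIncluded : ℕ → Path → Path → Set
RegionIncluded n p q = Below {n} p ⊆ Below q

-- The path D(M).
matchingPath : ∀ {n} → Matching n → Path
matchingPath M = List.tabulate λ i → if does (i <? partner M i) then N else E

MarkedBelow : ∀ {n} → Permutation′ n → Path → Set
MarkedBelow σ p = ∀ i → Below p (i , σ ⟨$⟩ʳ i)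

-- p is the path D(σ).
IsPermutationPath : ∀ {n} → Permutation′ n → Path → Set
IsPermutationPath {n} σ p = Dyck n p × MarkedBelow σ p
  × (∀ q → Dyck n q → MarkedBelow σ q → RegionIncluded n p q)

Cr : ∀ {n} → Permutation′ n → Pred (Cell n) 0ℓ
Cr σ (i , j) = σ ⟨$⟩ʳ i < j × i < σ ⟨$⟩ˡ j

-- The unit edges of the grid, standing for their midpoints: vertical i j
-- is the edge in row j on the line x = i, and horizontal i j is the edge
-- in column i on the line y = j.
data Edge (n : ℕ) : Set where
  vertical   : Fin (ℕ.suc n) → Fin n → Edge n
  horizontal : Fin n → Fin (ℕ.suc n) → Edge n

left right bottom top : ∀ {n} → Cell n → Edge n
left   (i , j) = vertical (inject₁ i) j
right  (i , j) = vertical (suc i) j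
bottom (i , j) = horizontal i (inject₁ j)
top    (i , j) = horizontal i (suc j)

-- The pieces of strand inside the cells of G(σ,F), for F ⊆ Cr σ.
data Piece {n} (σ : Permutation′ n) (F : Pred (Cell n) 0ℓ) : Rel (Edge n) 0ℓ where
  turn   : ∀ i → let c = (i , σ ⟨$⟩ʳ i) in Piece σ F (left c) (top c)
  across : ∀ i j → let c = (i , j) in
           i < σ ⟨$⟩ˡ j → c ∉ F → Piece σ F (left c) (right c)
  upward : ∀ i j → let c = (i , j) in
           σ ⟨$⟩ʳ i < j → c ∉ F → Piece σ F (bottom c) (top c)
  elbow₁ : ∀ {c} → F c → Piece σ F (left c) (bottom c)
  elbow₂ : ∀ {c} → F c → Piece σ F (right c) (top c)

Strand : ∀ {n} → Permutation′ n → Pred (Cell n) 0ℓ → Rel (Edge n) 0ℓ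
Strand σ F = EqClosure (Piece σ F)

-- The first n labels run up the left side, the last n along the top.
boundary : ∀ {n} → Fin (2 * n) → Edge n
boundary {n} a with remQuot {2} n a
... | 0F , j = vertical zero j
... | 1F , i = horizontal i (fromℕ n)

-- M is the matching M(σ,F).
IsGridMatching : ∀ {n} → Permutation′ n → Pred (Cell n) 0ℓ → Matching n → Set
IsGridMatching σ F M = ∀ a b →
  (partner M a ≡ b) ⇔ (a ≢ b × Strand σ F (boundary a) (boundary b))

_⪰_ : ∀ {n} → Rel (Cell n) 0ℓ
(x , y) ⪰ (x′ , y′) = x ≤ x′ × y′ ≤ y

Remaining : ∀ {n} → Permutation′ n → Pred (Cell n) 0ℓ → Pred (Cell n) 0ℓ
Remaining σ F c = Cr σ c × c ∉ F

MaximalRemaining : ∀ {n} → Permutation′ n → Pred (Cell n) 0ℓ → Pred (Cell n) 0ℓ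
MaximalRemaining σ F c = Remaining σ F c
  × (∀ {d} → Remaining σ F d → d ⪰ c → d ≡ c)

-- τ is the permutation σ′ obtained from σ by switching (i , j).
IsSwitch : ∀ {n} → Permutation′ n → Cell n → Permutation′ n → Set
IsSwitch σ (i , j) τ = τ ⟨$⟩ʳ i ≡ j
  × τ ⟨$⟩ʳ (σ ⟨$⟩ˡ j) ≡ σ ⟨$⟩ʳ i
  × (∀ k → k ≢ i → k ≢ σ ⟨$⟩ˡ j → τ ⟨$⟩ʳ k ≡ σ ⟨$⟩ʳ k)

-- Generated σ F: the configuration G(σ,F) occurs when starting from
-- G(id,∅) and resolving maximal remaining crossings.  Permutations are
-- taken up to pointwise equality.
data Generated {n} : Permutation′ n → Pred (Cell n) 0ℓ → Set₁ where
  start  : ∀ {σ} → σ Perm.≈ Perm.id → Generated σ ∅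
  smooth : ∀ {σ F c} → Generated σ F → MaximalRemaining σ F c →
           Generated σ (F ∪ ｛ c ｝)
  switch : ∀ {σ F c τ} → Generated σ F → MaximalRemaining σ F c →
           IsSwitch σ c τ → Generated τ F

WebPermutation : ∀ {n} → Permutation′ n → Set₁
WebPermutation σ = ∃[ F ] Generated σ F × F ≐ Cr σ

permutationSetoid : ℕ → Setoid 0ℓ 0ℓ
permutationSetoid n = record
  { Carrier       = Permutation′ n
  ; _≈_           = Perm._≈_
  ; isEquivalence = record
    { refl  = λ _ → refl
    ; sym   = λ p i → sym (p i)
    ; trans = λ p q i → trans (p i) (q i)
    }
  }

-- σ is a web permutation with D(σ) ⊆ D(M) and M(σ) = M′.
Contributes : ∀ {n} → NN n → NC n → Permutation′ n → Set₁
Contributes {n} (M , _) (M′ , _) σ = WebPermutation σ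
  × (∃[ p ] IsPermutationPath σ p × RegionIncluded n p (matchingPath M))
  × IsGridMatching σ (Cr σ) M′

subsetoid : ∀ {a ℓ p} (S : Setoid a ℓ) → Pred (Setoid.Carrier S) p → Setoid (a ⊔ p) ℓ
subsetoid S P = On.setoid S (proj₁ {B = P})

-- S has exactly k elements.
HasCardinality : ∀ {a ℓ} → Setoid a ℓ → ℕ → Set (a ⊔ ℓ)
HasCardinality S k = Inverse S (≡-setoid (Fin k))

module Spanned {r ℓr m ℓm a} {ring : Ring r ℓr} (V : LeftModule ring m ℓm)
               {I : Set a} (g : I → LeftModule.Carrierᴹ V) where
  open Ring ring using (Carrier)
  open LeftModule V

  data InSpan : Pred Carrierᴹ (a ⊔ r ⊔ m ⊔ ℓm) where
    generator : ∀ i → InSpan (g i)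
    zeroᴹ     : InSpan 0ᴹ
    add       : ∀ {x y} → InSpan x → InSpan y → InSpan (x +ᴹ y)
    scale     : ∀ c {x} → InSpan x → InSpan (c *ₗ x)
    respects  : ∀ {x y} → x ≈ᴹ y → InSpan x → InSpan y

  negate : ∀ {x} → InSpan x → InSpan (-ᴹ x)
  negate {x} s = respects (inverseˡ-uniqueᴹ _ _ vanishes) (scale (- 1#) s)
    where
    open Ring ring using (-_; 1#; 0#; _+_; -‿inverseˡ)
    open LeftModuleProperties V using (inverseˡ-uniqueᴹ)
    vanishes : (- 1#) *ₗ x +ᴹ x ≈ᴹ 0ᴹ
    vanishes = ≈ᴹ-trans (+ᴹ-cong ≈ᴹ-refl (≈ᴹ-sym (*ₗ-identityˡ x)))
      (≈ᴹ-trans (≈ᴹ-sym (*ₗ-distribʳ x (- 1#) 1#))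
      (≈ᴹ-trans (*ₗ-cong (-‿inverseˡ 1#) ≈ᴹ-refl) (*ₗ-zeroˡ x)))

  span : LeftModule ring (a ⊔ r ⊔ m ⊔ ℓm) ℓm
  span = record { isLeftModule = Mono.isLeftModule inclusion (Ring.isRing ring) isLeftModule }
    where
    raw : RawLeftModule Carrier (a ⊔ r ⊔ m ⊔ ℓm) ℓm
    raw = record
      { Carrierᴹ = ∃ InSpan
      ; _≈ᴹ_     = _≈ᴹ_ on proj₁
      ; _+ᴹ_     = λ (x , s) (y , t) → x +ᴹ y , add s t
      ; _*ₗ_     = λ c (x , s) → c *ₗ x , scale c s
      ; 0ᴹ       = 0ᴹ , zeroᴹ
      ; -ᴹ_      = λ (x , s) → -ᴹ x , negate s
      }
    inclusion : ModuleMorphism.LeftModuleMorphisms.IsLeftModuleMonomorphism raw rawLeftModule proj₁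
    inclusion = record
      { isLeftModuleHomomorphism = record
        { +ᴹ-isGroupHomomorphism = record
          { isMonoidHomomorphism = record
            { isMagmaHomomorphism = record
              { isRelHomomorphism = record { cong = λ eq → eq }
              ; homo = λ _ _ → ≈ᴹ-refl
              }
            ; ε-homo = ≈ᴹ-refl
            }
          ; ⁻¹-homo = λ _ → ≈ᴹ-refl
          }
        ; *ₗ-homo = λ _ _ → ≈ᴹ-refl
        }
      ; injective = λ eq → eq
      }

-- R[X] as the free commutative R-algebra on X: polynomial expressions
-- modulo the commutative R-algebra laws.
module Polynomials {c ℓ} (R : CommutativeRing c ℓ) (X : Set) where
  private module R = CommutativeRing R

  infixl 6 _⊕_
  infixl 7 _⊗_
  infix  8 ⊝_
  infix  4 _≃_

  data Poly : Set c where
    con     : R.Carrier → Poly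
    var     : X → Poly
    _⊕_ _⊗_ : Poly → Poly → Poly
    ⊝_      : Poly → Poly

  data _≃_ : Rel Poly (c ⊔ ℓ) where
    ≃-refl      : ∀ {p} → p ≃ p
    ≃-sym       : ∀ {p q} → p ≃ q → q ≃ p
    ≃-trans     : ∀ {p q s} → p ≃ q → q ≃ s → p ≃ s
    ⊕-cong      : ∀ {p p′ q q′} → p ≃ p′ → q ≃ q′ → p ⊕ q ≃ p′ ⊕ q′
    ⊗-cong      : ∀ {p p′ q q′} → p ≃ p′ → q ≃ q′ → p ⊗ q ≃ p′ ⊗ q′
    ⊝-cong      : ∀ {p p′} → p ≃ p′ → ⊝ p ≃ ⊝ p′
    ⊕-assoc     : ∀ p q s → (p ⊕ q) ⊕ s ≃ p ⊕ (q ⊕ s)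
    ⊕-comm      : ∀ p q → p ⊕ q ≃ q ⊕ p
    ⊕-identityˡ : ∀ p → con R.0# ⊕ p ≃ p
    ⊝-inverseˡ  : ∀ p → ⊝ p ⊕ p ≃ con R.0#
    ⊗-assoc     : ∀ p q s → (p ⊗ q) ⊗ s ≃ p ⊗ (q ⊗ s)
    ⊗-comm      : ∀ p q → p ⊗ q ≃ q ⊗ p
    ⊗-identityˡ : ∀ p → con R.1# ⊗ p ≃ p
    ⊗-distribˡ  : ∀ p q s → p ⊗ (q ⊕ s) ≃ p ⊗ q ⊕ p ⊗ s
    con-cong    : ∀ {a b} → a R.≈ b → con a ≃ con b
    con-⊕       : ∀ a b → con (a R.+ b) ≃ con a ⊕ con b
    con-⊗       : ∀ a b → con (a R.* b) ≃ con a ⊗ con b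

  polyRing : CommutativeRing c (c ⊔ ℓ)
  polyRing = record
    { _≈_ = _≃_ ; _+_ = _⊕_ ; _*_ = _⊗_ ; -_ = ⊝_ ; 0# = con R.0# ; 1# = con R.1#
    ; isCommutativeRing = record
      { isRing = record
        { +-isAbelianGroup = record
          { isGroup = record
            { isMonoid = record
              { isSemigroup = record
                { isMagma = record { isEquivalence = isEquivalence ; ∙-cong = ⊕-cong }
                ; assoc = ⊕-assoc
                }
              ; identity = ⊕-identityˡ , λ p → ≃-trans (⊕-comm _ _) (⊕-identityˡ p)
              }
            ; inverse = ⊝-inverseˡ , λ p → ≃-trans (⊕-comm _ _) (⊝-inverseˡ p)
            ; ⁻¹-cong = ⊝-cong
            }
          ; comm = ⊕-comm
          }
        ; *-cong = ⊗-cong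
        ; *-assoc = ⊗-assoc
        ; *-identity = ⊗-identityˡ , λ p → ≃-trans (⊗-comm _ _) (⊗-identityˡ p)
        ; distrib = ⊗-distribˡ , λ p q s → ≃-trans (⊗-comm _ _)
            (≃-trans (⊗-distribˡ p q s) (⊕-cong (⊗-comm _ _) (⊗-comm _ _)))
        }
      ; *-comm = ⊗-comm
      }
    }
    where
    isEquivalence : IsEquivalence _≃_
    isEquivalence = record { refl = ≃-refl ; sym = ≃-sym ; trans = ≃-trans }

  private module P = CommutativeRing polyRing

  polyModule : LeftModule R.ring c (c ⊔ ℓ)
  polyModule = record
    { _≈ᴹ_ = _≃_ ; _+ᴹ_ = _⊕_ ; _*ₗ_ = λ a p → con a ⊗ p ; 0ᴹ = con R.0# ; -ᴹ_ = ⊝_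
    ; isLeftModule = record
      { isLeftSemimodule = record
        { +ᴹ-isCommutativeMonoid = P.+-isCommutativeMonoid
        ; isPreleftSemimodule = record
          { *ₗ-cong      = λ a≈b p≃q → ⊗-cong (con-cong a≈b) p≃q
          ; *ₗ-zeroˡ     = P.zeroˡ
          ; *ₗ-distribʳ  = λ p a b → ≃-trans (⊗-cong (con-⊕ a b) ≃-refl) (P.distribʳ p _ _)
          ; *ₗ-identityˡ = ⊗-identityˡ
          ; *ₗ-assoc     = λ a b p → ≃-trans (⊗-cong (con-⊗ a b) ≃-refl) (⊗-assoc _ _ p)
          ; *ₗ-zeroʳ     = λ a → P.zeroʳ (con a)
          ; *ₗ-distribˡ  = λ a → ⊗-distribˡ (con a)
          }
        }
      ; -ᴹ‿cong    = ⊝-cong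
      ; -ᴹ‿inverse = P.-‿inverse
      }
    }

  rename : (X → X) → Poly → Poly
  rename f (con a) = con a
  rename f (var x) = var (f x)
  rename f (p ⊕ q) = rename f p ⊕ rename f q
  rename f (p ⊗ q) = rename f p ⊗ rename f q
  rename f (⊝ p)   = ⊝ rename f p

  rename-cong : ∀ f {p q} → p ≃ q → rename f p ≃ rename f q
  rename-cong f ≃-refl             = ≃-refl
  rename-cong f (≃-sym e)          = ≃-sym (rename-cong f e)
  rename-cong f (≃-trans d e)      = ≃-trans (rename-cong f d) (rename-cong f e)
  rename-cong f (⊕-cong d e)       = ⊕-cong (rename-cong f d) (rename-cong f e)
  rename-cong f (⊗-cong d e)       = ⊗-cong (rename-cong f d) (rename-cong f e)
  rename-cong f (⊝-cong e)         = ⊝-cong (rename-cong f e)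
  rename-cong f (⊕-assoc _ _ _)    = ⊕-assoc _ _ _
  rename-cong f (⊕-comm _ _)       = ⊕-comm _ _
  rename-cong f (⊕-identityˡ _)    = ⊕-identityˡ _
  rename-cong f (⊝-inverseˡ _)     = ⊝-inverseˡ _
  rename-cong f (⊗-assoc _ _ _)    = ⊗-assoc _ _ _
  rename-cong f (⊗-comm _ _)       = ⊗-comm _ _
  rename-cong f (⊗-identityˡ _)    = ⊗-identityˡ _
  rename-cong f (⊗-distribˡ _ _ _) = ⊗-distribˡ _ _ _
  rename-cong f (con-cong e)       = con-cong e
  rename-cong f (con-⊕ a b)        = con-⊕ a b
  rename-cong f (con-⊗ a b)        = con-⊗ a b

module Webs {c ℓ} (R : CommutativeRing c ℓ) (n : ℕ) where
  private module R = CommutativeRing R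

  -- var (r , i) is the indeterminate in row r and column i of z.
  open Polynomials R (Fin 2 × Fin (2 * n)) public
  private
    module P = CommutativeRing polyRing
    open Sum P.*-commutativeMonoid renaming (sum to product) using ()

  det : Fin (2 * n) → Fin (2 * n) → Poly
  det i j = var (0F , i) ⊗ var (1F , j) ⊕ ⊝ (var (0F , j) ⊗ var (1F , i))

  Δ : Matching n → Poly
  Δ M = product λ i → if does (i <? partner M i) then det i (partner M i) else con R.1#

  open Spanned polyModule Δ using (InSpan; generator; zeroᴹ; add; scale; respects; span)

  W : LeftModule R.ring (c ⊔ ℓ) (c ⊔ ℓ)
  W = span

  web : Matching n → LeftModule.Carrierᴹ W
  web M = Δ M , generator M

  permuteColumns : Permutation′ (2 * n) → Poly → Poly
  permuteColumns σ = rename λ (r , i) → r , σ ⟨$⟩ʳ i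

  private
    module Products where
      open Sum P.*-commutativeMonoid
        renaming (sum-cong-≋ to product-cong; sum-permute to product-permute; ∑-distrib-+ to product-⊗)
        using ()
      open import Relation.Binary.Reasoning.Setoid P.setoid

      -- Changing the orientation of some arcs only changes the sign.
      module Reorient (M : Matching n)
                      (d : Fin (2 * n) → Fin (2 * n) → Poly)
                      (d-alternating : ∀ i j → d i j ≃ con (R.- R.1#) ⊗ d j i)
                      where
        p = partner M

        swap : Permutation′ (2 * n)
        swap = permutation p p (involutive M) (involutive M)

        select : Bool → Poly → Poly
        select b q = if b then q else con R.1#

        oriented : (Fin (2 * n) → Bool) → Poly
        oriented o = product λ i → select (o i) (d i (p i))

        constant : ∀ {k} (f : Fin k → R.Carrier) → ∃[ a ] product (λ i → con (f i)) ≃ con a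
        constant {ℕ.zero}  f = R.1# , ≃-refl
        constant {ℕ.suc k} f = let (a , eq) = constant (λ i → f (suc i)) in
          f zero R.* a , ≃-trans (⊗-cong ≃-refl eq) (≃-sym (con-⊗ _ _))

        reorient : ∀ o o′ → (∀ i → o (p i) ≡ not (o i)) → (∀ i → o′ (p i) ≡ not (o′ i)) →
                   ∃[ a ] oriented o ≃ con a ⊗ oriented o′
        reorient o o′ flips flips′ = a , (begin
          oriented o
            ≈⟨ product-cong split ⟩
          product (λ i → con (s i) ⊗ (u i ⊗ v i))
            ≈⟨ product-⊗ (λ i → con (s i)) (λ i → u i ⊗ v i) ⟩
          product (λ i → con (s i)) ⊗ product (λ i → u i ⊗ v i)
            ≈⟨ ⊗-cong eq (product-⊗ u v) ⟩
          con a ⊗ (product u ⊗ product v)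
            ≈⟨ ⊗-cong ≃-refl (⊗-cong ≃-refl (product-permute v swap)) ⟩
          con a ⊗ (product u ⊗ product (λ i → v (p i)))
            ≈⟨ ⊗-cong ≃-refl (≃-sym (product-⊗ u (λ i → v (p i)))) ⟩
          con a ⊗ product (λ i → u i ⊗ v (p i))
            ≈⟨ ⊗-cong ≃-refl (product-cong merge) ⟩
          con a ⊗ oriented o′ ∎)
          where
          s : Fin (2 * n) → R.Carrier
          s i = if o i ∧ not (o′ i) then R.- R.1# else R.1#
          u v : Fin (2 * n) → Poly
          u i = select (o i ∧ o′ i) (d i (p i))
          v i = select (o i ∧ not (o′ i)) (d (p i) i)
          a = proj₁ (constant s)
          eq = proj₂ (constant s)

          split : ∀ i → select (o i) (d i (p i)) ≃ con (s i) ⊗ (u i ⊗ v i)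
          split i with o i | o′ i
          ... | false | _     = ≃-sym (≃-trans (⊗-identityˡ _) (⊗-identityˡ _))
          ... | true  | true  = ≃-sym (≃-trans (⊗-identityˡ _) (P.*-identityʳ _))
          ... | true  | false = ≃-trans (d-alternating i (p i)) (⊗-cong ≃-refl (≃-sym (⊗-identityˡ _)))

          merge : ∀ i → u i ⊗ v (p i) ≃ select (o′ i) (d i (p i))
          merge i rewrite flips i | flips′ i | involutive M i with o i | o′ i
          ... | true  | true  = P.*-identityʳ _
          ... | true  | false = ⊗-identityˡ _
          ... | false | true  = ⊗-identityˡ _
          ... | false | false = ⊗-identityˡ _

      det-alternating : ∀ i j → det i j ≃ con (R.- R.1#) ⊗ det j i
      det-alternating i j = ≃-sym (begin
        con (R.- R.1#) ⊗ det j i     ≈⟨ ⊗-cong con-⊝1 ≃-refl ⟩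
        ⊝ con R.1# ⊗ det j i         ≈⟨ -1*x≈-x _ ⟩
        ⊝ (y ⊕ ⊝ x)                  ≈⟨ -‿+-comm _ _ ⟨
        ⊝ y ⊕ ⊝ ⊝ x                  ≈⟨ ⊕-cong ≃-refl (-‿involutive _) ⟩
        ⊝ y ⊕ x                      ≈⟨ ⊕-comm _ _ ⟩
        det i j                      ∎)
        where
        open RingProperties P.ring
        x = var (0F , i) ⊗ var (1F , j)
        y = var (0F , j) ⊗ var (1F , i)
        con-⊝1 : con (R.- R.1#) ≃ ⊝ con R.1#
        con-⊝1 = +-inverseˡ-unique _ _
          (≃-trans (≃-sym (con-⊕ _ _)) (con-cong (R.-‿inverseˡ R.1#)))

      ascends : ∀ {k} {i j : Fin k} → i ≢ j → does (j <? i) ≡ not (does (i <? j))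
      ascends {i = i} {j} i≢j with Fin.<-cmp i j
      ... | tri< i<j _ j≮i = trans (dec-false (j <? i) j≮i) (sym (cong not (dec-true (i <? j) i<j)))
      ... | tri≈ _ i≡j _   = ⊥-elim (i≢j i≡j)
      ... | tri> i≮j _ j<i = trans (dec-true (j <? i) j<i) (sym (cong not (dec-false (i <? j) i≮j)))

      rename-product : ∀ f {k} (t : Fin k → Poly) →
                       rename f (product t) ≡ product (λ i → rename f (t i))
      rename-product f {ℕ.zero}  t = refl
      rename-product f {ℕ.suc k} t = cong (rename f (t zero) ⊗_) (rename-product f (λ i → t (suc i)))

      permute-web : ∀ σ M → ∃[ a ] permuteColumns σ (Δ M) ≃ con a ⊗ Δ (permuteMatching σ M)
      permute-web σ M = a , (begin
        permuteColumns σ (Δ M)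
          ≡⟨ rename-product _ {2 * n} _ ⟩
        product (λ i → permuteColumns σ (select (does (i <? p i)) (det i (p i))))
          ≈⟨ product-cong (λ i → renamed (does (i <? p i)) i) ⟩
        oriented (λ i → does (i <? p i))
          ≈⟨ eq ⟩
        con a ⊗ oriented o′
          ≈⟨ ⊗-cong ≃-refl (product-cong (λ i → P.reflexive
               (cong (λ x → select (does (σ ⟨$⟩ʳ i <? σ ⟨$⟩ʳ p x)) (det (σ ⟨$⟩ʳ i) (σ ⟨$⟩ʳ p x)))
                 (sym (Perm.inverseˡ σ {i}))))) ⟩
        con a ⊗ product (λ i → factor (σ ⟨$⟩ʳ i))
          ≈⟨ ⊗-cong ≃-refl (product-permute factor σ) ⟨
        con a ⊗ Δ (permuteMatching σ M) ∎)
        where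
        open Reorient M (λ i j → det (σ ⟨$⟩ʳ i) (σ ⟨$⟩ʳ j)) (λ _ _ → det-alternating _ _)
        p′ = partner (permuteMatching σ M)
        factor : Fin (2 * n) → Poly
        factor i = select (does (i <? p′ i)) (det i (p′ i))
        o′ : Fin (2 * n) → Bool
        o′ i = does (σ ⟨$⟩ʳ i <? σ ⟨$⟩ʳ p i)
        renamed : ∀ b i → permuteColumns σ (select b (det i (p i)))
                        ≃ select b (det (σ ⟨$⟩ʳ i) (σ ⟨$⟩ʳ p i))
        renamed true  i = ≃-refl
        renamed false i = ≃-refl
        σ-injective : ∀ {i j} → σ ⟨$⟩ʳ i ≡ σ ⟨$⟩ʳ j → i ≡ j
        σ-injective e = trans (sym (Perm.inverseˡ σ)) (trans (cong (σ ⟨$⟩ˡ_) e) (Perm.inverseˡ σ))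
        changed = reorient (λ i → does (i <? p i)) o′
          (λ i → trans (cong (λ x → does (p i <? x)) (involutive M i))
                       (ascends (λ e → no-fixpoint M i (sym e))))
          (λ i → trans (cong (λ x → does (σ ⟨$⟩ʳ p i <? σ ⟨$⟩ʳ x)) (involutive M i))
                       (ascends (λ e → no-fixpoint M i (sym (σ-injective e)))))
        a = proj₁ changed
        eq = proj₂ changed

  permuteColumns-InSpan : ∀ σ {p} → InSpan p → InSpan (permuteColumns σ p)
  permuteColumns-InSpan σ (generator M)  = let (a , eq) = Products.permute-web σ M in
    respects (≃-sym eq) (scale a (generator (permuteMatching σ M)))
  permuteColumns-InSpan σ zeroᴹ          = zeroᴹ
  permuteColumns-InSpan σ (add s t)      = add (permuteColumns-InSpan σ s) (permuteColumns-InSpan σ t)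
  permuteColumns-InSpan σ (scale a s)    = scale a (permuteColumns-InSpan σ s)
  permuteColumns-InSpan σ (respects e s) = respects (rename-cong _ e) (permuteColumns-InSpan σ s)

  _•_ : Permutation′ (2 * n) → LeftModule.Carrierᴹ W → LeftModule.Carrierᴹ W
  σ • (p , s) = permuteColumns σ p , permuteColumns-InSpan σ s

module Specht {c ℓ} (R : CommutativeRing c ℓ) (n : ℕ) where
  private
    module R = CommutativeRing R
    open Sum R.+-commutativeMonoid using (sum; sum-cong-≋)
    open Sum R.*-commutativeMonoid renaming (sum to product) using ()

  -- The tabloid {T} is the row equivalence class of T.
  tabloidSetoid : Setoid 0ℓ 0ℓ
  tabloidSetoid = record
    { Carrier       = Tableau n
    ; _≈_           = λ T S → rowOf T ≗ rowOf S
    ; isEquivalence = record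
      { refl  = λ _ → refl
      ; sym   = λ p i → sym (p i)
      ; trans = λ p q i → trans (p i) (q i)
      }
    }

  open Setoid tabloidSetoid using () renaming (_≈_ to _∼_)

  _∼?_ : ∀ T S → Dec (T ∼ S)
  T ∼? S = all? λ i → rowOf T i ≟ rowOf S i

  -- The free module on the finite set of tabloids, a linear combination
  -- of tabloids being given by its coefficients.
  tabloidModule : LeftModule R.ring (c ⊔ ℓ) ℓ
  tabloidModule = record
    { Carrierᴹ = Func tabloidSetoid R.setoid
    ; _≈ᴹ_     = λ f g → ∀ T → to f T R.≈ to g T
    ; _+ᴹ_     = λ f g → record
        { to = λ T → to f T R.+ to g T ; cong = λ e → R.+-cong (Func.cong f e) (Func.cong g e) }
    ; _*ₗ_     = λ a f → record
        { to = λ T → a R.* to f T ; cong = λ e → R.*-congˡ (Func.cong f e) }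
    ; 0ᴹ       = record { to = λ _ → R.0# ; cong = λ _ → R.refl }
    ; -ᴹ_      = λ f → record
        { to = λ T → R.- to f T ; cong = λ e → R.-‿cong (Func.cong f e) }
    ; isLeftModule = record
      { isLeftSemimodule = record
        { +ᴹ-isCommutativeMonoid = record
          { isMonoid = record
            { isSemigroup = record
              { isMagma = record
                { isEquivalence = record
                  { refl  = λ _ → R.refl
                  ; sym   = λ p T → R.sym (p T)
                  ; trans = λ p q T → R.trans (p T) (q T)
                  }
                ; ∙-cong = λ p q T → R.+-cong (p T) (q T)
                }
              ; assoc = λ _ _ _ _ → R.+-assoc _ _ _
              }
            ; identity = (λ _ _ → R.+-identityˡ _) , (λ _ _ → R.+-identityʳ _)
            }
          ; comm = λ _ _ _ → R.+-comm _ _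
          }
        ; isPreleftSemimodule = record
          { *ₗ-cong      = λ a≈b p T → R.*-cong a≈b (p T)
          ; *ₗ-zeroˡ     = λ _ _ → R.zeroˡ _
          ; *ₗ-distribʳ  = λ _ _ _ _ → R.distribʳ _ _ _
          ; *ₗ-identityˡ = λ _ _ → R.*-identityˡ _
          ; *ₗ-assoc     = λ _ _ _ _ → R.*-assoc _ _ _
          ; *ₗ-zeroʳ     = λ _ _ → R.zeroʳ _
          ; *ₗ-distribˡ  = λ _ _ _ _ → R.distribˡ _ _ _
          }
        }
      ; -ᴹ‿cong    = λ p T → R.-‿cong (p T)
      ; -ᴹ‿inverse = (λ _ _ → R.-‿inverseˡ _) , (λ _ _ → R.-‿inverseʳ _)
      }
    }
    where open Func using (to)

  -- The coefficient of {S} in {T}.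
  indicator : Tableau n → Tableau n → R.Carrier
  indicator T S = if does (T ∼? S) then R.1# else R.0#

  -- The column stabilizer of T is the product over all columns of the
  -- group of permutations of its two entries.  Its elements π are indexed
  -- by maps ε : Fin n → Fin 2, where π exchanges the entries of column k
  -- iff ε k = 1; swapColumns ε T is πT.
  swapColumns : (Fin n → Fin 2) → Tableau n → Tableau n
  swapColumns ε T = T ↔-∘ mk↔ₛ′ swap swap swap² swap²
    where
    flip : Fin 2 → Fin 2 → Fin 2
    flip 0F r = r
    flip 1F r = opposite r
    flip² : ∀ e r → flip e (flip e r) ≡ r
    flip² 0F r = refl
    flip² 1F r = opposite² r
    swap : Fin 2 × Fin n → Fin 2 × Fin n
    swap (r , k) = flip (ε k) r , k
    swap² : ∀ x → swap (swap x) ≡ x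
    swap² (r , k) = cong (_, k) (flip² (ε k) r)

  -- sgn π: every exchange is a transposition.
  sgn : (Fin n → Fin 2) → R.Carrier
  sgn ε = product λ k → if does (ε k ≟ 1F) then R.- R.1# else R.1#

  -- finToFun enumerates the maps Fin n → Fin 2.
  polytabloid : Tableau n → LeftModule.Carrierᴹ tabloidModule
  polytabloid T = record
    { to   = λ S → sum λ e → sgn (finToFun e) R.* indicator (swapColumns (finToFun e) T) S
    ; cong = λ {S} {S′} S∼S′ → sum-cong-≋ {2 ^ n} λ e →
        R.*-congˡ (R.reflexive (cong (λ b → if b then R.1# else R.0#)
          (does-⇔ (mk⇔ (λ T∼S i → trans (T∼S i) (S∼S′ i)) (λ T∼S′ i → trans (T∼S′ i) (sym (S∼S′ i))))
                  (swapColumns (finToFun e) T ∼? S) (swapColumns (finToFun e) T ∼? S′))))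
    }

  open Spanned tabloidModule polytabloid using (InSpan; generator; zeroᴹ; add; scale; respects; span)

  S⁽ⁿⁿ⁾ : LeftModule R.ring (c ⊔ ℓ) ℓ
  S⁽ⁿⁿ⁾ = span

  v : NN n → LeftModule.Carrierᴹ S⁽ⁿⁿ⁾
  v (M , nonnesting) = let T = proj₁ (standardTableau M nonnesting) in
    polytabloid T , generator T

  -- The coefficient of {T} in σf is the coefficient of {σ⁻¹T} in f.
  permuteTabloids : Permutation′ (2 * n) → LeftModule.Carrierᴹ tabloidModule →
                    LeftModule.Carrierᴹ tabloidModule
  permuteTabloids σ f = record
    { to   = λ T → Func.to f (permuteEntries (Perm.flip σ) T)
    ; cong = λ T∼S → Func.cong f λ i → T∼S (σ ⟨$⟩ʳ i)
    }

  permuteTabloids-polytabloid : ∀ σ T S →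
    Func.to (polytabloid (permuteEntries σ T)) S R.≈ Func.to (permuteTabloids σ (polytabloid T)) S
  permuteTabloids-polytabloid σ T S = sum-cong-≋ {2 ^ n} λ e →
    R.*-congˡ (R.reflexive (cong (λ b → if b then R.1# else R.0#) (does-⇔
      (mk⇔ (λ h i → trans (cong (λ x → rowOf (swapColumns (finToFun e) T) x) (sym (Perm.inverseˡ σ)))
                          (h (σ ⟨$⟩ʳ i)))
           (λ h i → trans (h (σ ⟨$⟩ˡ i)) (cong (rowOf S) (Perm.inverseʳ σ {i}))))
      (swapColumns (finToFun e) (permuteEntries σ T) ∼? S)
      (swapColumns (finToFun e) T ∼? permuteEntries (Perm.flip σ) S))))

  permuteTabloids-InSpan : ∀ σ {f} → InSpan f → InSpan (permuteTabloids σ f)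
  permuteTabloids-InSpan σ (generator T)  =
    respects (permuteTabloids-polytabloid σ T) (generator (permuteEntries σ T))
  permuteTabloids-InSpan σ zeroᴹ          = zeroᴹ
  permuteTabloids-InSpan σ (add s t)      = add (permuteTabloids-InSpan σ s) (permuteTabloids-InSpan σ t)
  permuteTabloids-InSpan σ (scale a s)    = scale a (permuteTabloids-InSpan σ s)
  permuteTabloids-InSpan σ (respects e s) = respects (λ T → e _) (permuteTabloids-InSpan σ s)

  _•_ : Permutation′ (2 * n) → LeftModule.Carrierᴹ S⁽ⁿⁿ⁾ → LeftModule.Carrierᴹ S⁽ⁿⁿ⁾
  σ • (f , s) = permuteTabloids σ f , permuteTabloids-InSpan σ s

fieldRing : ∀ {c ℓ₁ ℓ₂} → HeytingField c ℓ₁ ℓ₂ → CommutativeRing c ℓ₁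
fieldRing K = HeytingCommutativeRing.commutativeRing (HeytingField.heytingCommutativeRing K)

CharacteristicZero : ∀ {c ℓ₁ ℓ₂} → HeytingField c ℓ₁ ℓ₂ → Set ℓ₂
CharacteristicZero K = ∀ k → (ℕ.suc k ×ᴷ 1#) # 0#
  where
  open HeytingField K using (_#_; 0#; 1#)
  open Mult (CommutativeRing.+-monoid (fieldRing K)) using () renaming (_×_ to _×ᴷ_)

-- The scalars R are to be a field of characteristic zero, such as ℂ.
module Transition {c ℓ} (R : CommutativeRing c ℓ) (n : ℕ) where
  private module R = CommutativeRing R

  open Webs R n public using (W; web) renaming (_•_ to _•ᵂ_)
  open Specht R n public using (S⁽ⁿⁿ⁾; v) renaming (_•_ to _•ˢ_)
  open CommutativeRing R public using (_≈_) renaming (setoid to scalars)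
  open LeftModule S⁽ⁿⁿ⁾ using (_≈ᴹ_; _*ₗ_; +ᴹ-commutativeMonoid)
  open Sum +ᴹ-commutativeMonoid using (sum)
  open ModuleMorphism.LeftModuleMorphisms (LeftModule.rawLeftModule W) (LeftModule.rawLeftModule S⁽ⁿⁿ⁾)
    using (IsLeftModuleIsomorphism)

  -- φ is an isomorphism of 𝔖₂ₙ-modules with φ(Δ_{M₀}) = v_{M₀}.
  record IsNormalizedIsomorphism
         (φ : LeftModule.Carrierᴹ W → LeftModule.Carrierᴹ S⁽ⁿⁿ⁾) : Set (c ⊔ ℓ) where
    field
      isomorphism : IsLeftModuleIsomorphism φ
      equivariant : ∀ σ x → φ (σ •ᵂ x) ≈ᴹ σ •ˢ φ x
      normalized  : φ (web (proj₁ (M₀ n))) ≈ᴹ v (M₀ n)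

  -- The defining property of the entries a_{MM′}, with w_{M′} = φ(Δ_{M′}).
  -- As a Func, each row of a depends only on the matching M′.
  IsTransitionMatrix : (φ : LeftModule.Carrierᴹ W → LeftModule.Carrierᴹ S⁽ⁿⁿ⁾) →
                       (a : NN n → Func (NC-setoid n) scalars) → Set ℓ
  IsTransitionMatrix φ a = ∀ M → v M ≈ᴹ
    sum λ k → let M′ = List.lookup (noncrossings n) k in
      Func.to (a M) M′ *ₗ φ (web (proj₁ M′))

  -- k ·1 is the natural number k as a scalar.
  _·1 : ℕ → R.Carrier
  k ·1 = k ×ᴿ R.1#
    where open Mult R.+-monoid using () renaming (_×_ to _×ᴿ_)

{-# OPTIONS --safe #-}

-- The 𝔖₂ₙ-module structure determines φ on products of minors: φ takes the product
-- of the minors of the columns of a tableau T to v_T, hence Δ_M to v_M for nonnesting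
-- M, and Δ_M is to be expanded in the web basis.  Draw M in the region below its Dyck
-- path with every strand turning on the diagonal, and resolve the crossings from the
-- upper left with the three-term relation Δ_wy Δ_xz = Δ_wx Δ_yz + Δ_wz Δ_xy.
-- Smoothing a cell exchanges the labels carried by its two strands, switching it
-- changes the permutation and marks the cell for good, so each permutation is reached
-- at most once.  A permutation is reached iff no switch lowers the mark of its column
-- when it is rebuilt column by column; every order of resolution preserves this
-- property, so the permutations reached are the web permutations below the path.  The
-- crossings above the path, all smoothed, carry the labels of the full grid unchanged
-- to the path, so the labels also give M(σ).  The coefficients can be compared because
-- the coefficient of Δ_M′ at the monomial of the openers of M is unitriangular.

module Submission where

open import Defs
open import Algebra.Apartness.Bundles using (HeytingField)
open import Algebra.Bundles using (CommutativeMonoid; CommutativeRing)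
open import Algebra.Module.Bundles using (LeftModule)
import Algebra.Module.Morphism.Structures as ModuleMorphism
import Algebra.Properties.CommutativeMonoid.Sum as Sum
import Algebra.Properties.Group as GroupProperties
import Algebra.Properties.Ring as RingProperties
import Algebra.Solver.Ring.NaturalCoefficients.Default as SemiringSolver
open import Data.Bool.Base using (Bool; true; false; not; if_then_else_)
import Data.Bool.Properties as Bool
open import Data.Empty using (⊥-elim)
open import Data.Fin.Base
  using (Fin; zero; suc; toℕ; fromℕ; fromℕ<; inject₁; opposite; punchOut; combine; remQuot;
         _↑ˡ_; _↑ʳ_; finToFun; funToFin; _<_)
  renaming (_≤_ to _≤ᶠ_)
open import Data.Fin.Induction using (<-weakInduction; >-weakInduction)
open import Data.Fin.Patterns using (0F; 1F)
open import Data.Fin.Permutation as Perm using (Permutation′; permutation; _⟨$⟩ʳ_; _⟨$⟩ˡ_; _∘ₚ_)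
import Data.Fin.Permutation.Components as PC
open import Data.Fin.Properties as Fin
  using (_≟_; _<?_; all?; any?; injective⇒≤; *↔×; finToFun-funToFin; funToFin-finToFin)
open import Data.List.Base as List
  using (List; []; _∷_; _++_; [_]; foldr; replicate; take; tabulate; allFin; mapMaybe; filter; length; lookup)
import Data.List.Properties as List
open import Data.List.Membership.Propositional using (find; lose) renaming (_∈_ to _∈ˡ_)
open import Data.List.Membership.Propositional.Properties
  using (∈-∃++; ∈-++⁺ˡ; ∈-++⁺ʳ; ∈-filter⁺; ∈-lookup; ∈-allFin)
open import Data.List.Relation.Unary.All as All using (All; []; _∷_)
import Data.List.Relation.Unary.All.Properties as All
open import Data.List.Relation.Unary.AllPairs as AllPairs using (AllPairs; []; _∷_)
import Data.List.Relation.Unary.AllPairs.Properties as AllPairs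
open import Data.List.Relation.Unary.Any as Any using (Any; here; there)
import Data.List.Relation.Unary.Any.Properties as Any
open import Data.Maybe.Base as Maybe using (Maybe; just; nothing)
open import Data.Nat.Base as ℕ using (ℕ; _≤_; _+_; _*_; _∸_; _⊔_; _^_)
open import Data.Nat.Induction using (<-rec)
import Data.Nat.Properties as ℕ
open import Data.Product.Base using (∃-syntax; _×_; _,_; proj₁; proj₂)
open import Data.Product.Properties using (≡-dec)
open import Data.Sum.Base as ⊎ using (_⊎_; inj₁; inj₂)
open import Data.Vec.Functional using (updateAt)
open import Data.Vec.Functional.Properties using (updateAt-updates; updateAt-minimal)
open import Function.Base using (_∘_; case_of_; const)
open import Function.Bundles using (Func; Inverse; Equivalence; _⇔_; mk⇔; mk↔ₛ′)
open import Function.Construct.Composition using (_↔-∘_)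
open import Function.Construct.Symmetry using (↔-sym)
import Function.Properties.Equivalence as ⇔
open import Level using (Level; 0ℓ)
open import Relation.Binary.Bundles using (Setoid)
open import Relation.Binary.Construct.Closure.Equivalence as EqClosure using ()
open import Relation.Binary.Core using (Rel)
open import Relation.Binary.Definitions using (tri<; tri≈; tri>)
open import Relation.Binary.PropositionalEquality
  using (_≡_; _≢_; _≗_; refl; sym; trans; cong; cong₂; subst; subst₂)
open import Relation.Binary.Structures using (IsEquivalence)
open import Relation.Nullary using (¬_; Dec; yes; no; does; contradiction)
import Relation.Nullary.Decidable as Dec
open import Relation.Nullary.Decidable
  using (_×-dec_; _⊎-dec_; ¬?; dec-true; dec-false; dec⇒maybe; does-⇔)
open import Relation.Unary using (Pred; Decidable; ∅; _∪_; ｛_｝)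

-- Two obstacles shape the proof. A web permutation comes with a history of resolutions in any
-- admissible order, whereas Δ_M is expanded along one fixed order of the cells. No confluence
-- statement links the two: `Ascending` is a condition on σ alone, implied by every history and
-- sufficient for the fixed order to reach σ. The induction over histories needs the stronger
-- `Guided`, which also records smoothed crossings; this is where the maximality of the resolved
-- crossing enters.
--
-- The other obstacle is that a strand is a path in a drawing. Boundary labels are pushed to the
-- right along rows and downwards along columns, so that a strand becomes a pair of labels meeting
-- at a marked cell and planarity becomes a set of inequalities between labels. The same labels
-- drive the algebra: the current product always consists of the minors of the two labels that meet
-- in each column.
--
-- No signs have to be tracked, because every minor is written with the row label before the column
-- label and the three-term relation is arranged to respect this.

private
  variable
    n : ℕ
    ℓ₁ ℓ₂ : Level
    A B : Set ℓ₁

-- Transpositions and switches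

transpose-matchˡ : (i j : Fin n) → PC.transpose i j i ≡ j
transpose-matchˡ i j with i ≟ i
... | yes _   = refl
... | no  i≢i = contradiction refl i≢i

transpose-matchʳ : (i j : Fin n) → PC.transpose i j j ≡ i
transpose-matchʳ i j with j ≟ i
... | yes j≡i = j≡i
... | no  _ with j ≟ j
...   | yes _   = refl
...   | no  j≢j = contradiction refl j≢j

transpose-other : {i j k : Fin n} → k ≢ i → k ≢ j → PC.transpose i j k ≡ k
transpose-other {i = i} {j} {k} k≢i k≢j with k ≟ i
... | yes k≡i = contradiction k≡i k≢i
... | no  _ with k ≟ j
...   | yes k≡j = contradiction k≡j k≢j
...   | no  _   = refl

transpose-self : (i k : Fin n) → PC.transpose i i k ≡ k
transpose-self i k = case k ≟ i of λ where
    (yes refl) → transpose-matchˡ k k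
    (no k≢i)   → transpose-other k≢i k≢i

transpose-conjugate : (s : Fin n → Fin n) → (∀ {x y} → s x ≡ s y → x ≡ y) → ∀ i j k →
                      PC.transpose (s i) (s j) (s k) ≡ s (PC.transpose i j k)
transpose-conjugate s s-injective i j k with k ≟ i
... | yes refl = transpose-matchˡ (s i) (s j)
... | no  k≢i with k ≟ j
...   | yes refl = transpose-matchʳ (s i) (s j)
...   | no  k≢j  = transpose-other (k≢i ∘ s-injective) (k≢j ∘ s-injective)

transpose-injective : (i j : Fin n) → ∀ {x y} → PC.transpose i j x ≡ PC.transpose i j y → x ≡ y
transpose-injective i j eq = trans (sym (PC.transpose-inverse j i))
  (trans (cong (PC.transpose j i) eq) (PC.transpose-inverse j i))

⟨$⟩ʳ-injective : (σ : Permutation′ n) → ∀ {i j} → σ ⟨$⟩ʳ i ≡ σ ⟨$⟩ʳ j → i ≡ j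
⟨$⟩ʳ-injective σ eq =
  trans (sym (Perm.inverseˡ σ)) (trans (cong (σ ⟨$⟩ˡ_) eq) (Perm.inverseˡ σ))

⟨$⟩ˡ-unique : (σ : Permutation′ n) → ∀ {i j} → σ ⟨$⟩ʳ i ≡ j → σ ⟨$⟩ˡ j ≡ i
⟨$⟩ˡ-unique σ eq = trans (cong (σ ⟨$⟩ˡ_) (sym eq)) (Perm.inverseˡ σ)

⟨$⟩ʳ-unique : (σ : Permutation′ n) → ∀ {i j} → σ ⟨$⟩ˡ j ≡ i → σ ⟨$⟩ʳ i ≡ j
⟨$⟩ʳ-unique σ eq = trans (cong (σ ⟨$⟩ʳ_) (sym eq)) (Perm.inverseʳ σ)

≈⇒ˡ : {σ τ : Permutation′ n} → σ Perm.≈ τ → ∀ j → σ ⟨$⟩ˡ j ≡ τ ⟨$⟩ˡ j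
≈⇒ˡ {σ = σ} {τ} σ≈τ j = ⟨$⟩ˡ-unique σ (trans (σ≈τ _) (Perm.inverseʳ τ))

Cr? : (σ : Permutation′ n) → Decidable (Cr σ)
Cr? σ (i , j) = (σ ⟨$⟩ʳ i <? j) ×-dec (i <? σ ⟨$⟩ˡ j)

Cr-resp-≈ : {σ τ : Permutation′ n} → σ Perm.≈ τ → ∀ {c} → Cr σ c → Cr τ c
Cr-resp-≈ {σ = σ} {τ} σ≈τ {i , j} (p , q) =
  subst (_< j) (σ≈τ i) p , subst (i <_) (≈⇒ˡ {σ = σ} {τ} σ≈τ j) q

switchAt : Permutation′ n → Cell n → Permutation′ n
switchAt σ (i , j) = σ ∘ₚ Perm.transpose (σ ⟨$⟩ʳ i) j

switchAt-IsSwitch : (σ : Permutation′ n) → ∀ c → IsSwitch σ c (switchAt σ c)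
switchAt-IsSwitch σ (i , j) =
    transpose-matchˡ (σ ⟨$⟩ʳ i) j
  , trans (cong (PC.transpose (σ ⟨$⟩ʳ i) j) (Perm.inverseʳ σ)) (transpose-matchʳ (σ ⟨$⟩ʳ i) j)
  , λ k k≢i k≢b → transpose-other (k≢i ∘ ⟨$⟩ʳ-injective σ)
      (λ eq → k≢b (sym (⟨$⟩ˡ-unique σ eq)))

IsSwitch⇒transpose : {σ τ : Permutation′ n} → ∀ {i j} → IsSwitch σ (i , j) τ →
                     ∀ k → τ ⟨$⟩ʳ k ≡ PC.transpose (σ ⟨$⟩ʳ i) j (σ ⟨$⟩ʳ k)
IsSwitch⇒transpose {σ = σ} {τ} {i} {j} (τi , τb , τk) k with σ ⟨$⟩ʳ k ≟ σ ⟨$⟩ʳ i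
... | yes eq = trans (cong (τ ⟨$⟩ʳ_) (⟨$⟩ʳ-injective σ eq)) τi
... | no  k≢i with σ ⟨$⟩ʳ k ≟ j
...   | yes eq = trans (cong (τ ⟨$⟩ʳ_) (sym (⟨$⟩ˡ-unique σ eq))) τb
...   | no k≢b = τk k (k≢i ∘ cong (σ ⟨$⟩ʳ_)) (λ eq → k≢b (⟨$⟩ʳ-unique σ (sym eq)))

module Switch {n} {σ τ : Permutation′ n} {i j : Fin n}
              (sw : IsSwitch σ (i , j) τ) (cr : Cr σ (i , j)) where

  a b : Fin n
  a = σ ⟨$⟩ʳ i
  b = σ ⟨$⟩ˡ j

  a<j : a < j
  a<j = proj₁ cr

  i<b : i < b
  i<b = proj₂ cr

  col-i : τ ⟨$⟩ʳ i ≡ j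
  col-i = proj₁ sw

  col-b : τ ⟨$⟩ʳ b ≡ a
  col-b = proj₁ (proj₂ sw)

  col-other : ∀ {k} → k ≢ i → k ≢ b → τ ⟨$⟩ʳ k ≡ σ ⟨$⟩ʳ k
  col-other = proj₂ (proj₂ sw) _

  row-j : τ ⟨$⟩ˡ j ≡ i
  row-j = ⟨$⟩ˡ-unique τ col-i

  row-a : τ ⟨$⟩ˡ a ≡ b
  row-a = ⟨$⟩ˡ-unique τ col-b

  row-other : ∀ {y} → y ≢ j → y ≢ a → τ ⟨$⟩ˡ y ≡ σ ⟨$⟩ˡ y
  row-other {y} y≢j y≢a = ⟨$⟩ˡ-unique τ (trans
    (col-other (y≢a ∘ λ eq → sym (⟨$⟩ʳ-unique σ eq))
               (λ eq → y≢j (trans (sym (Perm.inverseʳ σ)) (trans (cong (σ ⟨$⟩ʳ_) eq) (Perm.inverseʳ σ)))))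
    (Perm.inverseʳ σ))

  row-σi : σ ⟨$⟩ˡ a ≡ i
  row-σi = Perm.inverseˡ σ

  -- Membership in Cr at d = (x , y) only depends on column x and row y, and the
  -- comparisons there are unaffected unless x ≥ i and y ≤ j.
  crossing : ∀ {d} → ¬ ((i , j) ⪰ d) → Cr σ d ⇔ Cr τ d
  crossing {x , y} ¬⪰ = mk⇔
    (λ (p , q) → col→ (x ≟ i) (x ≟ b) p , row→ (y ≟ j) (y ≟ a) q)
    (λ (p , q) → col← (x ≟ i) (x ≟ b) p , row← (y ≟ j) (y ≟ a) q)
    where
    j<y : i ≤ᶠ x → j < y
    j<y i≤x = ℕ.≰⇒> λ y≤j → ¬⪰ (i≤x , y≤j)
    x<i : y ≤ᶠ j → x < i
    x<i y≤j = ℕ.≰⇒> λ i≤x → ¬⪰ (i≤x , y≤j)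
    col→ : Dec (x ≡ i) → Dec (x ≡ b) → σ ⟨$⟩ʳ x < y → τ ⟨$⟩ʳ x < y
    col→ (yes refl) _ p = subst (_< y) (sym col-i) (j<y ℕ.≤-refl)
    col→ (no _) (yes refl) p = subst (_< y) (sym col-b) (ℕ.<-trans a<j (j<y (ℕ.<⇒≤ i<b)))
    col→ (no x≢i) (no x≢b) p = subst (_< y) (sym (col-other x≢i x≢b)) p
    col← : Dec (x ≡ i) → Dec (x ≡ b) → τ ⟨$⟩ʳ x < y → σ ⟨$⟩ʳ x < y
    col← (yes refl) _ p = ℕ.<-trans a<j (j<y ℕ.≤-refl)
    col← (no _) (yes refl) p = subst (_< y) (sym (Perm.inverseʳ σ)) (j<y (ℕ.<⇒≤ i<b))
    col← (no x≢i) (no x≢b) p = subst (_< y) (col-other x≢i x≢b) p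
    row→ : Dec (y ≡ j) → Dec (y ≡ a) → x < σ ⟨$⟩ˡ y → x < τ ⟨$⟩ˡ y
    row→ (yes refl) _ q = subst (x <_) (sym row-j) (x<i ℕ.≤-refl)
    row→ (no _) (yes refl) q = subst (x <_) (sym row-a) (ℕ.<-trans (x<i (ℕ.<⇒≤ a<j)) i<b)
    row→ (no y≢j) (no y≢a) q = subst (x <_) (sym (row-other y≢j y≢a)) q
    row← : Dec (y ≡ j) → Dec (y ≡ a) → x < τ ⟨$⟩ˡ y → x < σ ⟨$⟩ˡ y
    row← (yes refl) _ q = ℕ.<-trans (x<i ℕ.≤-refl) i<b
    row← (no _) (yes refl) q = subst (x <_) (sym row-σi) (x<i (ℕ.<⇒≤ a<j))
    row← (no y≢j) (no y≢a) q = subst (x <_) (row-other y≢j y≢a) q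

  -- The marks that disappear, (i , a) and (b , j), and those that appear, (i , j) and (b , a), all
  -- lie weakly to the right of and below (i , j).
  marked : ∀ {x y} → ¬ ((i , j) ⪰ (x , y)) → (σ ⟨$⟩ʳ x ≡ y) ⇔ (τ ⟨$⟩ʳ x ≡ y)
  marked {x} {y} ¬⪰ = mk⇔ (to (x ≟ i) (x ≟ b)) (from (x ≟ i) (x ≟ b))
    where
    to : Dec (x ≡ i) → Dec (x ≡ b) → σ ⟨$⟩ʳ x ≡ y → τ ⟨$⟩ʳ x ≡ y
    to (yes refl) _ refl = ⊥-elim (¬⪰ (ℕ.≤-refl , ℕ.<⇒≤ a<j))
    to (no _) (yes refl) eq = ⊥-elim (¬⪰ (ℕ.<⇒≤ i<b , Fin.≤-reflexive (trans (sym eq) (Perm.inverseʳ σ))))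
    to (no x≢i) (no x≢b) eq = trans (col-other x≢i x≢b) eq
    from : Dec (x ≡ i) → Dec (x ≡ b) → τ ⟨$⟩ʳ x ≡ y → σ ⟨$⟩ʳ x ≡ y
    from (yes refl) _ eq = ⊥-elim (¬⪰ (ℕ.≤-refl , Fin.≤-reflexive (trans (sym eq) col-i)))
    from (no _) (yes refl) eq = ⊥-elim (¬⪰ (ℕ.<⇒≤ i<b , ℕ.≤-trans (Fin.≤-reflexive (trans (sym eq) col-b)) (ℕ.<⇒≤ a<j)))
    from (no x≢i) (no x≢b) eq = trans (sym (col-other x≢i x≢b)) eq

-- Switching column by column at the marks of σ

guideFrom : ∀ {m} → (Fin m → Cell n) → Permutation′ n → Fin (ℕ.suc m) → Permutation′ n
guideFrom c π zero                  = π
guideFrom {m = ℕ.suc m} c π (suc k) = guideFrom (c ∘ suc) (switchAt π (c zero)) k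

-- The definition peels off the first column; the inductions below append the last one.
guideFrom-suc : ∀ {m} (c : Fin m → Cell n) π k →
                guideFrom c π (suc k) ≡ switchAt (guideFrom c π (inject₁ k)) (c k)
guideFrom-suc c π zero    = refl
guideFrom-suc c π (suc k) = guideFrom-suc (c ∘ suc) (switchAt π (c zero)) k

mark : Permutation′ n → Fin n → Cell n
mark σ i = i , σ ⟨$⟩ʳ i

guide : Permutation′ n → Fin (ℕ.suc n) → Permutation′ n
guide σ = guideFrom (mark σ) Perm.id

guide-suc : (σ : Permutation′ n) → ∀ k →
            guide σ (suc k) ≡ switchAt (guide σ (inject₁ k)) (mark σ k)
guide-suc σ = guideFrom-suc (mark σ) Perm.id

-- The switch in column k exchanges the current value of k with σ k. An earlier column holds
-- neither, by injectivity of the current permutation and of σ.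
guide-agrees : (σ : Permutation′ n) → ∀ k {x} → toℕ x ℕ.< toℕ k → guide σ k ⟨$⟩ʳ x ≡ σ ⟨$⟩ʳ x
guide-agrees σ = <-weakInduction _ (λ ()) step
  where
  step : ∀ k → (∀ {x} → toℕ x ℕ.< toℕ (inject₁ k) → guide σ (inject₁ k) ⟨$⟩ʳ x ≡ σ ⟨$⟩ʳ x) →
         ∀ {x} → x < suc k → guide σ (suc k) ⟨$⟩ʳ x ≡ σ ⟨$⟩ʳ x
  step k ih {x} x<sk rewrite guide-suc σ k with x ≟ k
  ... | yes refl = transpose-matchˡ (guide σ (inject₁ k) ⟨$⟩ʳ k) _
  ... | no  x≢k  = trans (transpose-other (x≢k ∘ ⟨$⟩ʳ-injective (guide σ (inject₁ k)))
                           (λ eq → x≢k (⟨$⟩ʳ-injective σ (trans (sym (ih x<k)) eq)))) (ih x<k)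
    where x<k = subst (toℕ x ℕ.<_) (sym (Fin.toℕ-inject₁ k))
                  (ℕ.≤∧≢⇒< (ℕ.s≤s⁻¹ x<sk) (x≢k ∘ Fin.toℕ-injective))

guide-last : (σ : Permutation′ n) → guide σ (fromℕ n) Perm.≈ σ
guide-last {n} σ x = guide-agrees σ (fromℕ n)
  (subst (toℕ x ℕ.<_) (sym (Fin.toℕ-fromℕ n)) (Fin.toℕ<n x))

-- This property characterizes the web permutations.
Ascending : Permutation′ n → Set
Ascending σ = ∀ k → guide σ (inject₁ k) ⟨$⟩ʳ k ≤ᶠ σ ⟨$⟩ʳ k

Strict : Permutation′ n → Fin n → Set
Strict σ k = guide σ (inject₁ k) ⟨$⟩ʳ k < σ ⟨$⟩ʳ k

-- When the mark of column k comes from a switch, it was a maximal remaining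
-- crossing, so every crossing above it has been smoothed.
Guided : Permutation′ n → Pred (Cell n) 0ℓ → Set
Guided σ F = Ascending σ × (∀ k → Strict σ k → ∀ {d} → Cr σ d → d ⪰ mark σ k → F d)

guide-id : {σ : Permutation′ n} → σ Perm.≈ Perm.id → ∀ k x → guide σ k ⟨$⟩ʳ x ≡ x
guide-id {σ = σ} σ≈id = <-weakInduction _ (λ _ → refl) step
  where
  step : ∀ k → (∀ x → guide σ (inject₁ k) ⟨$⟩ʳ x ≡ x) → ∀ x → guide σ (suc k) ⟨$⟩ʳ x ≡ x
  step k ih x rewrite guide-suc σ k | ih k | ih x | σ≈id k = transpose-self k x

-- A generated F is a finite union of singletons. Deciding membership is what lets `smoothed` below
-- exploit the maximality of a switched crossing.
Generated-decidable : {σ : Permutation′ n} {F : Pred (Cell n) 0ℓ} → Generated σ F → Decidable F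
Generated-decidable (start _)        d = no λ ()
Generated-decidable (smooth {c = c} g _) d =
  Generated-decidable g d ⊎-dec Dec.map′ sym sym (≡-dec _≟_ _≟_ d c)
  where open import Data.Product.Properties using (≡-dec)
Generated-decidable (switch g _ _)   d = Generated-decidable g d

-- A switch at a maximal crossing keeps the configuration guided

module GuidedSwitch {n} {σ τ : Permutation′ n} {F : Pred (Cell n) 0ℓ} (F? : Decidable F) {i j : Fin n}
                    (guided : Guided σ F) (maximal : MaximalRemaining σ F (i , j))
                    (sw : IsSwitch σ (i , j) τ) where

  cr : Cr σ (i , j)
  cr = proj₁ (proj₁ maximal)

  open Switch {σ = σ} {τ} sw cr

  s : Fin n → Fin n
  s = PC.transpose a j

  τ-s : ∀ k → τ ⟨$⟩ʳ k ≡ s (σ ⟨$⟩ʳ k)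
  τ-s = IsSwitch⇒transpose {σ = σ} {τ} sw

  -- Above a mark that came from a strict step all crossings are smoothed, but (i , j) is still
  -- remaining. Hence the columns i and b have trivial steps in the rebuilding of σ.
  not-above : ∀ k → Strict σ k → ¬ ((i , j) ⪰ mark σ k)
  not-above k strict above = proj₂ (proj₁ maximal) (proj₂ guided k strict cr above)

  guide-tight : ∀ k → (i , j) ⪰ mark σ k → guide σ (inject₁ k) ⟨$⟩ʳ k ≡ σ ⟨$⟩ʳ k
  guide-tight k above with ℕ.m≤n⇒m<n∨m≡n (proj₁ guided k)
  ... | inj₁ strict = ⊥-elim (not-above k strict above)
  ... | inj₂ eq     = Fin.toℕ-injective eq

  tight-i : guide σ (inject₁ i) ⟨$⟩ʳ i ≡ a
  tight-i = guide-tight i (ℕ.≤-refl , ℕ.<⇒≤ a<j)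

  tight-b : guide σ (inject₁ b) ⟨$⟩ʳ b ≡ j
  tight-b = trans (guide-tight b (ℕ.<⇒≤ i<b , Fin.≤-reflexive (Perm.inverseʳ σ))) (Perm.inverseʳ σ)

  SwitchedGuide : Fin (ℕ.suc n) → Set
  SwitchedGuide k =
      (toℕ k ℕ.≤ toℕ i → ∀ x → guide τ k ⟨$⟩ʳ x ≡ guide σ k ⟨$⟩ʳ x)
    × (toℕ i ℕ.< toℕ k → ∀ x → guide τ k ⟨$⟩ʳ x ≡ s (guide σ k ⟨$⟩ʳ x))

  -- The two rebuildings diverge in column i, where the step of σ is trivial by `tight-i` and that
  -- of τ exchanges a and j. Afterwards each step of τ is the conjugate by `s` of the step of σ.
  switched-guide : ∀ k → SwitchedGuide k
  switched-guide = <-weakInduction _ ((λ _ _ → refl) , (λ ())) step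
    where
    step : ∀ k → SwitchedGuide (inject₁ k) → SwitchedGuide (suc k)
    step k (before , after) rewrite guide-suc τ k | guide-suc σ k | Fin.toℕ-inject₁ k =
      (λ k<i x → cong₂ (λ f y → f y)
         (cong₂ PC.transpose (before (ℕ.<⇒≤ k<i) k)
           (col-other (Fin.<⇒≢ k<i) (Fin.<⇒≢ (ℕ.<-trans k<i i<b))))
         (before (ℕ.<⇒≤ k<i) x))
      , after′
      where
      g h : Fin n → Fin n
      g = guide σ (inject₁ k) ⟨$⟩ʳ_
      h = guide τ (inject₁ k) ⟨$⟩ʳ_
      after′ : toℕ i ℕ.< ℕ.suc (toℕ k) → ∀ x →
               PC.transpose (h k) (τ ⟨$⟩ʳ k) (h x) ≡ s (PC.transpose (g k) (σ ⟨$⟩ʳ k) (g x))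
      after′ i≤k x with k ≟ i
      ... | yes refl rewrite before ℕ.≤-refl k | before ℕ.≤-refl x | tight-i | col-i =
            cong s (sym (transpose-self a (g x)))
      ... | no  k≢i = later (ℕ.≤∧≢⇒< (ℕ.s≤s⁻¹ i≤k) (λ eq → k≢i (sym (Fin.toℕ-injective eq))))
        where
        later : i < k → PC.transpose (h k) (τ ⟨$⟩ʳ k) (h x) ≡ s (PC.transpose (g k) (σ ⟨$⟩ʳ k) (g x))
        later i<k rewrite after i<k k | after i<k x | τ-s k =
          transpose-conjugate s (transpose-injective a j) (g k) (σ ⟨$⟩ʳ k) (g x)

  data Position (k : Fin n) : Set where
    early : k < i → τ ⟨$⟩ʳ k ≡ σ ⟨$⟩ʳ k → guide τ (inject₁ k) ⟨$⟩ʳ k ≡ guide σ (inject₁ k) ⟨$⟩ʳ k →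
            Position k
    at-i  : k ≡ i → Position k
    at-b  : k ≡ b → guide τ (inject₁ k) ⟨$⟩ʳ k ≡ τ ⟨$⟩ʳ k → Position k
    late  : i < k → k ≢ b → τ ⟨$⟩ʳ k ≡ σ ⟨$⟩ʳ k →
            guide τ (inject₁ k) ⟨$⟩ʳ k ≤ᶠ guide σ (inject₁ k) ⟨$⟩ʳ k →
            (Strict τ k → Strict σ k) → Position k

  private
    toℕ-i≤ : ∀ {k : Fin n} → k ≤ᶠ i → toℕ (inject₁ k) ℕ.≤ toℕ i
    toℕ-i≤ {k} = subst (ℕ._≤ toℕ i) (sym (Fin.toℕ-inject₁ k))

    toℕ-i< : ∀ {k : Fin n} → i < k → toℕ i ℕ.< toℕ (inject₁ k)
    toℕ-i< {k} = subst (toℕ i ℕ.<_) (sym (Fin.toℕ-inject₁ k))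

  position : ∀ k → Position k
  position k with Fin.<-cmp k i
  ... | tri< k<i k≢i _ = early k<i (col-other k≢i (Fin.<⇒≢ (ℕ.<-trans k<i i<b)))
                           (proj₁ (switched-guide (inject₁ k)) (toℕ-i≤ (ℕ.<⇒≤ k<i)) k)
  ... | tri≈ _ k≡i _ = at-i k≡i
  ... | tri> _ k≢i i<k with k ≟ b
  ...   | yes refl = at-b refl (trans (proj₂ (switched-guide (inject₁ b)) (toℕ-i< i<b) b)
                       (trans (cong s tight-b) (trans (transpose-matchʳ a j) (sym col-b))))
  ...   | no  k≢b = late i<k k≢b (col-other k≢i k≢b)
                      (proj₁ compare) (proj₂ compare)
    where
    u = guide σ (inject₁ k) ⟨$⟩ʳ k
    u≢a : u ≢ a
    u≢a eq = k≢i (⟨$⟩ʳ-injective (guide σ (inject₁ k))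
      (trans eq (sym (guide-agrees σ (inject₁ k) (toℕ-i< i<k)))))
    σk≢j : σ ⟨$⟩ʳ k ≢ j
    σk≢j eq = k≢b (sym (⟨$⟩ˡ-unique σ eq))
    -- The value `u` is not a, which column i holds, so `s` either fixes it or lowers it from j to
    -- a. In the latter case the step of σ is strict, since j is the value of σ at b and not at k.
    compare : guide τ (inject₁ k) ⟨$⟩ʳ k ≤ᶠ u × (Strict τ k → Strict σ k)
    compare rewrite proj₂ (switched-guide (inject₁ k)) (toℕ-i< i<k) k | col-other k≢i k≢b with u ≟ j
    ... | yes u≡j = subst (_≤ᶠ u) (sym (trans (cong s u≡j) (transpose-matchʳ a j)))
                      (ℕ.<⇒≤ (subst (a <_) (sym u≡j) a<j))
                  , λ _ → ℕ.≤∧≢⇒< (proj₁ guided k)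
                            (λ eq → σk≢j (trans (sym (Fin.toℕ-injective eq)) u≡j))
    ... | no  u≢j rewrite transpose-other u≢a u≢j = ℕ.≤-refl , λ p → p

  ascending : Ascending τ
  ascending k with position k
  ... | early _ τk gk = subst₂ _≤ᶠ_ (sym gk) (sym τk) (proj₁ guided k)
  ... | at-i refl = subst₂ _≤ᶠ_
        (sym (trans (proj₁ (switched-guide (inject₁ i)) (toℕ-i≤ ℕ.≤-refl) i) tight-i)) (sym col-i) (ℕ.<⇒≤ a<j)
  ... | at-b _ eq = Fin.≤-reflexive eq
  ... | late _ _ τk gk _ = ℕ.≤-trans gk (subst (_ ≤ᶠ_) (sym τk) (proj₁ guided k))

  private
    below-c : ∀ {k} → i < k → k ≢ b → Strict σ k → ∀ {d} → d ⪰ mark σ k → ¬ ((i , j) ⪰ d)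
    below-c i<k k≢b strict (x≤k , σk≤y) (i≤x , y≤j) =
      not-above _ strict (ℕ.<⇒≤ i<k , ℕ.≤-trans σk≤y y≤j)

  smoothed : ∀ k → Strict τ k → ∀ {d} → Cr τ d → d ⪰ mark τ k → F d
  smoothed k strict {d} crd d⪰ with position k
  ... | early k<i τk gk = proj₂ guided k (subst₂ _<_ gk τk strict)
        (Equivalence.from (crossing λ (i≤x , _) → ℕ.<⇒≱ k<i (ℕ.≤-trans i≤x (proj₁ d⪰))) crd)
        (proj₁ d⪰ , subst (_≤ᶠ proj₂ d) τk (proj₂ d⪰))
  ... | at-b _ eq = contradiction (cong toℕ eq) (ℕ.<⇒≢ strict)
  ... | late i<k k≢b τk gk strict′ = proj₂ guided k (strict′ strict)
        (Equivalence.from (crossing (below-c i<k k≢b (strict′ strict) d⪰′)) crd) d⪰′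
    where d⪰′ = proj₁ d⪰ , subst (_≤ᶠ proj₂ d) τk (proj₂ d⪰)
  -- A crossing of τ above (i , j) and different from it is also a crossing of σ. If it were not in
  -- F, maximality would make it (i , j), which is marked in τ and hence no crossing.
  ... | at-i refl with F? d
  ...   | yes Fd = Fd
  ...   | no ¬Fd = ⊥-elim (ℕ.<⇒≱ (proj₁ crd) (subst (_ ≤ᶠ_)
          (sym (trans (cong (τ ⟨$⟩ʳ_) (cong proj₁ d≡c)) col-i)) (Fin.≤-reflexive (cong proj₂ d≡c))))
    where
    d≢c : d ≢ (i , j)
    d≢c refl = ℕ.<-irrefl (cong toℕ col-i) (proj₁ crd)
    j≤y : j ≤ᶠ proj₂ d
    j≤y = subst (_≤ᶠ proj₂ d) col-i (proj₂ d⪰)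
    d≡c : d ≡ (i , j)
    d≡c = proj₂ maximal (Equivalence.from (crossing λ (i≤x , y≤j) → d≢c (cong₂ _,_
            (Fin.toℕ-injective (ℕ.≤-antisym (proj₁ d⪰) i≤x))
            (Fin.toℕ-injective (ℕ.≤-antisym y≤j j≤y)))) crd , ¬Fd) (proj₁ d⪰ , j≤y)

Generated⇒Guided : {σ : Permutation′ n} {F : Pred (Cell n) 0ℓ} → Generated σ F → Guided σ F
Generated⇒Guided {σ = σ} (start σ≈id) = (λ k → Fin.≤-reflexive (tight k)) ,
  λ k strict → contradiction (cong toℕ (tight k)) (ℕ.<⇒≢ strict)
  where
  tight : ∀ k → guide σ (inject₁ k) ⟨$⟩ʳ k ≡ σ ⟨$⟩ʳ k
  tight k = trans (guide-id {σ = σ} σ≈id (inject₁ k) k) (sym (σ≈id k))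
Generated⇒Guided (smooth g maximal) = let (up , above) = Generated⇒Guided g in
  up , λ k strict cr d⪰ → inj₁ (above k strict cr d⪰)
Generated⇒Guided (switch {σ = σ} {c = i , j} {τ} g maximal sw) = ascending , smoothed
  where open GuidedSwitch {σ = σ} {τ} (Generated-decidable g) (Generated⇒Guided g) maximal sw

web⇒ascending : {σ : Permutation′ n} → WebPermutation σ → Ascending σ
web⇒ascending (_ , g , _) = proj₁ (Generated⇒Guided g)

-- Labels of the edges of the grid

-- One column is read upwards from height y: at the first elbow the strand bends to the left and has
-- the label v of that row; without an elbow it runs to the top and has the label t.
carry : ∀ {m} → (Fin m → Bool) → (Fin m → A) → A → Fin (ℕ.suc m) → A
carry {m = ℕ.zero}  x v t zero    = t
carry {m = ℕ.suc m} x v t zero    = if x zero then v zero else carry (x ∘ suc) (v ∘ suc) t zero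
carry {m = ℕ.suc m} x v t (suc y) = carry (x ∘ suc) (v ∘ suc) t y

carry-last : ∀ {m} (x : Fin m → Bool) (v : Fin m → A) t → carry x v t (fromℕ m) ≡ t
carry-last {m = ℕ.zero}  x v t = refl
carry-last {m = ℕ.suc m} x v t = carry-last (x ∘ suc) (v ∘ suc) t

carry-inject₁ : ∀ {m} (x : Fin m → Bool) (v : Fin m → A) t j →
                carry x v t (inject₁ j) ≡ (if x j then v j else carry x v t (suc j))
carry-inject₁ x v t zero    = refl
carry-inject₁ x v t (suc j) = carry-inject₁ (x ∘ suc) (v ∘ suc) t j

sweep : (Fin n → Bool) → (Fin n → A) → A → Fin n → A
sweep x v t j = if x j then carry x v t (suc j) else v j

sweeps : ∀ {m} → (Fin m → Fin n → Bool) → (Fin n → A) → (Fin m → A) → Fin (ℕ.suc m) → Fin n → A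
sweeps x v t zero                  = v
sweeps {m = ℕ.suc m} x v t (suc k) = sweeps (x ∘ suc) (sweep (x zero) v (t zero)) (t ∘ suc) k

sweeps-suc : ∀ {m} (x : Fin m → Fin n → Bool) (v : Fin n → A) t k →
             sweeps x v t (suc k) ≡ sweep (x k) (sweeps x v t (inject₁ k)) (t k)
sweeps-suc x v t zero    = refl
sweeps-suc x v t (suc k) = sweeps-suc (x ∘ suc) (sweep (x zero) v (t zero)) (t ∘ suc) k

-- The labels v on the left and t on the top of the grid are carried along the
-- strands, which are straight outside X and form elbows in X; the edges that
-- belong to no strand get junk labels.
module Labels {n} {A : Set} {X : Pred (Cell n) 0ℓ} (X? : Decidable X) (v t : Fin n → A) where

  x : Fin n → Fin n → Bool
  x i j = does (X? (i , j))

  V : Fin (ℕ.suc n) → Fin n → A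
  V = sweeps x v t

  H : Fin n → Fin (ℕ.suc n) → A
  H i = carry (x i) (V (inject₁ i)) (t i)

  H-last : ∀ i → H i (fromℕ n) ≡ t i
  H-last i = carry-last (x i) (V (inject₁ i)) (t i)

  V-elbow : ∀ {i j} → X (i , j) → V (suc i) j ≡ H i (suc j)
  V-elbow {i} {j} Xc rewrite sweeps-suc x v t i | dec-true (X? (i , j)) Xc = refl

  V-straight : ∀ {i j} → ¬ X (i , j) → V (suc i) j ≡ V (inject₁ i) j
  V-straight {i} {j} ¬Xc rewrite sweeps-suc x v t i | dec-false (X? (i , j)) ¬Xc = refl

  H-elbow : ∀ {i j} → X (i , j) → H i (inject₁ j) ≡ V (inject₁ i) j
  H-elbow {i} {j} Xc rewrite carry-inject₁ (x i) (V (inject₁ i)) (t i) j | dec-true (X? (i , j)) Xc = refl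

  H-straight : ∀ {i j} → ¬ X (i , j) → H i (inject₁ j) ≡ H i (suc j)
  H-straight {i} {j} ¬Xc rewrite carry-inject₁ (x i) (V (inject₁ i)) (t i) j | dec-false (X? (i , j)) ¬Xc = refl

injective⇒surjective : ∀ {m} (f : Fin m → Fin m) → (∀ {x y} → f x ≡ f y → x ≡ y) →
                       ∀ y → ∃[ x ] f x ≡ y
injective⇒surjective {ℕ.suc m} f f-injective y with any? (λ x → f x ≟ y)
... | yes p = p
... | no ¬p = contradiction (injective⇒≤ {f = λ x → punchOut (y≢f x)}
    (λ eq → f-injective (Fin.punchOut-injective (y≢f _) (y≢f _) eq))) ℕ.1+n≰n
  where
  y≢f : ∀ x → y ≢ f x
  y≢f x eq = ¬p (x , sym eq)

leftLabel topLabel : Fin n → Fin (2 * n)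
leftLabel = combine {2} 0F
topLabel  = combine {2} 1F

toℕ-leftLabel : (j : Fin n) → toℕ (leftLabel j) ≡ toℕ j
toℕ-leftLabel {n} j = trans (Fin.toℕ-combine {2} 0F j) (cong (_+ toℕ j) (ℕ.*-zeroʳ n))

toℕ-topLabel : (i : Fin n) → toℕ (topLabel i) ≡ n + toℕ i
toℕ-topLabel {n} i = trans (Fin.toℕ-combine {2} 1F i) (cong (_+ toℕ i) (ℕ.*-identityʳ n))

boundary-left : (j : Fin n) → boundary (leftLabel j) ≡ vertical zero j
boundary-left {n} j rewrite Fin.remQuot-combine {2} {n} 0F j = refl

boundary-top : (i : Fin n) → boundary (topLabel i) ≡ horizontal i (fromℕ n)
boundary-top {n} i rewrite Fin.remQuot-combine {2} {n} 1F i = refl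

-- The strands of a configuration with all crossings smoothed

module Grid {n} (σ : Permutation′ n) where

  open Labels (Cr? σ) leftLabel topLabel public

  startLabel endLabel : Fin n → Fin (2 * n)
  startLabel i = V (inject₁ i) (σ ⟨$⟩ʳ i)
  endLabel   i = H i (suc (σ ⟨$⟩ʳ i))

  private
    uncrossed-row : ∀ {i j} → σ ⟨$⟩ˡ j ≤ᶠ i → ¬ Cr σ (i , j)
    uncrossed-row b≤i (_ , i<b) = ℕ.<⇒≱ i<b b≤i

    uncrossed-col : ∀ {i j} → j ≤ᶠ σ ⟨$⟩ʳ i → ¬ Cr σ (i , j)
    uncrossed-col j≤a (a<j , _) = ℕ.<⇒≱ a<j j≤a

    Live : Fin (ℕ.suc n) → Fin n → Set
    Live x j = toℕ x ℕ.≤ toℕ (σ ⟨$⟩ˡ j)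

    live-inject₁ : ∀ {i j} → i ≤ᶠ σ ⟨$⟩ˡ j → Live (inject₁ i) j
    live-inject₁ {i} = subst (ℕ._≤ _) (sym (Fin.toℕ-inject₁ i))

    live-suc⇒ : ∀ {i j} → Live (suc i) j → Live (inject₁ i) j
    live-suc⇒ = live-inject₁ ∘ ℕ.<⇒≤

    live-mark : ∀ i → Live (inject₁ i) (σ ⟨$⟩ʳ i)
    live-mark i = live-inject₁ (Fin.≤-reflexive (sym (Perm.inverseˡ σ)))

  -- From its mark onwards a row has no crossing, so the junk labels there repeat the one that
  -- arrived at the mark. The label of a strand can thus be read off at the right border, and
  -- likewise at the bottom border for columns.
  V-after-mark : ∀ j x → toℕ (σ ⟨$⟩ˡ j) ℕ.≤ toℕ x → V x j ≡ V (inject₁ (σ ⟨$⟩ˡ j)) j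
  V-after-mark j = <-weakInduction _
    (λ b≤0 → cong (λ x → V x j) (Fin.toℕ-injective (sym (trans (Fin.toℕ-inject₁ _) (ℕ.n≤0⇒n≡0 b≤0)))))
    step
    where
    b = σ ⟨$⟩ˡ j
    step : ∀ i → (toℕ b ℕ.≤ toℕ (inject₁ i) → V (inject₁ i) j ≡ V (inject₁ b) j) →
           toℕ b ℕ.≤ ℕ.suc (toℕ i) → V (suc i) j ≡ V (inject₁ b) j
    step i ih b≤1+i with Fin.<-cmp i b
    ... | tri< i<b _ _ = cong (λ x → V x j) (Fin.toℕ-injective
          (trans (ℕ.≤-antisym i<b b≤1+i) (sym (Fin.toℕ-inject₁ b))))
    ... | tri≈ _ refl _ = V-straight (uncrossed-row ℕ.≤-refl)
    ... | tri> _ _ b<i = trans (V-straight (uncrossed-row (ℕ.<⇒≤ b<i)))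
          (ih (subst (toℕ b ℕ.≤_) (sym (Fin.toℕ-inject₁ i)) (ℕ.<⇒≤ b<i)))

  V-end : ∀ i → V (fromℕ n) (σ ⟨$⟩ʳ i) ≡ startLabel i
  V-end i = trans (V-after-mark _ _ (ℕ.<⇒≤ (subst (toℕ (σ ⟨$⟩ˡ (σ ⟨$⟩ʳ i)) ℕ.<_) (sym (Fin.toℕ-fromℕ n)) (Fin.toℕ<n _))))
                  (cong (λ b → V (inject₁ b) (σ ⟨$⟩ʳ i)) (Perm.inverseˡ σ))

  H-after-mark : ∀ i y → toℕ y ℕ.≤ ℕ.suc (toℕ (σ ⟨$⟩ʳ i)) → H i y ≡ endLabel i
  H-after-mark i = >-weakInduction _
    (λ n≤ → cong (H i) (Fin.toℕ-injective (ℕ.≤-antisym n≤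
       (subst (toℕ (σ ⟨$⟩ʳ i) ℕ.<_) (sym (Fin.toℕ-fromℕ n)) (Fin.toℕ<n _)))))
    step
    where
    step : ∀ j → (ℕ.suc (toℕ j) ℕ.≤ ℕ.suc (toℕ (σ ⟨$⟩ʳ i)) → H i (suc j) ≡ endLabel i) →
           toℕ (inject₁ j) ℕ.≤ ℕ.suc (toℕ (σ ⟨$⟩ʳ i)) → H i (inject₁ j) ≡ endLabel i
    step j ih j≤ rewrite Fin.toℕ-inject₁ j with ℕ.m≤n⇒m<n∨m≡n j≤
    ... | inj₁ j<1+a = trans (H-straight (uncrossed-col (ℕ.s≤s⁻¹ j<1+a))) (ih j<1+a)
    ... | inj₂ j≡1+a = cong (H i) (Fin.toℕ-injective (trans (Fin.toℕ-inject₁ j) j≡1+a))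

  H-end : ∀ i → H i zero ≡ endLabel i
  H-end i = H-after-mark i zero ℕ.z≤n

  -- The planarity invariant on the vertical line x: strands meet it in the order of their labels,
  -- and no top label of a column to its right has been used yet.
  Sorted : Fin (ℕ.suc n) → Set
  Sorted x = (∀ {j k} → Live x j → Live x k → j < k → V x j < V x k)
           × (∀ j → toℕ (V x j) ℕ.< n + toℕ x)

  module Column (i : Fin n) (sorted : Sorted (inject₁ i)) where
    private
      a = σ ⟨$⟩ʳ i

    V-bound : ∀ j → toℕ (V (inject₁ i) j) ℕ.< n + toℕ i
    V-bound j = subst (λ k → toℕ (V (inject₁ i) j) ℕ.< n + k) (Fin.toℕ-inject₁ i) (proj₂ sorted j)

    H-bound : ∀ y → toℕ (H i y) ℕ.≤ n + toℕ i
    H-bound = >-weakInduction _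
      (subst (λ l → toℕ l ℕ.≤ n + toℕ i) (sym (H-last i)) (ℕ.≤-reflexive (toℕ-topLabel i)))
      (λ j ih → case Cr? σ (i , j) of λ where
        (yes cr) → subst (λ l → toℕ l ℕ.≤ n + toℕ i) (sym (H-elbow cr)) (ℕ.<⇒≤ (V-bound j))
        (no ¬cr) → subst (λ l → toℕ l ℕ.≤ n + toℕ i) (sym (H-straight ¬cr)) ih)

    -- Going down the column, each elbow releases the larger label to the right and takes over the
    -- smaller one from the left, so the label of the column separates the rows still to be met from
    -- those already passed.
    Separated : Fin (ℕ.suc n) → Set
    Separated y = toℕ a ℕ.< toℕ y →
        (∀ {q} → Live (inject₁ i) q → toℕ q ℕ.< toℕ y → V (inject₁ i) q < H i y)
      × (∀ {q} → Live (suc i) q → toℕ y ℕ.≤ toℕ q → H i y < V (suc i) q)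

    separated : ∀ y → Separated y
    separated = >-weakInduction _ last step
      where
      last : Separated (fromℕ n)
      last _ = (λ {q} _ _ → subst (V (inject₁ i) q <_) (sym (H-last i))
                  (subst (toℕ (V (inject₁ i) q) ℕ.<_) (sym (toℕ-topLabel i)) (V-bound q)))
             , λ {q} _ n≤q → ⊥-elim (ℕ.<⇒≱ (Fin.toℕ<n q) (subst (ℕ._≤ toℕ q) (Fin.toℕ-fromℕ n) n≤q))
      step : ∀ j → Separated (suc j) → Separated (inject₁ j)
      step j ih a<j rewrite Fin.toℕ-inject₁ j with Cr? σ (i , j)
      ... | yes cr@(_ , i<b) = left-below , right-above
        where
        rest = ih (ℕ.m<n⇒m<1+n a<j)
        left-below : ∀ {q} → Live (inject₁ i) q → q < j → V (inject₁ i) q < H i (inject₁ j)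
        left-below live q<j = subst (V (inject₁ i) _ <_) (sym (H-elbow cr))
          (proj₁ sorted live (live-inject₁ (ℕ.<⇒≤ i<b)) q<j)
        Vj<H : V (inject₁ i) j < H i (suc j)
        Vj<H = proj₁ rest (live-inject₁ (ℕ.<⇒≤ i<b)) ℕ.≤-refl
        right-above : ∀ {q} → Live (suc i) q → j ≤ᶠ q → H i (inject₁ j) < V (suc i) q
        right-above {q} live j≤q with ℕ.m≤n⇒m<n∨m≡n j≤q
        ... | inj₁ j<q = subst (_< _) (sym (H-elbow cr)) (ℕ.<-trans Vj<H (proj₂ rest live j<q))
        ... | inj₂ eq with Fin.toℕ-injective eq
        ...   | refl = subst₂ _<_ (sym (H-elbow cr)) (sym (V-elbow cr)) Vj<H
      ... | no ¬cr =
          (λ live q<j → subst (V (inject₁ i) _ <_) (sym (H-straight ¬cr)) (proj₁ rest live (ℕ.m<n⇒m<1+n q<j)))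
        , λ {q} live j≤q → subst (_< V (suc i) q) (sym (H-straight ¬cr))
            (proj₂ rest live (ℕ.≤∧≢⇒< j≤q λ eq → ¬cr (a<j , subst (λ k → i < σ ⟨$⟩ˡ k) (sym (Fin.toℕ-injective eq)) live)))
        where rest = ih (ℕ.m<n⇒m<1+n a<j)

    start<end : startLabel i < endLabel i
    start<end = proj₁ (separated (suc a) ℕ.≤-refl) (live-mark i) ℕ.≤-refl

    not-mark : ∀ {j} → Live (suc i) j → j ≢ a
    not-mark live refl = ℕ.<-irrefl (cong toℕ (sym (Perm.inverseˡ σ))) live

    V-lower : ∀ {j} → j < a → V (suc i) j ≡ V (inject₁ i) j
    V-lower j<a = V-straight (uncrossed-col (ℕ.<⇒≤ j<a))

    V-upper : ∀ {j} → Live (suc i) j → a < j → V (suc i) j ≡ H i (suc j)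
    V-upper live a<j = V-elbow (a<j , live)

    sorted-suc : Sorted (suc i)
    sorted-suc = increasing , bound
      where
      bound : ∀ j → toℕ (V (suc i) j) ℕ.< n + ℕ.suc (toℕ i)
      bound j rewrite ℕ.+-suc n (toℕ i) with Cr? σ (i , j)
      ... | yes cr = ℕ.s≤s (subst (λ l → toℕ l ℕ.≤ n + toℕ i) (sym (V-elbow cr)) (H-bound (suc j)))
      ... | no ¬cr = ℕ.s≤s (subst (λ l → toℕ l ℕ.≤ n + toℕ i) (sym (V-straight ¬cr)) (ℕ.<⇒≤ (V-bound j)))
      increasing : ∀ {j k} → Live (suc i) j → Live (suc i) k → j < k → V (suc i) j < V (suc i) k
      increasing {j} {k} lj lk j<k with Fin.<-cmp j a | Fin.<-cmp k a
      ... | tri≈ _ j≡a _ | _ = ⊥-elim (not-mark lj j≡a)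
      ... | _ | tri≈ _ k≡a _ = ⊥-elim (not-mark lk k≡a)
      ... | tri< j<a _ _ | tri< k<a _ _ = subst₂ _<_ (sym (V-lower j<a)) (sym (V-lower k<a))
            (proj₁ sorted (live-suc⇒ lj) (live-suc⇒ lk) j<k)
      ... | tri< j<a _ _ | tri> _ _ a<k = subst₂ _<_ (sym (V-lower j<a)) (sym (V-upper lk a<k))
            (proj₁ (separated (suc k) (ℕ.m<n⇒m<1+n a<k)) (live-suc⇒ lj) (ℕ.m<n⇒m<1+n j<k))
      ... | tri> _ _ a<j | tri< k<a _ _ = ⊥-elim (ℕ.<-asym j<k (ℕ.<-trans k<a a<j))
      ... | tri> _ _ a<j | tri> _ _ a<k = subst (_< V (suc i) k) (sym (V-upper lj a<j))
            (proj₂ (separated (suc j) (ℕ.m<n⇒m<1+n a<j)) lk j<k)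

    -- The strand that turns in column i joins two neighbours on the boundary,
    -- so all strands that turn later avoid the interval between its labels.
    Avoids : Fin (2 * n) → Set
    Avoids l = l < startLabel i ⊎ endLabel i < l

    avoid-rows : ∀ {j} → Live (suc i) j → Avoids (V (suc i) j)
    avoid-rows {j} live with Fin.<-cmp j a
    ... | tri< j<a _ _ = inj₁ (subst (_< startLabel i) (sym (V-lower j<a))
          (proj₁ sorted (live-suc⇒ live) (live-mark i) j<a))
    ... | tri≈ _ j≡a _ = ⊥-elim (not-mark live j≡a)
    ... | tri> _ _ a<j = inj₂ (proj₂ (separated (suc a) ℕ.≤-refl) live a<j)

    avoid-column : ∀ k → i < k → (∀ {j} → Live (inject₁ k) j → Avoids (V (inject₁ k) j)) →
                   ∀ y → toℕ (σ ⟨$⟩ʳ k) ℕ.< toℕ y → Avoids (H k y)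
    avoid-column k i<k rows = >-weakInduction _
      (λ _ → inj₂ (subst (endLabel i <_) (sym (H-last k)) (subst (toℕ (endLabel i) ℕ.<_) (sym (toℕ-topLabel k))
         (ℕ.≤-<-trans (H-bound (suc a)) (ℕ.+-monoʳ-< n i<k)))))
      step
      where
      step : ∀ j → (toℕ (σ ⟨$⟩ʳ k) ℕ.< ℕ.suc (toℕ j) → Avoids (H k (suc j))) →
             toℕ (σ ⟨$⟩ʳ k) ℕ.< toℕ (inject₁ j) → Avoids (H k (inject₁ j))
      step j ih a<j rewrite Fin.toℕ-inject₁ j with Cr? σ (k , j)
      ... | yes cr = subst Avoids (sym (H-elbow cr)) (rows (live-inject₁ (ℕ.<⇒≤ (proj₂ cr))))
      ... | no ¬cr = subst Avoids (sym (H-straight ¬cr)) (ih (ℕ.m<n⇒m<1+n a<j))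

    avoid-later : ∀ x → toℕ i ℕ.< toℕ x → ∀ {j} → Live x j → Avoids (V x j)
    avoid-later = <-weakInduction _ (λ ()) step
      where
      step : ∀ k → (toℕ i ℕ.< toℕ (inject₁ k) → ∀ {j} → Live (inject₁ k) j → Avoids (V (inject₁ k) j)) →
             toℕ i ℕ.< ℕ.suc (toℕ k) → ∀ {j} → Live (suc k) j → Avoids (V (suc k) j)
      step k ih i≤k {j} live with ℕ.m≤n⇒m<n∨m≡n (ℕ.s≤s⁻¹ i≤k)
      ... | inj₂ eq with Fin.toℕ-injective eq
      ...   | refl = avoid-rows live
      step k ih i≤k {j} live | inj₁ i<k with Cr? σ (k , j)
      ... | yes cr = subst Avoids (sym (V-elbow cr))
            (avoid-column k i<k (ih i<k′) (suc j) (ℕ.m<n⇒m<1+n (proj₁ cr)))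
        where i<k′ = subst (toℕ i ℕ.<_) (sym (Fin.toℕ-inject₁ k)) i<k
      ... | no ¬cr = subst Avoids (sym (V-straight ¬cr)) (ih i<k′ (live-suc⇒ live))
        where i<k′ = subst (toℕ i ℕ.<_) (sym (Fin.toℕ-inject₁ k)) i<k

    avoid-start : ∀ k → i < k → Avoids (startLabel k)
    avoid-start k i<k = avoid-later (inject₁ k) (subst (toℕ i ℕ.<_) (sym (Fin.toℕ-inject₁ k)) i<k) (live-mark k)

    avoid-end : ∀ k → i < k → Avoids (endLabel k)
    avoid-end k i<k = avoid-column k i<k
      (avoid-later (inject₁ k) (subst (toℕ i ℕ.<_) (sym (Fin.toℕ-inject₁ k)) i<k)) _ ℕ.≤-refl

  sorted : ∀ x → Sorted x
  sorted = <-weakInduction _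
    ( (λ _ _ j<k → subst₂ ℕ._<_ (sym (toℕ-leftLabel _)) (sym (toℕ-leftLabel _)) j<k)
    , λ j → subst₂ ℕ._<_ (sym (toℕ-leftLabel j)) (sym (ℕ.+-identityʳ n)) (Fin.toℕ<n j))
    Column.sorted-suc

  open module ColumnAt (i : Fin n) = Column i (sorted (inject₁ i))
    using (Avoids; start<end; avoid-start; avoid-end) public

  strandLabel : Fin 2 × Fin n → Fin (2 * n)
  strandLabel (0F , i) = startLabel i
  strandLabel (1F , i) = endLabel i

  avoid-label : ∀ i r k → i < k → Avoids i (strandLabel (r , k))
  avoid-label i 0F = avoid-start i
  avoid-label i 1F = avoid-end i

  avoids⇒≢ : ∀ i r {l} → Avoids i l → strandLabel (r , i) ≢ l
  avoids⇒≢ i 0F (inj₁ l<s) refl = ℕ.<-irrefl refl l<s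
  avoids⇒≢ i 0F (inj₂ e<l) refl = ℕ.<-asym e<l (start<end i)
  avoids⇒≢ i 1F (inj₁ l<s) refl = ℕ.<-asym l<s (start<end i)
  avoids⇒≢ i 1F (inj₂ e<l) refl = ℕ.<-irrefl refl e<l

  strandLabel-injective : ∀ x y → strandLabel x ≡ strandLabel y → x ≡ y
  strandLabel-injective (r , i) (s , k) eq with Fin.<-cmp i k
  ... | tri< i<k _ _ = ⊥-elim (avoids⇒≢ i r (avoid-label i s k i<k) eq)
  ... | tri> _ _ k<i = ⊥-elim (avoids⇒≢ k s (avoid-label k r i k<i) (sym eq))
  ... | tri≈ _ refl _ = cong (_, i) (same r s eq)
    where
    same : ∀ r s → strandLabel (r , i) ≡ strandLabel (s , i) → r ≡ s
    same 0F 0F _  = refl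
    same 1F 1F _  = refl
    same 0F 1F eq = ⊥-elim (Fin.<⇒≢ (start<end i) eq)
    same 1F 0F eq = ⊥-elim (Fin.<⇒≢ (start<end i) (sym eq))

  strandLabel-surjective : ∀ l → ∃[ x ] strandLabel x ≡ l
  strandLabel-surjective l =
    let (k , eq) = injective⇒surjective (strandLabel ∘ split) (λ {k} {m} eq →
          split-injective k m (strandLabel-injective (split k) (split m) eq)) l
    in split k , eq
    where
    split = remQuot {2} n
    split-injective : ∀ k m → split k ≡ split m → k ≡ m
    split-injective k m eq = trans (sym (Fin.combine-remQuot {2} n k))
      (trans (cong (λ (r , i) → combine {2} r i) eq) (Fin.combine-remQuot {2} n m))

  strandTableau : Tableau n
  strandTableau = mk↔ₛ′ strandLabel (proj₁ ∘ strandLabel-surjective) (proj₂ ∘ strandLabel-surjective)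
    (λ x → strandLabel-injective _ _ (proj₂ (strandLabel-surjective (strandLabel x))))

  strandMatching : Matching n
  strandMatching = columnMatching strandTableau

  private
    p = partner strandMatching

  partner-label : ∀ r i → p (strandLabel (r , i)) ≡ strandLabel (opposite r , i)
  partner-label r i = cong (λ (r , i) → strandLabel (opposite r , i))
    (Inverse.strictlyInverseʳ strandTableau (r , i))

  -- Of two crossing arcs, the one that turns first has exactly one end of the other
  -- between its ends.
  strand-noncrossing : Noncrossing strandMatching
  strand-noncrossing α β γ δ α<β β<γ γ<δ pα≡γ pβ≡δ =
    go (strandLabel-surjective α) (strandLabel-surjective β)
    where
    α<γ = ℕ.<-trans α<β β<γ
    β<δ = ℕ.<-trans β<γ γ<δ
    go : ∃[ x ] strandLabel x ≡ α → ∃[ y ] strandLabel y ≡ β → _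
    go ((1F , i) , refl) _ = ℕ.<-asym α<γ (subst (_< α) (trans (sym (partner-label 1F i)) pα≡γ) (start<end i))
    go ((0F , _) , _) ((1F , k) , refl) = ℕ.<-asym β<δ (subst (_< β) (trans (sym (partner-label 1F k)) pβ≡δ) (start<end k))
    go ((0F , i) , refl) ((0F , k) , refl)
      with trans (sym (partner-label 0F i)) pα≡γ | trans (sym (partner-label 0F k)) pβ≡δ
    ... | refl | refl with Fin.<-cmp i k
    ...   | tri≈ _ refl _ = ℕ.<-irrefl refl α<β
    ...   | tri< i<k _ _ = case avoid-start i k i<k of λ where
              (inj₁ β<α) → ℕ.<-asym β<α α<β
              (inj₂ γ<β) → ℕ.<-asym γ<β β<γ
    ...   | tri> _ _ k<i = case avoid-end k i k<i of λ where
              (inj₁ γ<β) → ℕ.<-asym γ<β β<γ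
              (inj₂ δ<γ) → ℕ.<-asym δ<γ γ<δ

  label : Edge n → Fin (2 * n)
  label (vertical x j)   = V x j
  label (horizontal i y) = H i y

  label-boundary : ∀ a → label (boundary a) ≡ a
  label-boundary a with remQuot {2} n a in eq
  ... | 0F , j = trans (cong (λ (r , i) → combine {2} r i) (sym eq)) (Fin.combine-remQuot {2} n a)
  ... | 1F , i = trans (H-last i) (trans (cong (λ (r , i) → combine {2} r i) (sym eq)) (Fin.combine-remQuot {2} n a))

  SameArc : Rel (Fin (2 * n)) 0ℓ
  SameArc k l = k ≡ l ⊎ p k ≡ l

  sameArc-isEquivalence : IsEquivalence SameArc
  sameArc-isEquivalence = record { refl = inj₁ refl ; sym = sym′ ; trans = trans′ }
    where
    sym′ : ∀ {k l} → SameArc k l → SameArc l k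
    sym′ (inj₁ refl) = inj₁ refl
    sym′ (inj₂ refl) = inj₂ (involutive strandMatching _)
    trans′ : ∀ {k l m} → SameArc k l → SameArc l m → SameArc k m
    trans′ (inj₁ refl) q = q
    trans′ (inj₂ refl) (inj₁ refl) = inj₂ refl
    trans′ (inj₂ refl) (inj₂ refl) = inj₁ (sym (involutive strandMatching _))

  -- Every piece of strand joins edges with equal labels, except a turn, which leads from one end of
  -- an arc to the other.
  strand⇒sameArc : ∀ {e f} → Strand σ (Cr σ) e f → SameArc (label e) (label f)
  strand⇒sameArc = EqClosure.gfold sameArc-isEquivalence label piece
    where
    piece : ∀ {e f} → Piece σ (Cr σ) e f → SameArc (label e) (label f)
    piece (turn i)          = inj₂ (partner-label 0F i)
    piece (across i j _ ∉)  = inj₁ (sym (V-straight ∉))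
    piece (upward i j _ ∉)  = inj₁ (H-straight ∉)
    piece (elbow₁ cr)       = inj₁ (sym (H-elbow cr))
    piece (elbow₂ cr)       = inj₁ (V-elbow cr)

  private
    module Eq = IsEquivalence (EqClosure.isEquivalence (Piece σ (Cr σ)))

  -- The counterpart of `strand⇒sameArc`: an edge is connected to the boundary edge that its label
  -- names. This is shown for edges that lie on a strand, as the others carry junk.
  Attached : Edge n → Set
  Attached e = Strand σ (Cr σ) (boundary (label e)) e

  attached-step : ∀ {e f} → label e ≡ label f → Strand σ (Cr σ) e f → Attached e → Attached f
  attached-step eq e~f a = subst (λ l → Strand σ (Cr σ) (boundary l) _) eq (Eq.trans a e~f)

  attached-column : ∀ i → (∀ {j} → Live (inject₁ i) j → Attached (vertical (inject₁ i) j)) →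
                    ∀ y → toℕ (σ ⟨$⟩ʳ i) ℕ.< toℕ y → Attached (horizontal i y)
  attached-column i rows = >-weakInduction _
    (λ _ → subst (λ l → Strand σ (Cr σ) (boundary l) _) (sym (H-last i))
             (subst (λ e → Strand σ (Cr σ) e (horizontal i (fromℕ n))) (sym (boundary-top i)) Eq.refl))
    step
    where
    step : ∀ j → (toℕ (σ ⟨$⟩ʳ i) ℕ.< ℕ.suc (toℕ j) → Attached (horizontal i (suc j))) →
           toℕ (σ ⟨$⟩ʳ i) ℕ.< toℕ (inject₁ j) → Attached (horizontal i (inject₁ j))
    step j ih a<j rewrite Fin.toℕ-inject₁ j with Cr? σ (i , j)
    ... | yes cr = attached-step (sym (H-elbow cr)) (EqClosure.return (elbow₁ cr))
          (rows (live-inject₁ (ℕ.<⇒≤ (proj₂ cr))))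
    ... | no ¬cr = attached-step (sym (H-straight ¬cr)) (Eq.sym (EqClosure.return (upward i j a<j ¬cr)))
          (ih (ℕ.m<n⇒m<1+n a<j))

  attached-row : ∀ x {j} → Live x j → Attached (vertical x j)
  attached-row = <-weakInduction _
    (λ {j} _ → subst (λ e → Strand σ (Cr σ) e (vertical zero j)) (sym (boundary-left j)) Eq.refl)
    step
    where
    step : ∀ i → (∀ {j} → Live (inject₁ i) j → Attached (vertical (inject₁ i) j)) →
           ∀ {j} → Live (suc i) j → Attached (vertical (suc i) j)
    step i ih {j} live with Cr? σ (i , j)
    ... | yes cr = attached-step (sym (V-elbow cr)) (Eq.sym (EqClosure.return (elbow₂ cr)))
          (attached-column i ih (suc j) (ℕ.m<n⇒m<1+n (proj₁ cr)))
    ... | no ¬cr = attached-step (sym (V-straight ¬cr)) (EqClosure.return (across i j live ¬cr))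
          (ih (live-suc⇒ live))

  strand-turns : ∀ i → Strand σ (Cr σ) (boundary (startLabel i)) (boundary (endLabel i))
  strand-turns i = Eq.trans (attached-row (inject₁ i) (live-mark i)) (Eq.trans (EqClosure.return (turn i))
    (Eq.sym (attached-column i (attached-row (inject₁ i)) (suc (σ ⟨$⟩ʳ i)) ℕ.≤-refl)))

  strandMatching-isGridMatching : IsGridMatching σ (Cr σ) strandMatching
  strandMatching-isGridMatching a b = mk⇔ to from
    where
    joined : ∀ x → Strand σ (Cr σ) (boundary (strandLabel x)) (boundary (p (strandLabel x)))
    joined (0F , i) = subst (λ l → Strand σ (Cr σ) (boundary (startLabel i)) (boundary l)) (sym (partner-label 0F i)) (strand-turns i)
    joined (1F , i) = subst (λ l → Strand σ (Cr σ) (boundary (endLabel i)) (boundary l)) (sym (partner-label 1F i)) (Eq.sym (strand-turns i))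
    to : p a ≡ b → a ≢ b × Strand σ (Cr σ) (boundary a) (boundary b)
    to refl = (λ eq → no-fixpoint strandMatching a (sym eq)) ,
      subst (λ l → Strand σ (Cr σ) (boundary l) (boundary (p l))) (proj₂ (strandLabel-surjective a))
        (joined (proj₁ (strandLabel-surjective a)))
    from : a ≢ b × Strand σ (Cr σ) (boundary a) (boundary b) → p a ≡ b
    from (a≢b , s) with subst₂ SameArc (label-boundary a) (label-boundary b) (strand⇒sameArc s)
    ... | inj₁ a≡b  = ⊥-elim (a≢b a≡b)
    ... | inj₂ pa≡b = pa≡b

gridMatching-unique : ∀ {σ : Permutation′ n} {F} M M′ → IsGridMatching σ F M → IsGridMatching σ F M′ →
                      ∀ a → partner M a ≡ partner M′ a
gridMatching-unique M M′ g g′ a =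
  sym (Equivalence.from (g′ a (partner M a)) (Equivalence.to (g a (partner M a)) refl))

gridMatching-resp : ∀ {σ : Permutation′ n} {F} M M′ → (∀ a → partner M a ≡ partner M′ a) →
                    IsGridMatching σ F M → IsGridMatching σ F M′
gridMatching-resp M M′ eq g a b = mk⇔
  (λ p → Equivalence.to (g a b) (trans (eq a) p))
  (λ q → trans (sym (eq a)) (Equivalence.from (g a b) q))

-- The labels depend on σ through a computation that also uses its inverse, so the comparison goes
-- through the drawing: the pieces transfer along σ ≈ τ, and the drawing determines the matching.
strandMatching-cong : {σ τ : Permutation′ n} → σ Perm.≈ τ →
                      ∀ a → partner (Grid.strandMatching σ) a ≡ partner (Grid.strandMatching τ) a
strandMatching-cong {σ = σ} {τ} σ≈τ = gridMatching-unique (Grid.strandMatching σ) (Grid.strandMatching τ)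
  (Grid.strandMatching-isGridMatching σ) λ a b → mk⇔
    (λ eq → let (a≢b , s) = Equivalence.to (Grid.strandMatching-isGridMatching τ a b) eq
            in a≢b , EqClosure.map (piece {σ = τ} {σ} (sym ∘ σ≈τ)) s)
    (λ (a≢b , s) → Equivalence.from (Grid.strandMatching-isGridMatching τ a b)
       (a≢b , EqClosure.map (piece {σ = σ} {τ} σ≈τ) s))
  where
  piece : {σ τ : Permutation′ n} → σ Perm.≈ τ → ∀ {e f} → Piece σ (Cr σ) e f → Piece τ (Cr τ) e f
  piece {σ = σ} {τ} σ≈τ (turn i) = subst (λ j → Piece τ (Cr τ) (left (i , j)) (top (i , j))) (sym (σ≈τ i)) (turn i)
  piece {σ = σ} {τ} σ≈τ (across i j i<b ∉) = across i j (subst (i <_) (≈⇒ˡ {σ = σ} {τ} σ≈τ j) i<b)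
    (∉ ∘ Cr-resp-≈ {σ = τ} {σ} (sym ∘ σ≈τ))
  piece {σ = σ} {τ} σ≈τ (upward i j a<j ∉) = upward i j (subst (_< j) (σ≈τ i) a<j)
    (∉ ∘ Cr-resp-≈ {σ = τ} {σ} (sym ∘ σ≈τ))
  piece {σ = σ} {τ} σ≈τ (elbow₁ cr) = elbow₁ (Cr-resp-≈ {σ = σ} {τ} σ≈τ cr)
  piece {σ = σ} {τ} σ≈τ (elbow₂ cr) = elbow₂ (Cr-resp-≈ {σ = σ} {τ} σ≈τ cr)

-- The cells, column by column from the left, each column from the top

below : ∀ {m} → (Fin m → A) → Fin (ℕ.suc m) → List A
below f zero                  = []
below {m = ℕ.suc m} f (suc y) = below (f ∘ suc) y ++ [ f zero ]

below-suc : ∀ {m} (f : Fin m → A) j → below f (suc j) ≡ f j ∷ below f (inject₁ j)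
below-suc f zero    = refl
below-suc f (suc j) = cong (_++ [ f zero ]) (below-suc (f ∘ suc) j)

∈-below : ∀ {m} (f : Fin m → A) j → f j ∈ˡ below f (fromℕ m)
∈-below {m = ℕ.suc m} f zero = ∈-++⁺ʳ (below (f ∘ suc) (fromℕ m)) (here refl)
∈-below f (suc j) = ∈-++⁺ˡ (∈-below (f ∘ suc) j)

concatFrom : ∀ {m} → (Fin m → List A) → Fin (ℕ.suc m) → List A
concatFrom {m = ℕ.zero}  f zero    = []
concatFrom {m = ℕ.suc m} f zero    = f zero ++ concatFrom (f ∘ suc) zero
concatFrom {m = ℕ.suc m} f (suc k) = concatFrom (f ∘ suc) k

concatFrom-inject₁ : ∀ {m} (f : Fin m → List A) i →
                     concatFrom f (inject₁ i) ≡ f i ++ concatFrom f (suc i)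
concatFrom-inject₁ f zero    = refl
concatFrom-inject₁ f (suc i) = concatFrom-inject₁ (f ∘ suc) i

concatFrom-last : ∀ {m} (f : Fin m → List A) → concatFrom f (fromℕ m) ≡ []
concatFrom-last {m = ℕ.zero}  f = refl
concatFrom-last {m = ℕ.suc m} f = concatFrom-last (f ∘ suc)

column : Fin n → List (Cell n)
column {n} i = below (i ,_) (fromℕ n)

columnsFrom : Fin (ℕ.suc n) → List (Cell n)
columnsFrom = concatFrom column

cells : ∀ n → List (Cell n)
cells n = columnsFrom zero

-- Queue P cs: the cells outside P are listed in cs, each after the cells above it.
data Queue {n} (P : Pred (Cell n) 0ℓ) : List (Cell n) → Set₁ where
  done : (∀ c → P c) → Queue P []
  next : ∀ {P′ c cs} → ¬ P c → (∀ {d} → P′ d ⇔ (P d ⊎ d ≡ c)) →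
         (∀ {d} → d ⪰ c → P d ⊎ d ≡ c) → Queue P′ cs → Queue P (c ∷ cs)

Queue-resp : ∀ {P Q : Pred (Cell n) 0ℓ} {cs} → (∀ {d} → P d ⇔ Q d) → Queue P cs → Queue Q cs
Queue-resp P⇔Q (done all) = done (λ c → Equivalence.to P⇔Q (all c))
Queue-resp P⇔Q (next ¬Pc P′ above q) = next (¬Pc ∘ Equivalence.from P⇔Q)
  (mk⇔ (⊎.map₁ (Equivalence.to P⇔Q) ∘ Equivalence.to P′)
       (Equivalence.from P′ ∘ ⊎.map₁ (Equivalence.from P⇔Q)))
  (⊎.map₁ (Equivalence.to P⇔Q) ∘ above) q

UpClosed : Pred (Cell n) 0ℓ → Set
UpClosed P = ∀ {c d} → P c → d ⪰ c → P d

UpClosed-next : ∀ {P P′ : Pred (Cell n) 0ℓ} {c} → (∀ {d} → P′ d ⇔ (P d ⊎ d ≡ c)) →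
                (∀ {d} → d ⪰ c → P d ⊎ d ≡ c) → UpClosed P → UpClosed P′
UpClosed-next P′ above up p d⪰ with Equivalence.to P′ p
... | inj₁ Pd   = Equivalence.from P′ (inj₁ (up Pd d⪰))
... | inj₂ refl = Equivalence.from P′ (above d⪰)

cells-queue : ∀ n → Queue {n} ∅ (cells n)
cells-queue n = Queue-resp (mk⇔ (λ ()) λ ()) (>-weakInduction Columns last columns zero)
  where
  Before : Fin (ℕ.suc n) → Pred (Cell n) 0ℓ
  Before k (x , _) = toℕ x ℕ.< toℕ k
  Columns : Fin (ℕ.suc n) → Set₁
  Columns k = Queue (Before k) (columnsFrom k)
  Done : Fin n → Fin (ℕ.suc n) → Pred (Cell n) 0ℓ
  Done i y (x , z) = x < i ⊎ (x ≡ i × toℕ y ℕ.≤ toℕ z)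
  last : Columns (fromℕ n)
  last = subst (Queue _) (sym (concatFrom-last column))
    (done λ (x , _) → subst (toℕ x ℕ.<_) (sym (Fin.toℕ-fromℕ n)) (Fin.toℕ<n x))
  columns : ∀ i → Columns (suc i) → Columns (inject₁ i)
  columns i q = subst (Queue _) (sym (concatFrom-inject₁ column i))
    (Queue-resp (mk⇔ top→ top←) (<-weakInduction Rows base rows (fromℕ n)))
    where
    Rows : Fin (ℕ.suc n) → Set₁
    Rows y = Queue (Done i y) (below (i ,_) y ++ columnsFrom (suc i))
    top→ : ∀ {d} → Done i (fromℕ n) d → Before (inject₁ i) d
    top→ (inj₁ x<i) = subst (_ ℕ.<_) (sym (Fin.toℕ-inject₁ i)) x<i
    top→ {_ , z} (inj₂ (_ , n≤z)) = ⊥-elim (ℕ.<⇒≱ (Fin.toℕ<n z) (subst (ℕ._≤ toℕ z) (Fin.toℕ-fromℕ n) n≤z))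
    top← : ∀ {d} → Before (inject₁ i) d → Done i (fromℕ n) d
    top← x<i = inj₁ (subst (_ ℕ.<_) (Fin.toℕ-inject₁ i) x<i)
    base : Rows zero
    base = Queue-resp (mk⇔
      (λ x<si → case ℕ.m≤n⇒m<n∨m≡n (ℕ.s≤s⁻¹ x<si) of λ where
        (inj₁ x<i) → inj₁ x<i
        (inj₂ x≡i) → inj₂ (Fin.toℕ-injective x≡i , ℕ.z≤n))
      (λ where
        (inj₁ x<i) → ℕ.m<n⇒m<1+n x<i
        (inj₂ (refl , _)) → ℕ.≤-refl)) q
    rows : ∀ j → Rows (inject₁ j) → Rows (suc j)
    rows j q′ = subst (λ xs → Queue (Done i (suc j)) (xs ++ _)) (sym (below-suc (i ,_) j))
      (next fresh (mk⇔ split→ split←) above q′)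
      where
      fresh : ¬ Done i (suc j) (i , j)
      fresh (inj₁ i<i)         = ℕ.<-irrefl refl i<i
      fresh (inj₂ (_ , 1+j≤j)) = ℕ.<-irrefl refl 1+j≤j
      split→ : ∀ {d} → Done i (inject₁ j) d → Done i (suc j) d ⊎ d ≡ (i , j)
      split→ (inj₁ x<i) = inj₁ (inj₁ x<i)
      split→ (inj₂ (refl , j≤z)) rewrite Fin.toℕ-inject₁ j with ℕ.m≤n⇒m<n∨m≡n j≤z
      ... | inj₁ j<z = inj₁ (inj₂ (refl , j<z))
      ... | inj₂ j≡z = inj₂ (cong (i ,_) (sym (Fin.toℕ-injective j≡z)))
      split← : ∀ {d} → Done i (suc j) d ⊎ d ≡ (i , j) → Done i (inject₁ j) d
      split← (inj₁ (inj₁ x<i)) = inj₁ x<i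
      split← (inj₁ (inj₂ (x≡i , j<z))) rewrite Fin.toℕ-inject₁ j = inj₂ (x≡i , ℕ.<⇒≤ j<z)
      split← (inj₂ refl) rewrite Fin.toℕ-inject₁ j = inj₂ (refl , ℕ.≤-refl)
      above : ∀ {d} → d ⪰ (i , j) → Done i (suc j) d ⊎ d ≡ (i , j)
      above (x≤i , j≤z) with ℕ.m≤n⇒m<n∨m≡n x≤i
      ... | inj₁ x<i = inj₁ (inj₁ x<i)
      ... | inj₂ x≡i = split→ (inj₂ (Fin.toℕ-injective x≡i , subst (ℕ._≤ _) (sym (Fin.toℕ-inject₁ j)) j≤z))

-- The tree of resolutions, with switches only allowed at the cells of I

module Leaves {n} {I : Pred (Cell n) 0ℓ} (I? : Decidable I) where

  leaves : List (Cell n) → Permutation′ n → List (Permutation′ n)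
  leaves []       τ = [ τ ]
  leaves (c ∷ cs) τ with Cr? τ c ×-dec I? c
  ... | yes _ = leaves cs τ ++ leaves cs (switchAt τ c)
  ... | no  _ = leaves cs τ

  Persists : Permutation′ n → Cell n → Permutation′ n → Set
  Persists τ (x , y) σ = (Cr τ (x , y) ⇔ Cr σ (x , y)) × ((τ ⟨$⟩ʳ x ≡ y) ⇔ (σ ⟨$⟩ʳ x ≡ y))

  -- Since P is closed upwards and contains c, no later switch takes place weakly above and to the
  -- left of c; a switch elsewhere changes neither the mark nor the crossing at c.
  persist : ∀ {P cs} → Queue P cs → UpClosed P → ∀ {c} → P c → ∀ τ → All (Persists τ c) (leaves cs τ)
  persist (done _) up Pc τ = (⇔.refl , ⇔.refl) ∷ []
  persist (next {c = d} {cs} ¬Pd P′ above q) up {c} Pc τ with Cr? τ d ×-dec I? d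
  ... | no _ = persist q (UpClosed-next P′ above up) (Equivalence.from P′ (inj₁ Pc)) τ
  ... | yes (cr , _) = All.++⁺ (ih τ) (All.map (λ (p , q) → ⇔.trans (crossing ¬⪰) p , ⇔.trans (marked ¬⪰) q) (ih (switchAt τ d)))
    where
    ih = persist q (UpClosed-next P′ above up) {c} (Equivalence.from P′ (inj₁ Pc))
    ¬⪰ : ¬ (d ⪰ c)
    ¬⪰ d⪰c = ¬Pd (up Pc d⪰c)
    open Switch {σ = τ} {switchAt τ d} (switchAt-IsSwitch τ d) cr

  -- By `persist` the two branches at c stay apart: all leaves of one have c marked, all leaves of
  -- the other have it unmarked.
  leaves-unique : ∀ {P cs} → Queue P cs → UpClosed P → ∀ τ →
                  AllPairs (λ σ σ′ → ¬ (σ Perm.≈ σ′)) (leaves cs τ)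
  leaves-unique (done _) up τ = [] ∷ []
  leaves-unique (next {c = c} ¬Pc P′ above q) up τ with Cr? τ c ×-dec I? c
  ... | no _ = leaves-unique q (UpClosed-next P′ above up) τ
  ... | yes (cr , _) = AllPairs.++⁺ (leaves-unique q up′ τ) (leaves-unique q up′ (switchAt τ c))
    (All.map (λ (_ , p) → All.map (λ (_ , p′) σ≈σ′ → unmarked (Equivalence.from p (trans (σ≈σ′ _)
       (Equivalence.to p′ (proj₁ (switchAt-IsSwitch τ c))))))
       (persist q up′ (Equivalence.from P′ (inj₂ refl)) (switchAt τ c)))
       (persist q up′ (Equivalence.from P′ (inj₂ refl)) τ))
    where
    up′ = UpClosed-next P′ above up
    unmarked : τ ⟨$⟩ʳ proj₁ c ≢ proj₂ c
    unmarked eq = Fin.<⇒≢ (proj₁ cr) eq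

  Inside : Permutation′ n → Set
  Inside σ = ∀ i → I (mark σ i)

  DownClosed : Set
  DownClosed = ∀ {c d} → I c → c ⪰ d → I d

  -- A switch at c creates one mark at c and one below and to the right of c, both in I.
  leaves-inside : DownClosed → ∀ cs {τ} → Inside τ → All Inside (leaves cs τ)
  leaves-inside down []       inside = inside ∷ []
  leaves-inside down (c@(i , j) ∷ cs) {τ} inside with Cr? τ c ×-dec I? c
  ... | no _ = leaves-inside down cs {τ} inside
  ... | yes (cr , Ic) = All.++⁺ (leaves-inside down cs {τ} inside) (leaves-inside down cs {switchAt τ c} inside′)
    where
    open Switch {σ = τ} {switchAt τ c} (switchAt-IsSwitch τ c) cr
    inside′ : Inside (switchAt τ c)
    inside′ k with k ≟ i
    ... | yes refl = subst (λ y → I (i , y)) (sym col-i) Ic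
    ... | no  k≢i with k ≟ b
    ...   | yes refl = subst (λ y → I (b , y)) (sym col-b) (down Ic (ℕ.<⇒≤ i<b , ℕ.<⇒≤ a<j))
    ...   | no  k≢b  = subst (λ y → I (k , y)) (sym (col-other k≢i k≢b)) (inside k)

  module _ {P P′ : Pred (Cell n) 0ℓ} {c : Cell n} (¬Pc : ¬ P c) (P′⇔ : ∀ {d} → P′ d ⇔ (P d ⊎ d ≡ c))
           {τ : Permutation′ n} {F : Pred (Cell n) 0ℓ} (F⇔ : ∀ {d} → F d ⇔ (Cr τ d × P d)) where

    next-maximal : (∀ {d} → d ⪰ c → P d ⊎ d ≡ c) → Cr τ c → MaximalRemaining τ F c
    next-maximal above cr = (cr , ¬Pc ∘ proj₂ ∘ Equivalence.to F⇔) ,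
      λ (crd , d∉F) d⪰c → case above d⪰c of λ where
        (inj₁ Pd)  → ⊥-elim (d∉F (Equivalence.from F⇔ (crd , Pd)))
        (inj₂ d≡c) → d≡c

    next-smoothed : Cr τ c → ∀ {d} → (F ∪ ｛ c ｝) d ⇔ (Cr τ d × P′ d)
    next-smoothed cr {d} = mk⇔ to from
      where
      to : (F ∪ ｛ c ｝) d → Cr τ d × P′ d
      to (inj₁ Fd) = let (crd , Pd) = Equivalence.to F⇔ Fd in crd , Equivalence.from P′⇔ (inj₁ Pd)
      to (inj₂ refl) = cr , Equivalence.from P′⇔ (inj₂ refl)
      from : Cr τ d × P′ d → (F ∪ ｛ c ｝) d
      from (crd , P′d) with Equivalence.to P′⇔ P′d
      ... | inj₁ Pd  = inj₁ (Equivalence.from F⇔ (crd , Pd))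
      ... | inj₂ d≡c = inj₂ (sym d≡c)

    next-skipped : ¬ Cr τ c → ∀ {d} → F d ⇔ (Cr τ d × P′ d)
    next-skipped ¬cr {d} = mk⇔
      (λ Fd → let (crd , Pd) = Equivalence.to F⇔ Fd in crd , Equivalence.from P′⇔ (inj₁ Pd)) from
      where
      from : Cr τ d × P′ d → F d
      from (crd , P′d) with Equivalence.to P′⇔ P′d
      ... | inj₁ Pd   = Equivalence.from F⇔ (crd , Pd)
      ... | inj₂ refl = ⊥-elim (¬cr crd)

    -- F stays as it is: c has become a mark and left the crossings, and the cells of P are out of
    -- reach of the switch.
    next-switched : UpClosed P → Cr τ c → ∀ {d} → F d ⇔ (Cr (switchAt τ c) d × P′ d)
    next-switched up cr {d} = mk⇔ to from
      where
      open Switch {σ = τ} {switchAt τ c} (switchAt-IsSwitch τ c) cr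
      ¬⪰ : P d → ¬ (c ⪰ d)
      ¬⪰ Pd c⪰d = ¬Pc (up Pd c⪰d)
      to : F d → Cr (switchAt τ c) d × P′ d
      to Fd = let (crd , Pd) = Equivalence.to F⇔ Fd in
        Equivalence.to (crossing (¬⪰ Pd)) crd , Equivalence.from P′⇔ (inj₁ Pd)
      from : Cr (switchAt τ c) d × P′ d → F d
      from (crd , P′d) with Equivalence.to P′⇔ P′d
      ... | inj₁ Pd   = Equivalence.from F⇔ (Equivalence.from (crossing (¬⪰ Pd)) crd , Pd)
      ... | inj₂ refl = ⊥-elim (ℕ.<-irrefl (cong toℕ col-i) (proj₁ crd))

  leaves-web : ∀ {P cs} → Queue P cs → UpClosed P → ∀ {τ F} → Generated τ F →
               (∀ {d} → F d ⇔ (Cr τ d × P d)) → All WebPermutation (leaves cs τ)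
  leaves-web (done all) up g F⇔ =
    (_ , g , (λ Fd → proj₁ (Equivalence.to F⇔ Fd)) , (λ cr → Equivalence.from F⇔ (cr , all _))) ∷ []
  leaves-web (next {P′} {c = c} {cs} ¬Pc P′⇔ above q) up {τ} {F} g F⇔ with Cr? τ c ×-dec I? c
  ... | yes (cr , _) = All.++⁺
    (leaves-web q up′ (smooth g maximal) (next-smoothed ¬Pc P′⇔ {τ} F⇔ cr))
    (leaves-web q up′ (switch g maximal (switchAt-IsSwitch τ c)) (next-switched ¬Pc P′⇔ {τ} F⇔ up cr))
    where
    up′ = UpClosed-next P′⇔ above up
    maximal = next-maximal ¬Pc P′⇔ {τ} F⇔ above cr
  -- A crossing outside I is smoothed and its switching branch is dropped, so the leaves still end
  -- with all crossings smoothed.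
  ... | no _ with Cr? τ c
  ...   | no ¬cr = leaves-web q (UpClosed-next P′⇔ above up) g (next-skipped ¬Pc P′⇔ {τ} F⇔ ¬cr)
  ...   | yes cr = leaves-web q (UpClosed-next P′⇔ above up)
    (smooth g (next-maximal ¬Pc P′⇔ {τ} F⇔ above cr)) (next-smoothed ¬Pc P′⇔ {τ} F⇔ cr)

  Reaches : Permutation′ n → List (Cell n) → Permutation′ n → Set
  Reaches σ cs τ = Any (σ Perm.≈_) (leaves cs τ)

  -- The branch that leaves the permutation alone is always present, so any stretch of cells can be
  -- passed without a switch.
  reaches-skip : ∀ {σ τ} cs ds → Reaches σ ds τ → Reaches σ (cs ++ ds) τ
  reaches-skip [] ds r = r
  reaches-skip {σ} {τ} (c ∷ cs) ds r with Cr? τ c ×-dec I? c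
  ... | yes _ = Any.++⁺ˡ (reaches-skip {σ} {τ} cs ds r)
  ... | no  _ = reaches-skip {σ} {τ} cs ds r

  reaches-switch : ∀ {σ τ} c cs → Cr τ c → I c → Reaches σ cs (switchAt τ c) → Reaches σ (c ∷ cs) τ
  reaches-switch {σ} {τ} c cs cr Ic r with Cr? τ c ×-dec I? c
  ... | yes _ = Any.++⁺ʳ (leaves cs τ) r
  ... | no ¬p = contradiction (cr , Ic) ¬p

  reaches-resp : ∀ {σ} cs {τ τ′} → τ Perm.≈ τ′ → Reaches σ cs τ → Reaches σ cs τ′
  reaches-resp [] τ≈ (here σ≈τ) = here (λ i → trans (σ≈τ i) (τ≈ i))
  reaches-resp {σ} (c@(i , j) ∷ cs) {τ} {τ′} τ≈ r with Cr? τ c ×-dec I? c | Cr? τ′ c ×-dec I? c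
  ... | no _ | no _ = reaches-resp {σ} cs {τ} {τ′} τ≈ r
  ... | no ¬p | yes (p , q) = contradiction (Cr-resp-≈ {σ = τ′} {τ} (sym ∘ τ≈) p , q) ¬p
  ... | yes (p , q) | no ¬p = contradiction (Cr-resp-≈ {σ = τ} {τ′} τ≈ p , q) ¬p
  ... | yes _ | yes _ = case Any.++⁻ (leaves cs τ) r of λ where
      (inj₁ r) → Any.++⁺ˡ (reaches-resp {σ} cs {τ} {τ′} τ≈ r)
      (inj₂ r) → Any.++⁺ʳ (leaves cs τ′) (reaches-resp {σ} cs {switchAt τ c} {switchAt τ′ c}
        (λ k → cong₂ (λ a x → Perm.transpose a j ⟨$⟩ʳ x) (τ≈ i) (τ≈ k)) r)

  -- The tree can follow the rebuilding of σ: in each column all cells are passed unswitched except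
  -- the mark of σ, where the switch is made if the step is strict.
  leaves-complete : ∀ {σ} → Ascending σ → Inside σ → Reaches σ (cells n) Perm.id
  leaves-complete {σ} ascending inside = >-weakInduction
    (λ k → Reaches σ (columnsFrom k) (guide σ k)) last step zero
    where
    last : Reaches σ (columnsFrom (fromℕ n)) (guide σ (fromℕ n))
    last rewrite concatFrom-last (column {n}) = here (sym ∘ guide-last σ)
    step : ∀ i → Reaches σ (columnsFrom (suc i)) (guide σ (suc i)) →
           Reaches σ (columnsFrom (inject₁ i)) (guide σ (inject₁ i))
    step i r rewrite guide-suc σ i | concatFrom-inject₁ (column {n}) i
      with ∈-∃++ (∈-below (i ,_) (σ ⟨$⟩ʳ i))
    ... | xs , ys , eq rewrite eq | List.++-assoc xs (mark σ i ∷ ys) (columnsFrom (suc i)) =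
      reaches-skip {σ} {π} xs _ (case ℕ.m≤n⇒m<n∨m≡n (ascending i) of λ where
        (inj₁ lt) → reaches-switch {σ} {π} (mark σ i) _ (crossing lt) (inside i) r′
        -- Here the switch of `guide-suc` is the identity, so the mark is passed like the other
        -- cells.
        (inj₂ eq) → reaches-skip {σ} {π} (mark σ i ∷ []) _ (reaches-resp {σ} (ys ++ _) {switchAt π (mark σ i)} {π}
           (λ x → trans (cong (λ t → Perm.transpose (π ⟨$⟩ʳ i) t ⟨$⟩ʳ (π ⟨$⟩ʳ x)) (sym (Fin.toℕ-injective eq)))
                        (transpose-self (π ⟨$⟩ʳ i) (π ⟨$⟩ʳ x))) r′))
      where
      π = guide σ (inject₁ i)
      r′ = reaches-skip {σ} {switchAt π (mark σ i)} ys _ r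
      b = π ⟨$⟩ˡ (σ ⟨$⟩ʳ i)
      -- If the value σ i sat in an earlier column b, that column would already agree with σ, and σ
      -- would take the value σ i twice.
      crossing : π ⟨$⟩ʳ i < σ ⟨$⟩ʳ i → Cr π (mark σ i)
      crossing lt = lt , (case Fin.<-cmp i b of λ where
        (tri< i<b _ _) → i<b
        (tri≈ _ i≡b _) → ⊥-elim (Fin.<⇒≢ lt (⟨$⟩ʳ-unique π (sym i≡b)))
        (tri> _ _ b<i) → ⊥-elim (Fin.<⇒≢ b<i (⟨$⟩ʳ-injective σ (trans
           (sym (guide-agrees σ (inject₁ i) (subst (toℕ b ℕ.<_) (sym (Fin.toℕ-inject₁ i)) b<i)))
           (Perm.inverseʳ π)))))

module _ where

  open import Data.Nat.Base using (zero; suc)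

  -- Lattice paths

  at : Path → ℕ → ℕ × ℕ
  at p t = endpoint (take t p)

  advance : Step → ℕ × ℕ → ℕ × ℕ
  advance N (x , y) = x , suc y
  advance E (x , y) = suc x , y

  endpoint-∷ : ∀ s p → endpoint (s ∷ p) ≡ advance s (endpoint p)
  endpoint-∷ N p = refl
  endpoint-∷ E p = refl

  advance-comm : ∀ s s′ z → advance s (advance s′ z) ≡ advance s′ (advance s z)
  advance-comm N N z = refl
  advance-comm N E z = refl
  advance-comm E N z = refl
  advance-comm E E z = refl

  at-tabulate : ∀ {m} (f : Fin m → Step) i →
                at (tabulate f) (suc (toℕ i)) ≡ advance (f i) (at (tabulate f) (toℕ i))
  at-tabulate {suc m} f zero    = endpoint-∷ (f zero) []
  at-tabulate {suc m} f (suc i) = trans (endpoint-∷ (f zero) _)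
    (trans (cong (advance (f zero)) (at-tabulate (f ∘ suc) i))
    (trans (advance-comm (f zero) (f (suc i)) _)
           (cong (advance (f (suc i))) (sym (endpoint-∷ (f zero) _)))))

  at-≤ : ∀ p t → proj₁ (at p t) ℕ.≤ proj₁ (endpoint p) × proj₂ (at p t) ℕ.≤ proj₂ (endpoint p)
  at-≤ p       zero    = ℕ.z≤n , ℕ.z≤n
  at-≤ []      (suc t) = ℕ.z≤n , ℕ.z≤n
  at-≤ (N ∷ p) (suc t) = let (x≤ , y≤) = at-≤ p t in x≤ , ℕ.s≤s y≤
  at-≤ (E ∷ p) (suc t) = let (x≤ , y≤) = at-≤ p t in ℕ.s≤s x≤ , y≤

  reach : ∀ p {i} → i ℕ.≤ proj₁ (endpoint p) → ∃[ t ] proj₁ (at p t) ≡ i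
  reach p       {zero}  _ = 0 , refl
  reach (N ∷ p) {suc i} i≤x = let (t , eq) = reach p i≤x in suc t , eq
  reach (E ∷ p) {suc i} (ℕ.s≤s i≤x) = let (t , eq) = reach p i≤x in suc t , cong suc eq

  reach-later : ∀ p t {i} → proj₁ (at p t) ℕ.≤ i → i ℕ.≤ proj₁ (endpoint p) →
                ∃[ t′ ] proj₁ (at p t′) ≡ i × proj₂ (at p t) ℕ.≤ proj₂ (at p t′)
  reach-later p       zero    _ i≤x = let (t , eq) = reach p i≤x in t , eq , ℕ.z≤n
  reach-later []      (suc t) _ ℕ.z≤n = 0 , refl , ℕ.z≤n
  reach-later (N ∷ p) (suc t) x≤i i≤x = let (t′ , eq , y≤) = reach-later p t x≤i i≤x in suc t′ , eq , ℕ.s≤s y≤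
  reach-later (E ∷ p) (suc t) (ℕ.s≤s x≤i) (ℕ.s≤s i≤x) =
    let (t′ , eq , y≤) = reach-later p t x≤i i≤x in suc t′ , cong suc eq , y≤

  east-step : ∀ p {i} → i ℕ.< proj₁ (endpoint p) →
              ∃[ t ] proj₁ (at p t) ≡ i × at p (suc t) ≡ (suc i , proj₂ (at p t))
  east-step (N ∷ p) i<x = let (t , eq , eq′) = east-step p i<x in suc t , eq , cong (advance N) eq′
  east-step (E ∷ p) {zero}  i<x = 0 , refl , refl
  east-step (E ∷ p) {suc i} (ℕ.s≤s i<x) =
    let (t , eq , eq′) = east-step p i<x in suc t , cong suc eq , cong (advance E) eq′

  module _ {n p} (dyck : Dyck n p) where

    Below-⪰ : ∀ {c d : Cell n} → Below p c → c ⪰ d → Below p d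
    Below-⪰ {d = i , j} (t , x≡ , j<y) (≤i , j≤) =
      let (t′ , eq , y≤) = reach-later p t (subst (ℕ._≤ toℕ i) (sym x≡) ≤i)
            (subst (toℕ i ℕ.≤_) (sym (cong proj₁ (proj₁ dyck))) (ℕ.<⇒≤ (Fin.toℕ<n i)))
      in t′ , eq , ℕ.≤-<-trans j≤ (ℕ.<-≤-trans j<y y≤)

    Below-diagonal : ∀ i → Below p (i , i)
    Below-diagonal i =
      let (t , eq , eq′) = east-step p (subst (toℕ i ℕ.<_) (sym (cong proj₁ (proj₁ dyck))) (Fin.toℕ<n i))
      in t , eq , subst (λ (x , y) → x ℕ.≤ y) eq′ (proj₂ dyck (suc t))

  -- The path from height y whose height in column k is the maximum of y, g 0, …, g k

  staircase : ∀ {m} → (Fin m → ℕ) → ℕ → Path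
  staircase {zero}  g y = []
  staircase {suc m} g y = replicate (g zero ∸ y) N ++ E ∷ staircase (g ∘ suc) (y + (g zero ∸ y))

  at-replicate : ∀ r p t → (∃[ b ] b ℕ.≤ r × at (replicate r N ++ p) t ≡ (0 , b))
               ⊎ (∃[ t′ ] at (replicate r N ++ p) t ≡ (proj₁ (at p t′) , r + proj₂ (at p t′)))
  at-replicate zero    p t       = inj₂ (t , refl)
  at-replicate (suc r) p zero    = inj₁ (0 , ℕ.z≤n , refl)
  at-replicate (suc r) p (suc t) with at-replicate r p t
  ... | inj₁ (b , b≤r , eq) = inj₁ (suc b , ℕ.s≤s b≤r , cong (advance N) eq)
  ... | inj₂ (t′ , eq)      = inj₂ (t′ , cong (advance N) eq)

  at-replicate-+ : ∀ r p t → at (replicate r N ++ p) (r + t) ≡ (proj₁ (at p t) , r + proj₂ (at p t))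
  at-replicate-+ zero    p t = refl
  at-replicate-+ (suc r) p t = cong (advance N) (at-replicate-+ r p t)

  endpoint-replicate : ∀ r p → endpoint (replicate r N ++ p) ≡ (proj₁ (endpoint p) , r + proj₂ (endpoint p))
  endpoint-replicate zero    p = refl
  endpoint-replicate (suc r) p = cong (advance N) (endpoint-replicate r p)

  staircase-width : ∀ {m} (g : Fin m → ℕ) y → proj₁ (endpoint (staircase g y)) ≡ m
  staircase-width {zero}  g y = refl
  staircase-width {suc m} g y = trans (cong proj₁ (endpoint-replicate (g zero ∸ y) _))
    (cong suc (staircase-width (g ∘ suc) _))


  <-+∸ : ∀ {j} y g → j ℕ.< y + (g ∸ y) → j ℕ.< y ⊎ j ℕ.< g
  <-+∸ {j} y g j< with ℕ.≤-total g y
  ... | inj₁ g≤y = inj₁ (subst (j ℕ.<_) (trans (cong (y +_) (ℕ.m≤n⇒m∸n≡0 g≤y)) (ℕ.+-identityʳ y)) j<)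
  ... | inj₂ y≤g = inj₂ (subst (j ℕ.<_) (ℕ.m+[n∸m]≡n y≤g) j<)

  staircase-below : ∀ {m} (g : Fin m → ℕ) y t {j} → let (a , b) = at (staircase g y) t in
                    j ℕ.< y + b → j ℕ.< y ⊎ (∃[ k ] toℕ k ℕ.≤ a × j ℕ.< g k)
  staircase-below {zero}  g y zero    j< = inj₁ (subst (_ ℕ.<_) (ℕ.+-identityʳ y) j<)
  staircase-below {zero}  g y (suc t) j< = inj₁ (subst (_ ℕ.<_) (ℕ.+-identityʳ y) j<)
  staircase-below {suc m} g y t {j} j<
    with at-replicate (g zero ∸ y) (E ∷ staircase (g ∘ suc) (y + (g zero ∸ y))) t
  ... | inj₁ (b , b≤r , eq) rewrite eq =
    ⊎.map₂ (λ j<g → zero , ℕ.z≤n , j<g) (<-+∸ y (g zero) (ℕ.<-≤-trans j< (ℕ.+-monoʳ-≤ y b≤r)))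
  ... | inj₂ (zero , eq) rewrite eq | ℕ.+-identityʳ (g zero ∸ y) =
    ⊎.map₂ (λ j<g → zero , ℕ.z≤n , j<g) (<-+∸ y (g zero) j<)
  ... | inj₂ (suc t′ , eq) rewrite eq
    with staircase-below (g ∘ suc) (y + (g zero ∸ y)) t′ (subst (j ℕ.<_) (sym (ℕ.+-assoc y (g zero ∸ y) _)) j<)
  ...   | inj₁ j<′ = ⊎.map₂ (λ j<g → zero , ℕ.z≤n , j<g) (<-+∸ y (g zero) j<′)
  ...   | inj₂ (k , k≤ , j<g) = inj₂ (suc k , ℕ.s≤s k≤ , j<g)

  staircase-above : ∀ {m} (g : Fin m → ℕ) y k → ∃[ t ] let (a , b) = at (staircase g y) t in
                    a ≡ toℕ k × g k ℕ.≤ y + b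
  staircase-above {suc m} g y zero = g zero ∸ y + 0 , cong proj₁ eq ,
    subst (λ b → g zero ℕ.≤ y + b) (sym (trans (cong proj₂ eq) (ℕ.+-identityʳ _))) (ℕ.m≤n+m∸n (g zero) y)
    where eq = at-replicate-+ (g zero ∸ y) (E ∷ staircase (g ∘ suc) (y + (g zero ∸ y))) 0
  staircase-above {suc m} g y (suc k) =
    let (t , a≡ , g≤) = staircase-above (g ∘ suc) (y + (g zero ∸ y)) k
        eq = at-replicate-+ (g zero ∸ y) (E ∷ staircase (g ∘ suc) (y + (g zero ∸ y))) (suc t)
    in g zero ∸ y + suc t , trans (cong proj₁ eq) (cong suc a≡) ,
       subst (g (suc k) ℕ.≤_) (trans (ℕ.+-assoc y _ _) (cong (y +_) (sym (cong proj₂ eq)))) g≤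

  -- The staircase is regarded as starting at (c , y), which lets the induction move on to the next
  -- column.
  staircase-dyck : ∀ {m} (g : Fin m → ℕ) c y → c ℕ.≤ y → (∀ k → c + toℕ k ℕ.< g k) →
                   ∀ t → let (a , b) = at (staircase g y) t in c + a ℕ.≤ y + b
  staircase-dyck {zero}  g c y c≤y c<g zero    = ℕ.+-monoˡ-≤ 0 c≤y
  staircase-dyck {zero}  g c y c≤y c<g (suc t) = ℕ.+-monoˡ-≤ 0 c≤y
  staircase-dyck {suc m} g c y c≤y c<g t
    with at-replicate (g zero ∸ y) (E ∷ staircase (g ∘ suc) (y + (g zero ∸ y))) t
  ... | inj₁ (b , _ , eq) rewrite eq | ℕ.+-identityʳ c = ℕ.≤-trans c≤y (ℕ.m≤m+n y b)
  ... | inj₂ (zero , eq) rewrite eq | ℕ.+-identityʳ c = ℕ.≤-trans c≤y (ℕ.m≤m+n y _)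
  ... | inj₂ (suc t′ , eq) rewrite eq = subst₂ ℕ._≤_ (sym (ℕ.+-suc c _)) (ℕ.+-assoc y (g zero ∸ y) _)
    (staircase-dyck (g ∘ suc) (suc c) (y + (g zero ∸ y))
      (ℕ.≤-trans (subst (ℕ._< g zero) (ℕ.+-identityʳ c) (c<g zero)) (ℕ.m≤n+m∸n (g zero) y))
      (λ k → subst (ℕ._< g (suc k)) (ℕ.+-suc c (toℕ k)) (c<g (suc k))) t′)

  at-length : ∀ p t → List.length p ℕ.≤ t → at p t ≡ endpoint p
  at-length p t l = cong endpoint (List.take-all t p l)

  permutationPath : (σ : Permutation′ n) → ∃[ p ] IsPermutationPath σ p
  permutationPath {n} σ = path , dyck , marked , minimal
    where
    g : Fin n → ℕ
    -- The term i keeps the path above the diagonal and σ i puts the mark below it. Every Dyck path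
    -- with the marks below it has both (i , i) and (i , σ i) below it, whence minimality.
    g i = suc (toℕ i ⊔ toℕ (σ ⟨$⟩ʳ i))
    path : Path
    path = staircase g 0
    whole : at path (List.length path) ≡ endpoint path
    whole = at-length path _ ℕ.≤-refl
    g≤n : ∀ k → g k ℕ.≤ n
    g≤n k = ℕ.⊔-pres-<m (Fin.toℕ<n k) (Fin.toℕ<n _)
    below-diagonal : ∀ t → proj₁ (at path t) ℕ.≤ proj₂ (at path t)
    below-diagonal = staircase-dyck g 0 0 ℕ.z≤n (λ k → ℕ.s≤s (ℕ.m≤m⊔n _ _))
    height≤n : proj₂ (endpoint path) ℕ.≤ n
    height≤n = ℕ.≮⇒≥ λ n< → case staircase-below g 0 (List.length path) (subst (λ z → n ℕ.< proj₂ z) (sym whole) n<) of λ where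
      (inj₂ (k , _ , n<g)) → ℕ.<⇒≱ n<g (g≤n k)
    n≤height : n ℕ.≤ proj₂ (endpoint path)
    n≤height = subst₂ ℕ._≤_ (trans (cong proj₁ whole) (staircase-width g 0)) (cong proj₂ whole)
      (below-diagonal (List.length path))
    dyck : Dyck n path
    dyck = cong₂ _,_ (staircase-width g 0) (ℕ.≤-antisym height≤n n≤height) , below-diagonal
    marked : MarkedBelow σ path
    marked i = let (t , a≡ , g≤) = staircase-above g 0 i in
      t , a≡ , ℕ.<-≤-trans (ℕ.s≤s (ℕ.m≤n⊔m (toℕ i) _)) g≤
    minimal : ∀ q → Dyck n q → MarkedBelow σ q → RegionIncluded n path q
    minimal q dyck′ marked′ {i , j} (t , a≡ , j<b) with staircase-below g 0 t j<b
    ... | inj₂ (k , k≤ , ℕ.s≤s j≤) = [_,_]′ (λ k⊔σ≡k → Below-⪰ dyck′ {k , k} (Below-diagonal dyck′ k)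
                                                 (k≤i , subst (toℕ j ℕ.≤_) k⊔σ≡k j≤))
                                       (λ k⊔σ≡σ → Below-⪰ dyck′ {k , σ ⟨$⟩ʳ k} (marked′ k)
                                                 (k≤i , subst (toℕ j ℕ.≤_) k⊔σ≡σ j≤))
                                       (ℕ.⊔-sel (toℕ k) (toℕ (σ ⟨$⟩ʳ k)))
      where
      open ⊎ using ([_,_]′)
      k≤i = subst (toℕ k ℕ.≤_) a≡ k≤

  module _ {n} (M : Matching n) (T : Tableau n) (joins : partner (columnMatching T) ≗ partner M) where

    partner-entry : ∀ r k → partner M (entry T r k) ≡ entry T (opposite r) k
    partner-entry r k = trans (sym (joins _))
      (cong (λ (r , k) → entry T (opposite r) k) (Inverse.strictlyInverseʳ T (r , k)))

  -- The path of a matching that joins the columns of a standard tableau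

  module StandardPath {n} (M : Matching n) (T : Tableau n) (standard : Standard T)
                      (joins : partner (columnMatching T) ≗ partner M) where

    opener closer : Fin n → Fin (2 * n)
    opener = entry T 0F
    closer = entry T 1F

    opener<closer : ∀ k → opener k < closer k
    opener<closer = proj₂ standard

    step : Fin (2 * n) → Step
    step i = if does (i <? partner M i) then N else E

    path : Path
    path = matchingPath M

    step-opener : ∀ k → step (opener k) ≡ N
    step-opener k rewrite partner-entry M T joins 0F k | dec-true (opener k <? closer k) (opener<closer k) = refl

    step-closer : ∀ k → step (closer k) ≡ E
    step-closer k rewrite partner-entry M T joins 1F k | dec-false (closer k <? opener k) (ℕ.<-asym (opener<closer k)) = refl

    opener≢closer : ∀ j i → opener j ≢ closer i
    opener≢closer j i eq with trans (sym (Inverse.strictlyInverseʳ T (0F , j)))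
                               (trans (cong (Inverse.from T) eq) (Inverse.strictlyInverseʳ T (1F , i)))
    ... | ()

    -- The rows of a standard tableau increase, so the entries of row r smaller than t form an
    -- initial segment, here of length y. `Reading` uses this to identify the lattice point after t
    -- steps.
    Counts : Fin 2 → ℕ → ℕ → Set
    Counts r t y = ∀ k → (toℕ (entry T r k) ℕ.< t) ⇔ (toℕ k ℕ.< y)

    counts-hit : ∀ r k {y} → Counts r (toℕ (entry T r k)) y → y ≡ toℕ k
    counts-hit r k {y} c with ℕ.<-cmp y (toℕ k)
    ... | tri≈ _ eq _ = eq
    ... | tri> _ _ k<y = ⊥-elim (ℕ.<-irrefl refl (Equivalence.from (c k) k<y))
    ... | tri< y<k _ _ = ⊥-elim (ℕ.<-irrefl (Fin.toℕ-fromℕ< y<n) (Equivalence.to (c (fromℕ< y<n))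
            (proj₁ standard r (subst (ℕ._< toℕ k) (sym (Fin.toℕ-fromℕ< y<n)) y<k))))
      where y<n = ℕ.<-trans y<k (Fin.toℕ<n k)

    counts-suc-hit : ∀ r k {y} → Counts r (toℕ (entry T r k)) y → Counts r (suc (toℕ (entry T r k))) (suc y)
    counts-suc-hit r k c l rewrite counts-hit r k c = mk⇔
      (λ lt → ℕ.s≤s (ℕ.≮⇒≥ λ k<l → ℕ.<⇒≱ (proj₁ standard r k<l) (ℕ.s≤s⁻¹ lt)))
      (λ l≤k → case ℕ.m≤n⇒m<n∨m≡n (ℕ.s≤s⁻¹ l≤k) of λ where
        (inj₁ l<k) → ℕ.m<n⇒m<1+n (proj₁ standard r l<k)
        (inj₂ l≡k) → ℕ.≤-reflexive (cong (suc ∘ toℕ ∘ entry T r) (Fin.toℕ-injective l≡k)))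

    counts-suc-miss : ∀ r {t y} → (∀ k → toℕ (entry T r k) ≢ t) → Counts r t y → Counts r (suc t) y
    counts-suc-miss r miss c k = mk⇔
      (λ lt → Equivalence.to (c k) (ℕ.≤∧≢⇒< (ℕ.s≤s⁻¹ lt) (miss k)))
      (λ lt → ℕ.m<n⇒m<1+n (Equivalence.from (c k) lt))

    Reading : ℕ → Set
    Reading t = let (x , y) = at path t in
      Counts 0F t y × Counts 1F t x × (t ℕ.≤ 2 * n → x + y ≡ t)

    reading-suc : ∀ t → Reading t → Reading (suc t)
    reading-suc t (c₀ , c₁ , s) with t ℕ.<? 2 * n
    ... | no t≮ = subst (λ (x , y) → Counts 0F (suc t) y × Counts 1F (suc t) x × (suc t ℕ.≤ 2 * n → x + y ≡ suc t))
            same ( counts-suc-miss 0F (miss 0F) c₀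
                 , counts-suc-miss 1F (miss 1F) c₁
                 , λ t< → ⊥-elim (t≮ t<))
      where
      miss : ∀ r k → toℕ (entry T r k) ≢ t
      miss r k refl = t≮ (Fin.toℕ<n (entry T r k))
      l≤t : List.length path ℕ.≤ t
      l≤t = subst (ℕ._≤ t) (sym (List.length-tabulate step)) (ℕ.≮⇒≥ t≮)
      same : at path t ≡ at path (suc t)
      same = trans (at-length path t l≤t) (sym (at-length path (suc t) (ℕ.m≤n⇒m≤1+n l≤t)))
    ... | yes t< = go (proj₁ (Inverse.from T i)) (proj₂ (Inverse.from T i))
                      (trans (cong toℕ (Inverse.strictlyInverseˡ T i)) (Fin.toℕ-fromℕ< t<))
      where
      i = fromℕ< t<
      go : ∀ r k → toℕ (entry T r k) ≡ t → Reading (suc t)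
      go 0F k refl rewrite at-tabulate step (opener k) | step-opener k =
          counts-suc-hit 0F k c₀
        , counts-suc-miss 1F (λ l eq → opener≢closer k l (sym (Fin.toℕ-injective eq))) c₁
        , λ _ → trans (ℕ.+-suc _ _) (cong suc (s (ℕ.<⇒≤ t<)))
      go 1F k refl rewrite at-tabulate step (closer k) | step-closer k =
          counts-suc-miss 0F (λ l eq → opener≢closer l k (Fin.toℕ-injective eq)) c₀
        , counts-suc-hit 1F k c₁
        , λ _ → cong suc (s (ℕ.<⇒≤ t<))

    reading : ∀ t → Reading t
    reading zero    = (λ _ → mk⇔ (λ ()) (λ ())) , (λ _ → mk⇔ (λ ()) (λ ())) , λ _ → refl
    reading (suc t) = reading-suc t (reading t)

    -- The path leaves column i with the step of the i-th closer, and its height at that moment is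
    -- the number of openers read before.
    below⇔ : ∀ j i → Below path (i , j) ⇔ (opener j < closer i)
    below⇔ j i = mk⇔ to from
      where
      to : Below path (i , j) → opener j < closer i
      to (t , x≡i , j<y) = ℕ.<-≤-trans (Equivalence.from (proj₁ (reading t) j) j<y)
        (ℕ.≮⇒≥ λ lt → ℕ.<-irrefl (sym x≡i) (Equivalence.to (proj₁ (proj₂ (reading t)) i) lt))
      from : opener j < closer i → Below path (i , j)
      from lt = toℕ (closer i) , counts-hit 1F i (proj₁ (proj₂ (reading (toℕ (closer i)))))
              , Equivalence.to (proj₁ (reading (toℕ (closer i))) j) lt

    -- Here e counts the closers before the opener; it is the abscissa at which the path climbs
    -- through row j. The sum e + j returns in `Compare` as a label of the full grid.
    opener-position : ∀ j → ∃[ e ] (∀ i → (closer i < opener j) ⇔ (toℕ i ℕ.< e)) × toℕ (opener j) ≡ e + toℕ j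
    opener-position j = let (c₀ , c₁ , s) = reading (toℕ (opener j)) in
      _ , c₁ , trans (sym (s (ℕ.<⇒≤ (Fin.toℕ<n (opener j))))) (cong (proj₁ (at path (toℕ (opener j))) +_) (counts-hit 0F j c₀))

    closer-position : ∀ i → ∃[ h ] (∀ j → (opener j < closer i) ⇔ (toℕ j ℕ.< h)) × toℕ (closer i) ≡ toℕ i + h
    closer-position i = let (c₀ , c₁ , s) = reading (toℕ (closer i)) in
      _ , c₀ , trans (sym (s (ℕ.<⇒≤ (Fin.toℕ<n (closer i))))) (cong (_+ proj₂ (at path (toℕ (closer i)))) (counts-hit 1F i c₁))

    path-dyck : Dyck n path
    path-dyck = cong₂ _,_ x≡n y≡n , below-diagonal
      where
      ≤-by-Fin : ∀ {y} → (∀ (k : Fin n) → toℕ k ℕ.< y) → n ℕ.≤ y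
      ≤-by-Fin {y} all = ℕ.≮⇒≥ λ y<n → ℕ.<-irrefl (Fin.toℕ-fromℕ< y<n) (all (fromℕ< y<n))
      end : at path (2 * n) ≡ endpoint path
      end = at-length path (2 * n) (ℕ.≤-reflexive (List.length-tabulate step))
      x = proj₁ (endpoint path)
      y = proj₂ (endpoint path)
      n≤y : n ℕ.≤ y
      n≤y = subst (λ z → n ℕ.≤ proj₂ z) end
        (≤-by-Fin λ k → Equivalence.to (proj₁ (reading (2 * n)) k) (Fin.toℕ<n (opener k)))
      n≤x : n ℕ.≤ x
      n≤x = subst (λ z → n ℕ.≤ proj₁ z) end
        (≤-by-Fin λ k → Equivalence.to (proj₁ (proj₂ (reading (2 * n))) k) (Fin.toℕ<n (closer k)))
      x+y : x + y ≡ n + n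
      x+y = trans (subst (λ (x , y) → x + y ≡ 2 * n) end (proj₂ (proj₂ (reading (2 * n))) ℕ.≤-refl))
              (cong (n +_) (ℕ.+-identityʳ n))
      x≡n : x ≡ n
      x≡n = ℕ.≤-antisym (ℕ.+-cancelʳ-≤ n x n (subst (x + n ℕ.≤_) x+y (ℕ.+-monoʳ-≤ x n≤y))) n≤x
      y≡n : y ≡ n
      y≡n = ℕ.+-cancelˡ-≡ n y n (trans (cong (_+ y) (sym x≡n)) x+y)
      below-diagonal : ∀ t → proj₁ (at path t) ℕ.≤ proj₂ (at path t)
      below-diagonal t = ℕ.≮⇒≥ λ y<x →
        case proj₂ (at path t) ℕ.<? n of λ where
          (no y≮n) → ℕ.<⇒≱ (ℕ.≤-<-trans (ℕ.≮⇒≥ y≮n) y<x) (x≤n t)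
          (yes y<n) → ℕ.<-irrefl (Fin.toℕ-fromℕ< y<n)
            (Equivalence.to (proj₁ (reading t) (fromℕ< y<n))
              (ℕ.<-trans (opener<closer (fromℕ< y<n))
                (Equivalence.from (proj₁ (proj₂ (reading t)) (fromℕ< y<n))
                  (subst (ℕ._< proj₁ (at path t)) (sym (Fin.toℕ-fromℕ< y<n)) y<x))))
        where
        x≤n : ∀ t → proj₁ (at path t) ℕ.≤ n
        x≤n t = subst (proj₁ (at path t) ℕ.≤_) x≡n (proj₁ (at-≤ path t))

    closer-height : ∀ i → proj₁ (closer-position i) ℕ.≤ n
    closer-height i = subst (proj₁ (closer-position i) ℕ.≤_) (cong proj₂ (proj₁ path-dyck))
      (proj₂ (at-≤ path (toℕ (closer i))))

    opener-width : ∀ j → proj₁ (opener-position j) ℕ.≤ n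
    opener-width j = subst (proj₁ (opener-position j) ℕ.≤_) (cong proj₁ (proj₁ path-dyck))
      (proj₁ (at-≤ path (toℕ (opener j))))

    -- Forwards by the minimality of D(σ) among the Dyck paths above the marks; backwards because
    -- D(σ) has the marks below it.
    inside⇔ : (σ : Permutation′ n) → (∀ i → opener (σ ⟨$⟩ʳ i) < closer i) ⇔
              (∃[ p ] IsPermutationPath σ p × RegionIncluded n p path)
    inside⇔ σ = mk⇔
      (λ inside → let (p , isPath) = permutationPath σ in p , isPath ,
         λ {c} → proj₂ (proj₂ isPath) path path-dyck (λ i → Equivalence.from (below⇔ (σ ⟨$⟩ʳ i) i) (inside i)) {c})
      (λ (p , (_ , marked , _) , included) i → Equivalence.to (below⇔ (σ ⟨$⟩ʳ i) i) (included {i , σ ⟨$⟩ʳ i} (marked i)))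

infixl 6 _[_≔_]

_[_≔_] : {A : Set} → (Fin n → A) → Fin n → A → Fin n → A
f [ i ≔ a ] = updateAt f i (const a)

≔-updates : {A : Set} (f : Fin n → A) (i : Fin n) {a : A} → (f [ i ≔ a ]) i ≡ a
≔-updates f i = updateAt-updates i f

≔-minimal : {A : Set} (f : Fin n → A) {i k : Fin n} {a : A} → k ≢ i → (f [ i ≔ a ]) k ≡ f k
≔-minimal f {i} {k} k≢i = updateAt-minimal k i f k≢i

-- Exchanging labels cell by cell computes the labels on the edges

Labelling : ℕ → Set → Set
Labelling n A = (Fin n → A) × (Fin n → A)

module _ {A : Set} where

  -- The state is the front of a sweep: r holds the labels arriving on the rows from the left, l
  -- those arriving on the columns from the top. At an elbow the left label turns down and the top
  -- label turns right.
  exchange : Cell n → Labelling n A → Labelling n A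
  exchange (i , j) (r , l) = r [ j ≔ l i ] , l [ i ≔ r j ]

  run : {X : Pred (Cell n) 0ℓ} → Decidable X → List (Cell n) → Labelling n A → Labelling n A
  run X? []       s = s
  run X? (c ∷ cs) s = run X? cs (if does (X? c) then exchange c s else s)

  module Run {n} {X : Pred (Cell n) 0ℓ} (X? : Decidable X) (v t : Fin n → A) where

    open Labels X? v t

    AtColumn : Fin (ℕ.suc n) → Labelling n A → Set
    AtColumn k (r , l) = (∀ j → r j ≡ V k j)
                       × (∀ c → toℕ c ℕ.< toℕ k → l c ≡ H c zero)
                       × (∀ c → toℕ k ℕ.≤ toℕ c → l c ≡ t c)

    -- The state in the middle of column i, when its cells at height y and above have been passed.
    record AtRow (i : Fin n) (y : Fin (ℕ.suc n)) (s : Labelling n A) : Set where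
      field
        row-below : ∀ {j} → toℕ j ℕ.< toℕ y → proj₁ s j ≡ V (inject₁ i) j
        row-above : ∀ {j} → toℕ y ℕ.≤ toℕ j → proj₁ s j ≡ V (suc i) j
        col-left  : ∀ {c} → c < i → proj₂ s c ≡ H c zero
        col-here  : proj₂ s i ≡ H i y
        col-right : ∀ {c} → i < c → proj₂ s c ≡ t c

    open AtRow

    step-row : ∀ i j s → AtRow i (suc j) s →
               AtRow i (inject₁ j) (if does (X? (i , j)) then exchange (i , j) s else s)
    step-row i j (r , l) a with X? (i , j)
    ... | no ¬x = record
      { row-below = λ k<j → row-below a (ℕ.m<n⇒m<1+n (subst (_ ℕ.<_) (Fin.toℕ-inject₁ j) k<j))
      ; row-above = above
      ; col-left  = col-left a
      ; col-here  = trans (col-here a) (sym (H-straight ¬x))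
      ; col-right = col-right a
      }
      where
      above : ∀ {k} → toℕ (inject₁ j) ℕ.≤ toℕ k → r k ≡ V (suc i) k
      above j≤k rewrite Fin.toℕ-inject₁ j with ℕ.m≤n⇒m<n∨m≡n j≤k
      ... | inj₁ j<k = row-above a j<k
      ... | inj₂ j≡k with Fin.toℕ-injective j≡k
      ...   | refl = trans (row-below a ℕ.≤-refl) (sym (V-straight ¬x))
    ... | yes x = record
      { row-below = λ {k} k<j → let k<j = subst (toℕ k ℕ.<_) (Fin.toℕ-inject₁ j) k<j in
          trans (≔-minimal r (Fin.<⇒≢ k<j)) (row-below a (ℕ.m<n⇒m<1+n k<j))
      ; row-above = above
      ; col-left  = λ c<i → trans (≔-minimal l (Fin.<⇒≢ c<i)) (col-left a c<i)
      ; col-here  = trans (≔-updates l i) (trans (row-below a ℕ.≤-refl) (sym (H-elbow x)))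
      ; col-right = λ i<c → trans (≔-minimal l (Fin.<⇒≢ i<c ∘ sym)) (col-right a i<c)
      }
      where
      above : ∀ {k} → toℕ (inject₁ j) ℕ.≤ toℕ k → (r [ j ≔ l i ]) k ≡ V (suc i) k
      above j≤k rewrite Fin.toℕ-inject₁ j with ℕ.m≤n⇒m<n∨m≡n j≤k
      ... | inj₁ j<k = trans (≔-minimal r (Fin.<⇒≢ j<k ∘ sym)) (row-above a j<k)
      ... | inj₂ j≡k with Fin.toℕ-injective j≡k
      ...   | refl = trans (≔-updates r j) (trans (col-here a) (sym (V-elbow x)))

    run-columns : ∀ k s → AtColumn k s → AtColumn (fromℕ n) (run X? (columnsFrom k) s)
    run-columns = >-weakInduction _ last columns
      where
      last : ∀ s → AtColumn (fromℕ n) s → AtColumn (fromℕ n) (run X? (columnsFrom (fromℕ n)) s)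
      last s a rewrite concatFrom-last (column {n}) = a
      columns : ∀ i → (∀ s → AtColumn (suc i) s → AtColumn (fromℕ n) (run X? (columnsFrom (suc i)) s)) →
                ∀ s → AtColumn (inject₁ i) s → AtColumn (fromℕ n) (run X? (columnsFrom (inject₁ i)) s)
      columns i ih s (rows , left′ , right′) rewrite concatFrom-inject₁ (column {n}) i =
        <-weakInduction Rows finish rows-step (fromℕ n) s record
          { row-below = λ _ → rows _
          ; row-above = λ {j} n≤j → ⊥-elim (ℕ.<⇒≱ (Fin.toℕ<n j) (subst (ℕ._≤ toℕ j) (Fin.toℕ-fromℕ n) n≤j))
          ; col-left  = λ {c} c<i → left′ c (subst (toℕ c ℕ.<_) (sym (Fin.toℕ-inject₁ i)) c<i)
          ; col-here  = trans (right′ i (ℕ.≤-reflexive (Fin.toℕ-inject₁ i))) (sym (H-last i))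
          ; col-right = λ {c} i<c → right′ c (subst (ℕ._≤ toℕ c) (sym (Fin.toℕ-inject₁ i)) (ℕ.<⇒≤ i<c))
          }
        where
        Rows : Fin (ℕ.suc n) → Set
        Rows y = ∀ s → AtRow i y s → AtColumn (fromℕ n) (run X? (below (i ,_) y ++ columnsFrom (suc i)) s)
        finish : Rows zero
        finish s a = ih s
          ( (λ j → row-above a ℕ.z≤n)
          , (λ c c≤i → case ℕ.m≤n⇒m<n∨m≡n (ℕ.s≤s⁻¹ c≤i) of λ where
              (inj₁ c<i) → col-left a c<i
              (inj₂ c≡i) → subst (λ c → proj₂ s c ≡ H c zero) (sym (Fin.toℕ-injective c≡i)) (col-here a))
          , (λ c i<c → col-right a i<c))
        rows-step : ∀ j → Rows (inject₁ j) → Rows (suc j)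
        rows-step j ih s a rewrite below-suc (λ j → (i , j)) j = ih _ (step-row i j s a)

    run-cells : let (r , l) = run X? (cells n) (v , t) in
                (∀ j → r j ≡ V (fromℕ n) j) × (∀ i → l i ≡ H i zero)
    run-cells = let (rows , cols , _) = run-columns zero (v , t) ((λ _ → refl) , (λ _ ()) , (λ _ _ → refl)) in
      rows , λ i → cols i (subst (toℕ i ℕ.<_) (sym (Fin.toℕ-fromℕ n)) (Fin.toℕ<n i))

-- Expanding a product by three-term relations

module ListSum {c ℓ} (R : CommutativeRing c ℓ) where

  open CommutativeRing R renaming (_+_ to infixl 6 _⊕_; refl to ≈-refl; sym to ≈-sym; trans to ≈-trans)

  total : ∀ {B : Set} → (B → Carrier) → List B → Carrier
  total f = foldr (λ x s → f x ⊕ s) 0#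

  total-++ : ∀ {B : Set} (f : B → Carrier) xs ys → total f (xs ++ ys) ≈ total f xs ⊕ total f ys
  total-++ f []       ys = ≈-sym (+-identityˡ _)
  total-++ f (x ∷ xs) ys = ≈-trans (+-congˡ (total-++ f xs ys)) (≈-sym (+-assoc _ _ _))

  total-cong : ∀ {B : Set} {f g : B → Carrier} {xs} → All (λ x → f x ≈ g x) xs → total f xs ≈ total g xs
  total-cong []        = ≈-refl
  total-cong (eq ∷ eqs) = +-cong eq (total-cong eqs)

-- The Plücker relation, arranged without signs for row labels w, x and column labels y, z: a
-- crossing on the left, its smoothing and its switch on the right.
ThreeTerm : ∀ {c ℓ} (R : CommutativeRing c ℓ) {A : Set} → (A → A → CommutativeRing.Carrier R) → Set ℓ
ThreeTerm R {A} d = ∀ (w x y z : A) → d w y ⊗ d x z ≈ d w x ⊗ d y z ⊕ d w z ⊗ d x y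
  where open CommutativeRing R renaming (_+_ to infixl 6 _⊕_; _*_ to infixl 7 _⊗_)

module Expansion {c ℓ} (R : CommutativeRing c ℓ) {A : Set} {d : A → A → CommutativeRing.Carrier R}
                 (three-term : ThreeTerm R d) where

  open CommutativeRing R hiding (zero)
    renaming (_+_ to infixl 6 _⊕_; _*_ to infixl 7 _⊗_; refl to ≈-refl; sym to ≈-sym; trans to ≈-trans)
  open Sum *-commutativeMonoid renaming (sum to product; sum-cong-≋ to product-cong) using ()
  open ListSum R
  open import Relation.Binary.Reasoning.Setoid setoid

  product-extract : ∀ {m} (f : Fin m → Carrier) i → product f ≈ f i ⊗ product (updateAt f i (const 1#))
  product-extract f zero    = *-congˡ (≈-sym (*-identityˡ _))
  product-extract f (suc i) = begin
    f zero ⊗ product (f ∘ suc)                   ≈⟨ *-congˡ (product-extract (f ∘ suc) i) ⟩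
    f zero ⊗ (f (suc i) ⊗ rest)                 ≈⟨ *-assoc _ _ _ ⟨
    f zero ⊗ f (suc i) ⊗ rest                   ≈⟨ *-congʳ (*-comm _ _) ⟩
    f (suc i) ⊗ f zero ⊗ rest                   ≈⟨ *-assoc _ _ _ ⟩
    f (suc i) ⊗ (f zero ⊗ rest)                 ∎
    where rest = product (updateAt (f ∘ suc) i (const 1#))

  product-two : ∀ {m} (f : Fin m → Carrier) {i k} → k ≢ i →
                product f ≈ f i ⊗ f k ⊗ product (updateAt (updateAt f i (const 1#)) k (const 1#))
  product-two f {i} {k} k≢i = begin
    product f                                 ≈⟨ product-extract f i ⟩
    f i ⊗ product f′                         ≈⟨ *-congˡ (product-extract f′ k) ⟩
    f i ⊗ (f′ k ⊗ product f″)               ≈⟨ *-congˡ (*-congʳ (reflexive (updateAt-minimal k i f k≢i))) ⟩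
    f i ⊗ (f k ⊗ product f″)                ≈⟨ *-assoc _ _ _ ⟨
    f i ⊗ f k ⊗ product f″                  ∎
    where
    f′ = updateAt f i (const 1#)
    f″ = updateAt f′ k (const 1#)

  product-split : ∀ {m} (f g h : Fin m → Carrier) {i k} → k ≢ i →
                  (∀ {x} → x ≢ i → x ≢ k → f x ≡ g x × f x ≡ h x) →
                  f i ⊗ f k ≈ g i ⊗ g k ⊕ h i ⊗ h k → product f ≈ product g ⊕ product h
  product-split f g h {i} {k} k≢i same eq = begin
    product f                                              ≈⟨ product-two f k≢i ⟩
    f i ⊗ f k ⊗ rest f                                   ≈⟨ *-congʳ eq ⟩
    (g i ⊗ g k ⊕ h i ⊗ h k) ⊗ rest f                   ≈⟨ distribʳ _ _ _ ⟩
    g i ⊗ g k ⊗ rest f ⊕ h i ⊗ h k ⊗ rest f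
      ≈⟨ +-cong (*-congˡ (rest-cong f g (λ p q → proj₁ (same p q)))) (*-congˡ (rest-cong f h (λ p q → proj₂ (same p q)))) ⟩
    g i ⊗ g k ⊗ rest g ⊕ h i ⊗ h k ⊗ rest h           ≈⟨ +-cong (product-two g k≢i) (product-two h k≢i) ⟨
    product g ⊕ product h                                 ∎
    where
    rest : (Fin _ → Carrier) → Carrier
    rest f = product (updateAt (updateAt f i (const 1#)) k (const 1#))
    rest-cong : ∀ f g → (∀ {x} → x ≢ i → x ≢ k → f x ≡ g x) → rest f ≈ rest g
    rest-cong f g same = product-cong λ x → reflexive (at′ x)
      where
      at′ : ∀ x → updateAt (updateAt f i (const 1#)) k (const 1#) x ≡ updateAt (updateAt g i (const 1#)) k (const 1#) x
      at′ x with x ≟ k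
      ... | yes refl = trans (updateAt-updates x (updateAt f i (const 1#))) (sym (updateAt-updates x (updateAt g i (const 1#))))
      ... | no x≢k = trans (updateAt-minimal x k _ x≢k) (trans inner (sym (updateAt-minimal x k _ x≢k)))
        where
        inner : updateAt f i (const 1#) x ≡ updateAt g i (const 1#) x
        inner with x ≟ i
        ... | yes refl = trans (updateAt-updates x f) (sym (updateAt-updates x g))
        ... | no x≢i = trans (updateAt-minimal x i f x≢i) (trans (same x≢i x≢k) (sym (updateAt-minimal x i g x≢i)))

  value : Permutation′ n → Labelling n A → Carrier
  value τ (r , l) = product λ k → d (r (τ ⟨$⟩ʳ k)) (l k)

  -- Only the factors of the columns i and b change. After the exchange column i pairs the two row
  -- labels and column b the two column labels; the switch pairs rows and columns the other way
  -- round.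
  resolve : ∀ (τ : Permutation′ n) c s → Cr τ c → value τ s ≈ value τ (exchange c s) ⊕ value (switchAt τ c) s
  resolve τ (i , j) s@(r , l) cr = product-split _ _ _ {i} {b} (Fin.<⇒≢ i<b ∘ sym) same
    (begin
      d (r a) (l i) ⊗ d (r (τ ⟨$⟩ʳ b)) (l b)    ≡⟨ cong (λ y → d (r a) (l i) ⊗ d (r y) (l b)) (Perm.inverseʳ τ) ⟩
      d (r a) (l i) ⊗ d (r j) (l b)             ≈⟨ three-term (r a) (r j) (l i) (l b) ⟩
      d (r a) (r j) ⊗ d (l i) (l b) ⊕ d (r a) (l b) ⊗ d (r j) (l i)
        ≈⟨ +-congˡ (*-comm _ _) ⟩
      d (r a) (r j) ⊗ d (l i) (l b) ⊕ d (r j) (l i) ⊗ d (r a) (l b)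
        ≡⟨ cong₂ _⊕_
             (cong₂ _⊗_ (cong₂ d (sym (≔-minimal r (Fin.<⇒≢ a<j))) (sym (≔-updates l i)))
                         (cong₂ d (sym (trans (cong (r [ j ≔ l i ]) (Perm.inverseʳ τ)) (≔-updates r j)))
                                  (sym (≔-minimal l (Fin.<⇒≢ i<b ∘ sym)))))
             (cong₂ _⊗_ (cong (λ y → d (r y) (l i)) (sym col-i)) (cong (λ y → d (r y) (l b)) (sym col-b))) ⟩
      d (r′ a) (l′ i) ⊗ d (r′ (τ ⟨$⟩ʳ b)) (l′ b) ⊕ d (r (τ′ ⟨$⟩ʳ i)) (l i) ⊗ d (r (τ′ ⟨$⟩ʳ b)) (l b) ∎)
    where
    τ′ = switchAt τ (i , j)
    open Switch {σ = τ} {τ′} (switchAt-IsSwitch τ (i , j)) cr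
    r′ = r [ j ≔ l i ]
    l′ = l [ i ≔ r j ]
    same : ∀ {x} → x ≢ i → x ≢ b →
           d (r (τ ⟨$⟩ʳ x)) (l x) ≡ d (r′ (τ ⟨$⟩ʳ x)) (l′ x) × d (r (τ ⟨$⟩ʳ x)) (l x) ≡ d (r (τ′ ⟨$⟩ʳ x)) (l x)
    same x≢i x≢b =
        cong₂ d (sym (≔-minimal r (λ eq → x≢b (sym (⟨$⟩ˡ-unique τ eq))))) (sym (≔-minimal l x≢i))
      , cong (λ y → d (r y) (l _)) (sym (col-other x≢i x≢b))

  module _ {n} {I : Pred (Cell n) 0ℓ} (I? : Decidable I) where

    open Leaves I?

    Elbow? : (σ : Permutation′ n) → Decidable (λ c → Cr σ c × I c)
    Elbow? σ c = Cr? σ c ×-dec I? c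

    -- The choices on the way to a leaf can be recovered from the leaf: by `persist`, an exchange
    -- was made at c iff c lies in `Cr σ` and in I. Hence the final labels are those of one run
    -- governed by σ.
    expand : ∀ {P cs} → Queue P cs → UpClosed P → ∀ τ s →
             value τ s ≈ total (λ σ → value σ (run (Elbow? σ) cs s)) (leaves cs τ)
    expand (done _) up τ s = ≈-sym (+-identityʳ _)
    expand (next {P′} {c} {cs} _ P′⇔ above q) up τ s with Cr? τ c ×-dec I? c
    ... | no ¬x = ≈-trans (expand q up′ τ s) (total-cong (All.map (λ {σ} → skip {σ}) (persist q up′ P′c τ)))
      where
      up′ = UpClosed-next P′⇔ above up
      P′c = Equivalence.from P′⇔ (inj₂ refl)
      skip : ∀ {σ} → Persists τ c σ → value σ (run (Elbow? σ) cs s) ≈ value σ (run (Elbow? σ) (c ∷ cs) s)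
      skip {σ} (p , _) rewrite dec-false (Elbow? σ c) (λ (cr , Ic) → ¬x (Equivalence.from p cr , Ic)) = ≈-refl
    ... | yes (cr , Ic) = begin
      value τ s
        ≈⟨ resolve τ c s cr ⟩
      value τ (exchange c s) ⊕ value τ′ s
        ≈⟨ +-cong (expand q up′ τ (exchange c s)) (expand q up′ τ′ s) ⟩
      total (λ σ → value σ (run (Elbow? σ) cs (exchange c s))) (leaves cs τ)
        ⊕ total (λ σ → value σ (run (Elbow? σ) cs s)) (leaves cs τ′)
        ≈⟨ +-cong (total-cong (All.map (λ {σ} → elbow {σ}) (persist q up′ P′c τ)))
                  (total-cong (All.map (λ {σ} → cross {σ}) (persist q up′ P′c τ′))) ⟩
      total f (leaves cs τ) ⊕ total f (leaves cs τ′)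
        ≈⟨ total-++ f (leaves cs τ) (leaves cs τ′) ⟨
      total f (leaves cs τ ++ leaves cs τ′) ∎
      where
      τ′ = switchAt τ c
      f : Permutation′ n → Carrier
      f σ = value σ (run (Elbow? σ) (c ∷ cs) s)
      up′ = UpClosed-next P′⇔ above up
      P′c = Equivalence.from P′⇔ (inj₂ refl)
      elbow : ∀ {σ} → Persists τ c σ → value σ (run (Elbow? σ) cs (exchange c s)) ≈ f σ
      elbow {σ} (p , _) rewrite dec-true (Elbow? σ c) (Equivalence.to p cr , Ic) = ≈-refl
      uncrossed : ¬ Cr τ′ c
      uncrossed (lt , _) = ℕ.<-irrefl (cong toℕ (proj₁ (switchAt-IsSwitch τ c))) lt
      cross : ∀ {σ} → Persists τ′ c σ → value σ (run (Elbow? σ) cs s) ≈ f σ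
      cross {σ} (p , _) rewrite dec-false (Elbow? σ c) (λ (cr′ , _) → uncrossed (Equivalence.from p cr′)) = ≈-refl

-- Labelling only the region below the path of M gives the same strands

module Region {n} (M : Matching n) (T : Tableau n) (standard : Standard T)
              (joins : partner (columnMatching T) ≗ partner M) where

  open StandardPath M T standard joins

  I : Pred (Cell n) 0ℓ
  I (i , j) = opener j < closer i

  I? : Decidable I
  I? (i , j) = opener j <? closer i

  I-downClosed : Leaves.DownClosed I?
  I-downClosed {i , j} {x , y} lt (i≤x , y≤j) = ℕ.≤-<-trans (row-mono 0F y≤j) (ℕ.<-≤-trans lt (row-mono 1F i≤x))
    where
    row-mono : ∀ r {k l} → k ≤ᶠ l → entry T r k ≤ᶠ entry T r l
    row-mono r {k} {l} k≤l with ℕ.m≤n⇒m<n∨m≡n k≤l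
    ... | inj₁ k<l = ℕ.<⇒≤ (proj₁ standard r k<l)
    ... | inj₂ k≡l = Fin.≤-reflexive (cong (entry T r) (Fin.toℕ-injective k≡l))

  module Compare (σ : Permutation′ n) (inside : ∀ i → I (mark σ i)) where

    elbow? : Decidable (λ c → Cr σ c × I c)
    elbow? c = Cr? σ c ×-dec I? c

    module F = Grid σ
    module D = Labels elbow? opener closer

    e h : Fin n → ℕ
    e j = proj₁ (opener-position j)
    h i = proj₁ (closer-position i)

    -- Otherwise the cell would lie weakly below and to the right of the mark of its column or of
    -- its row, hence in the down-closed region.
    outside-crosses : ∀ {i j} → ¬ I (i , j) → Cr σ (i , j)
    outside-crosses {i} {j} ¬I =
        ℕ.≰⇒> (λ j≤a → ¬I (I-downClosed {mark σ i} {i , j} (inside i) (ℕ.≤-refl , j≤a)))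
      , ℕ.≰⇒> (λ b≤i → ¬I (I-downClosed {b , j} {i , j} (subst (λ y → I (b , y)) (Perm.inverseʳ σ) (inside b)) (b≤i , ℕ.≤-refl)))
      where b = σ ⟨$⟩ˡ j

    I⇔h : ∀ {i j} → I (i , j) ⇔ (toℕ j ℕ.< h i)
    I⇔h {i} {j} = proj₁ (proj₂ (closer-position i)) j

    ¬I⇒e : ∀ {i j} → ¬ I (i , j) → toℕ i ℕ.< e j
    ¬I⇒e {i} {j} ¬I = Equivalence.to (proj₁ (proj₂ (opener-position j)) i)
      (ℕ.≤∧≢⇒< (ℕ.≮⇒≥ ¬I) (opener≢closer j i ∘ sym ∘ Fin.toℕ-injective))

    e⇒¬I : ∀ {i j} → toℕ i ℕ.< e j → ¬ I (i , j)
    e⇒¬I {i} {j} i<e = ℕ.<-asym (Equivalence.from (proj₁ (proj₂ (opener-position j)) i) i<e)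

    -- Above the path every cell is an elbow of the full grid, whose labels there are x + j on
    -- vertical and i + y on horizontal edges. On the path these sums are the positions of the
    -- openers and closers, the labels with which the region starts.
    RowAgrees : Fin (ℕ.suc n) → Fin n → Set
    RowAgrees x j = (toℕ x ℕ.≤ e j → toℕ (F.V x j) ≡ toℕ x + toℕ j × D.V x j ≡ opener j)
                  × (e j ℕ.≤ toℕ x → D.V x j ≡ F.V x j)

    ColumnAgrees : Fin n → Fin (ℕ.suc n) → Set
    ColumnAgrees i y = (h i ℕ.≤ toℕ y → toℕ (F.H i y) ≡ toℕ i + toℕ y × D.H i y ≡ closer i)
                     × (toℕ y ℕ.≤ h i → D.H i y ≡ F.H i y)

    column-agrees : ∀ i → (∀ j → RowAgrees (inject₁ i) j) → ∀ y → ColumnAgrees i y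
    column-agrees i rows = >-weakInduction _ last step′
      where
      last : ColumnAgrees i (fromℕ n)
      last = (λ _ → height , D.H-last i)
           , (λ n≤h → trans (D.H-last i) (Fin.toℕ-injective (trans
               (trans (proj₂ (proj₂ (closer-position i)))
                 (cong (toℕ i +_) (ℕ.≤-antisym (subst (h i ℕ.≤_) (sym (Fin.toℕ-fromℕ n)) (closer-height i)) n≤h)))
               (sym height))))
        where
        height : toℕ (F.H i (fromℕ n)) ≡ toℕ i + toℕ (fromℕ n)
        height = trans (cong toℕ (F.H-last i)) (trans (toℕ-topLabel i)
          (trans (ℕ.+-comm n (toℕ i)) (cong (toℕ i +_) (sym (Fin.toℕ-fromℕ n)))))
      step′ : ∀ j → ColumnAgrees i (suc j) → ColumnAgrees i (inject₁ j)
      step′ j (above , below′) rewrite Fin.toℕ-inject₁ j with I? (i , j)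
      ... | no ¬I = (λ _ → far) , (λ j≤h → trans (proj₂ far)
              (Fin.toℕ-injective (trans (proj₂ (proj₂ (closer-position i)))
                (trans (cong (toℕ i +_) (ℕ.≤-antisym h≤j j≤h)) (sym (proj₁ far))))))
        where
        h≤j : h i ℕ.≤ toℕ j
        h≤j = ℕ.≮⇒≥ (¬I ∘ Equivalence.from I⇔h)
        i≤e : toℕ (inject₁ i) ℕ.≤ e j
        i≤e = subst (ℕ._≤ e j) (sym (Fin.toℕ-inject₁ i)) (ℕ.<⇒≤ (¬I⇒e ¬I))
        far : toℕ (F.H i (inject₁ j)) ≡ toℕ i + toℕ j × D.H i (inject₁ j) ≡ closer i
        far = trans (cong toℕ (F.H-elbow (outside-crosses ¬I)))
                (trans (proj₁ (proj₁ (rows j) i≤e)) (cong (_+ toℕ j) (Fin.toℕ-inject₁ i)))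
            , trans (D.H-straight (¬I ∘ proj₂)) (proj₂ (above (ℕ.m≤n⇒m≤1+n h≤j)))
      ... | yes Ic = (λ h≤j → ⊥-elim (ℕ.<⇒≱ (Equivalence.to I⇔h Ic) h≤j)) , (λ _ → near)
        where
        e≤i : e j ℕ.≤ toℕ (inject₁ i)
        e≤i = subst (e j ℕ.≤_) (sym (Fin.toℕ-inject₁ i)) (ℕ.≮⇒≥ λ i<e → e⇒¬I i<e Ic)
        near : D.H i (inject₁ j) ≡ F.H i (inject₁ j)
        near with Cr? σ (i , j)
        ... | yes cr = trans (D.H-elbow (cr , Ic)) (trans (proj₂ (rows j) e≤i) (sym (F.H-elbow cr)))
        ... | no ¬cr = trans (D.H-straight (¬cr ∘ proj₁))
              (trans (below′ (Equivalence.to I⇔h Ic)) (sym (F.H-straight ¬cr)))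

    row-agrees : ∀ x j → RowAgrees x j
    row-agrees = <-weakInduction _
      (λ j → (λ _ → toℕ-leftLabel j , refl) , λ e≤0 → Fin.toℕ-injective
        (trans (proj₂ (proj₂ (opener-position j))) (trans (cong (_+ toℕ j) (ℕ.n≤0⇒n≡0 e≤0)) (sym (toℕ-leftLabel j)))))
      step′
      where
      step′ : ∀ i → (∀ j → RowAgrees (inject₁ i) j) → ∀ j → RowAgrees (suc i) j
      step′ i rows j with column-agrees i rows (suc j) | I? (i , j)
      ... | above , _ | no ¬I = (λ _ → far) , λ e≤ → trans (proj₂ far) (Fin.toℕ-injective
              (trans (proj₂ (proj₂ (opener-position j)))
                (trans (cong (_+ toℕ j) (ℕ.≤-antisym e≤ (¬I⇒e ¬I))) (sym (proj₁ far)))))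
        where
        i≤e : toℕ (inject₁ i) ℕ.≤ e j
        i≤e = subst (ℕ._≤ e j) (sym (Fin.toℕ-inject₁ i)) (ℕ.<⇒≤ (¬I⇒e ¬I))
        far : toℕ (F.V (suc i) j) ≡ ℕ.suc (toℕ i) + toℕ j × D.V (suc i) j ≡ opener j
        far = trans (cong toℕ (F.V-elbow (outside-crosses ¬I)))
                (trans (proj₁ (above (ℕ.m≤n⇒m≤1+n (ℕ.≮⇒≥ (¬I ∘ Equivalence.from I⇔h))))) (ℕ.+-suc (toℕ i) (toℕ j)))
            , trans (D.V-straight (¬I ∘ proj₂)) (proj₂ (proj₁ (rows j) i≤e))
      ... | _ , below′ | yes Ic = (λ i<e → ⊥-elim (e⇒¬I i<e Ic)) , λ _ → near
        where
        e≤i : e j ℕ.≤ toℕ (inject₁ i)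
        e≤i = subst (e j ℕ.≤_) (sym (Fin.toℕ-inject₁ i)) (ℕ.≮⇒≥ λ i<e → e⇒¬I i<e Ic)
        near : D.V (suc i) j ≡ F.V (suc i) j
        near with Cr? σ (i , j)
        ... | yes cr = trans (D.V-elbow (cr , Ic)) (trans (below′ (Equivalence.to I⇔h Ic)) (sym (F.V-elbow cr)))
        ... | no ¬cr = trans (D.V-straight (¬cr ∘ proj₁)) (trans (proj₂ (rows j) e≤i) (sym (F.V-straight ¬cr)))

    starts-agree : ∀ i → proj₁ (run elbow? (cells n) (opener , closer)) (σ ⟨$⟩ʳ i) ≡ F.startLabel i
    starts-agree i = trans (proj₁ (Run.run-cells elbow? opener closer) _)
      (trans (proj₂ (row-agrees (fromℕ n) (σ ⟨$⟩ʳ i)) (subst (e (σ ⟨$⟩ʳ i) ℕ.≤_) (sym (Fin.toℕ-fromℕ n)) (e≤n _)))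
        (F.V-end i))
      where
      e≤n : ∀ j → e j ℕ.≤ n
      e≤n j = opener-width j

    ends-agree : ∀ i → proj₂ (run elbow? (cells n) (opener , closer)) i ≡ F.endLabel i
    ends-agree i = trans (proj₂ (Run.run-cells elbow? opener closer) i)
      (trans (proj₂ (column-agrees i (row-agrees (inject₁ i)) zero) ℕ.z≤n) (F.H-end i))

-- The three-term relation for minors of a matrix with two rows

module Determinant {c ℓ} (R : CommutativeRing c ℓ) {A : Set} (a b : A → CommutativeRing.Carrier R) where

  open CommutativeRing R
    renaming (_+_ to infixl 6 _⊕_; _*_ to infixl 7 _⊗_; -_ to infix 8 ⊝_; refl to ≈-refl; sym to ≈-sym; trans to ≈-trans)
  open RingProperties ring using (+-cancelʳ)
  open import Relation.Binary.Reasoning.Setoid setoid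
  open SemiringSolver commutativeSemiring using (solve; _:=_; _:+_; _:*_)

  det₂ : A → A → Carrier
  det₂ i j = a i ⊗ b j ⊕ ⊝ (a j ⊗ b i)

  product-of-differences : ∀ p q r s → (p ⊕ ⊝ q) ⊗ (r ⊕ ⊝ s) ⊕ (p ⊗ s ⊕ q ⊗ r) ≈ p ⊗ r ⊕ q ⊗ s
  product-of-differences p q r s = begin
    u ⊗ v ⊕ (p ⊗ s ⊕ q ⊗ r)               ≈⟨ +-congˡ (+-cong (*-congʳ (restore p q)) (*-congˡ (restore r s))) ⟨
    u ⊗ v ⊕ ((u ⊕ q) ⊗ s ⊕ q ⊗ (v ⊕ s))
      ≈⟨ solve 4 (λ u q v s → u :* v :+ ((u :+ q) :* s :+ q :* (v :+ s)) := (u :+ q) :* (v :+ s) :+ q :* s) ≈-refl u q v s ⟩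
    (u ⊕ q) ⊗ (v ⊕ s) ⊕ q ⊗ s             ≈⟨ +-congʳ (*-cong (restore p q) (restore r s)) ⟩
    p ⊗ r ⊕ q ⊗ s                         ∎
    where
    u = p ⊕ ⊝ q
    v = r ⊕ ⊝ s
    restore : ∀ p q → p ⊕ ⊝ q ⊕ q ≈ p
    restore p q = ≈-trans (+-assoc _ _ _) (≈-trans (+-congˡ (-‿inverseˡ q)) (+-identityʳ p))

  -- The subtractions are moved to the other side, which leaves a semiring identity.
  three-term : ThreeTerm R det₂
  three-term w x y z = +-cancelʳ (n₁ ⊕ (n₂ ⊕ n₃)) _ _ (begin
    det₂ w y ⊗ det₂ x z ⊕ (n₁ ⊕ (n₂ ⊕ n₃))     ≈⟨ +-assoc _ _ _ ⟨
    det₂ w y ⊗ det₂ x z ⊕ n₁ ⊕ (n₂ ⊕ n₃)       ≈⟨ +-congʳ (product-of-differences _ _ _ _) ⟩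
    p₁ ⊕ (n₂ ⊕ n₃)
      ≈⟨ solve 8 (λ aw ax ay az bw bx by bz →
           aw :* by :* (ax :* bz) :+ ay :* bw :* (az :* bx)
             :+ ((aw :* bx :* (az :* by) :+ ax :* bw :* (ay :* bz)) :+ (aw :* bz :* (ay :* bx) :+ az :* bw :* (ax :* by)))
           := ((aw :* bx :* (ay :* bz) :+ ax :* bw :* (az :* by)) :+ (aw :* bz :* (ax :* by) :+ az :* bw :* (ay :* bx)))
             :+ (aw :* by :* (az :* bx) :+ ay :* bw :* (ax :* bz)))
         ≈-refl (a w) (a x) (a y) (a z) (b w) (b x) (b y) (b z) ⟩
    p₂ ⊕ p₃ ⊕ n₁                               ≈⟨ +-congʳ (+-cong (product-of-differences _ _ _ _) (product-of-differences _ _ _ _)) ⟨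
    d₂ ⊕ n₂ ⊕ (d₃ ⊕ n₃) ⊕ n₁
      ≈⟨ solve 5 (λ d₂ d₃ n₁ n₂ n₃ → (d₂ :+ n₂) :+ (d₃ :+ n₃) :+ n₁ :=
           (d₂ :+ d₃) :+ (n₁ :+ (n₂ :+ n₃))) ≈-refl d₂ d₃ n₁ n₂ n₃ ⟩
    d₂ ⊕ d₃ ⊕ (n₁ ⊕ (n₂ ⊕ n₃))                 ∎)
    where
    positive negative : A → A → A → A → Carrier
    positive i j k l = a i ⊗ b j ⊗ (a k ⊗ b l) ⊕ a j ⊗ b i ⊗ (a l ⊗ b k)
    negative i j k l = a i ⊗ b j ⊗ (a l ⊗ b k) ⊕ a j ⊗ b i ⊗ (a k ⊗ b l)
    p₁ = positive w y x z
    n₁ = negative w y x z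
    p₂ = positive w x y z
    n₂ = negative w x y z
    p₃ = positive w z x y
    n₃ = negative w z x y
    d₂ = det₂ w x ⊗ det₂ y z
    d₃ = det₂ w z ⊗ det₂ x y

-- Splitting sums and products along the rows of a tableau

module Sums {c ℓ} (M : CommutativeMonoid c ℓ) where

  open CommutativeMonoid M renaming (refl to ≈-refl; sym to ≈-sym; trans to ≈-trans)
  open Sum M using (sum; sum-permute; sum-cong-≋; sum-replicate-zero)

  sum-zero : ∀ {m} {f : Fin m → Carrier} → (∀ i → f i ≈ ε) → sum f ≈ ε
  sum-zero {m} f≈ε = ≈-trans (sum-cong-≋ f≈ε) (sum-replicate-zero m)

  sum-single : ∀ {m} (f : Fin m → Carrier) i → (∀ k → k ≢ i → f k ≈ ε) → sum f ≈ f i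
  sum-single f zero    f≈ε = ≈-trans (∙-congˡ (sum-zero λ k → f≈ε (suc k) λ ())) (identityʳ _)
  sum-single f (suc i) f≈ε = ≈-trans (∙-congʳ (f≈ε zero λ ()))
    (≈-trans (identityˡ _) (sum-single (f ∘ suc) i λ k k≢i → f≈ε (suc k) (k≢i ∘ Fin.suc-injective)))

  sum-split : ∀ m {k} (f : Fin (m + k) → Carrier) → sum f ≈ sum (λ i → f (i ↑ˡ k)) ∙ sum (λ i → f (m ↑ʳ i))
  sum-split ℕ.zero    f = ≈-sym (identityˡ _)
  sum-split (ℕ.suc m) f = ≈-trans (∙-congˡ (sum-split m (f ∘ suc))) (≈-sym (assoc _ _ _))

  sum-tableau : (T : Tableau n) (f : Fin (2 * n) → Carrier) →
                sum f ≈ sum (λ k → f (entry T 0F k)) ∙ sum (λ k → f (entry T 1F k))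
  sum-tableau {n} T f = ≈-trans (sum-permute f (T ↔-∘ *↔×)) (≈-trans (sum-split n _)
    (∙-cong (sum-cong-≋ (λ k → reflexive (cong (f ∘ Inverse.to T) (Fin.remQuot-combine {2} {n} 0F k))))
      (≈-trans (sum-split n _) (≈-trans (identityʳ _)
        (sum-cong-≋ (λ k → reflexive (cong (f ∘ Inverse.to T) (Fin.remQuot-combine {2} {n} 1F k))))))))

module WebAlgebra {c ℓ} (R : CommutativeRing c ℓ) (n : ℕ) where

  open Webs R n
  open Sum (CommutativeRing.*-commutativeMonoid polyRing) renaming (sum to product; sum-cong-≋ to product-cong) using ()

  Δ-cong : ∀ M M′ → partner M ≗ partner M′ → Δ M ≃ Δ M′
  Δ-cong M M′ eq = product-cong λ i → CommutativeRing.reflexive polyRing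
    (cong (λ k → if does (i <? k) then det i k else con (CommutativeRing.1# R)) (eq i))

  -- The product `Δ` has a factor at each of the 2n points, which is 1 at the closers; the rows of
  -- the tableau sort the points into openers and closers.
  Δ-tableau : (M : Matching n) (T : Tableau n) → partner (columnMatching T) ≗ partner M →
              (∀ k → entry T 0F k < entry T 1F k) → Δ M ≃ product λ k → det (entry T 0F k) (entry T 1F k)
  Δ-tableau M T joins ordered = ≃-trans (Sums.sum-tableau (CommutativeRing.*-commutativeMonoid polyRing) T _)
    (≃-trans (⊗-cong (product-cong openers) (Sums.sum-zero (CommutativeRing.*-commutativeMonoid polyRing) closers))
      (CommutativeRing.*-identityʳ polyRing _))
    where
    factor : Fin (2 * n) → Poly
    factor i = if does (i <? partner M i) then det i (partner M i) else con (CommutativeRing.1# R)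
    openers : ∀ k → factor (entry T 0F k) ≃ det (entry T 0F k) (entry T 1F k)
    openers k rewrite partner-entry M T joins 0F k | dec-true (entry T 0F k <? entry T 1F k) (ordered k) = ≃-refl
    closers : ∀ k → factor (entry T 1F k) ≃ con (CommutativeRing.1# R)
    closers k rewrite partner-entry M T joins 1F k
      | dec-false (entry T 1F k <? entry T 0F k) (ℕ.<-asym (ordered k)) = ≃-refl

-- Opener sets

isOpener : Matching n → Fin (2 * n) → Bool
isOpener M i = does (i <? partner M i)

isOpener-partner : (M : Matching n) → ∀ i → isOpener M (partner M i) ≡ not (isOpener M i)
isOpener-partner M i rewrite involutive M i with Fin.<-cmp i (partner M i)
... | tri< lt _ gt = trans (dec-false (partner M i <? i) gt) (cong not (sym (dec-true (i <? partner M i) lt)))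
... | tri≈ _ eq _ = contradiction (sym eq) (no-fixpoint M i)
... | tri> lt _ gt = trans (dec-true (partner M i <? i) gt) (cong not (sym (dec-false (i <? partner M i) lt)))

isOpener⇒< : (M : Matching n) → ∀ {i} → isOpener M i ≡ true → i < partner M i
isOpener⇒< M {i} eq with i <? partner M i
... | yes lt = lt
... | no ≮   = contradiction (trans (sym eq) (dec-false (i <? partner M i) ≮)) λ ()

<⇒isOpener : (M : Matching n) → ∀ {i} → i < partner M i → isOpener M i ≡ true
<⇒isOpener M {i} = dec-true (i <? partner M i)

partner-injective : (M : Matching n) → ∀ {i j} → partner M i ≡ partner M j → i ≡ j
partner-injective M eq = trans (sym (involutive M _)) (trans (cong (partner M) eq) (involutive M _))

-- If the arc of M at i ends first, then its end is joined by M′ to an opener s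
-- strictly inside, and the two arcs at s differ as well.
shorter-disagreement : (M M′ : Matching n) → Noncrossing M → Noncrossing M′ → isOpener M ≗ isOpener M′ →
  ∀ {i} → i < partner M i → partner M i < partner M′ i →
  ∃[ s ] i < s × s < partner M s × partner M s < partner M′ s × partner M′ s ≡ partner M i
shorter-disagreement M M′ nc nc′ same {i} i<c c<d = s , i<s , s<ps , subst (p s <_) (sym qs≡c) ps<c , qs≡c
  where
  p = partner M
  q = partner M′
  c = p i
  s = q c
  qs≡c : q s ≡ c
  qs≡c = involutive M′ c
  closer-c : isOpener M c ≡ false
  closer-c = trans (isOpener-partner M i) (cong not (<⇒isOpener M i<c))
  opener-s : isOpener M s ≡ true
  opener-s = trans (same s) (trans (isOpener-partner M′ c) (cong not (trans (sym (same c)) closer-c)))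
  s<c : s < c
  s<c = subst (s <_) qs≡c (isOpener⇒< M′ (trans (sym (same s)) opener-s))
  s<ps : s < p s
  s<ps = isOpener⇒< M opener-s
  i<s : i < s
  i<s with Fin.<-cmp i s
  ... | tri< i<s _ _ = i<s
  ... | tri≈ _ i≡s _ = ⊥-elim (Fin.<⇒≢ c<d (trans (sym qs≡c) (cong q (sym i≡s))))
  ... | tri> _ _ s<i = ⊥-elim (nc′ s i c (q i) s<i i<c c<d qs≡c refl)
  ps<c : p s < c
  ps<c with Fin.<-cmp (p s) c
  ... | tri< ps<c _ _ = ps<c
  ... | tri≈ _ ps≡c _ = ⊥-elim (Fin.<⇒≢ i<s (partner-injective M (sym ps≡c)))
  ... | tri> _ _ c<ps = ⊥-elim (nc i s c (p s) i<s s<c c<ps refl refl)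

-- Descent on l, a bound for the length of the arc of M′ at i: `shorter-disagreement` leads to an
-- opener s after i whose arc in M′ ends at the earlier point `partner M i`.
never-shorter : ∀ l (M M′ : Matching n) → Noncrossing M → Noncrossing M′ → isOpener M ≗ isOpener M′ →
                ∀ i → i < partner M i → toℕ (partner M′ i) ℕ.≤ l + toℕ i → ¬ (partner M i < partner M′ i)
never-shorter ℕ.zero    M M′ nc nc′ same i i<c d≤i c<d = ℕ.<⇒≱ (ℕ.<-trans i<c c<d) d≤i
never-shorter (ℕ.suc l) M M′ nc nc′ same i i<c d≤ c<d =
  let (s , i<s , s<ps , ps<qs , qs≡c) = shorter-disagreement M M′ nc nc′ same i<c c<d in
  never-shorter l M M′ nc nc′ same s s<ps
    (subst (λ x → toℕ x ℕ.≤ l + toℕ s) (sym qs≡c)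
      (ℕ.≤-trans (ℕ.s≤s⁻¹ (ℕ.<-≤-trans c<d d≤)) (ℕ.+-monoʳ-≤ l (ℕ.<⇒≤ i<s)))) ps<qs

openers-determined : (M M′ : Matching n) → Noncrossing M → Noncrossing M′ → isOpener M ≗ isOpener M′ →
                     ∀ i → isOpener M i ≡ true → partner M i ≡ partner M′ i
openers-determined M M′ nc nc′ same i opens with Fin.<-cmp (partner M i) (partner M′ i)
... | tri≈ _ eq _  = eq
... | tri< lt _ _  = ⊥-elim (never-shorter (toℕ (partner M′ i)) M M′ nc nc′ same i (isOpener⇒< M opens) (ℕ.m≤m+n _ _) lt)
... | tri> _ _ gt  = ⊥-elim (never-shorter (toℕ (partner M i)) M′ M nc′ nc (sym ∘ same) i
                       (isOpener⇒< M′ (trans (sym (same i)) opens)) (ℕ.m≤m+n _ _) gt)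

noncrossing-determined : (M M′ : Matching n) → Noncrossing M → Noncrossing M′ →
                         isOpener M ≗ isOpener M′ → partner M ≗ partner M′
noncrossing-determined M M′ nc nc′ same i with isOpener M i in eq
... | true  = openers-determined M M′ nc nc′ same i eq
... | false = sym (trans (cong (partner M′) (trans (sym (involutive M i)) agrees)) (involutive M′ _))
  where
  agrees : partner M (partner M i) ≡ partner M′ (partner M i)
  agrees = openers-determined M M′ nc nc′ same (partner M i) (trans (isOpener-partner M i) (cong not eq))

module ℕSum = Sum ℕ.+-0-commutativeMonoid

sum-mono-≤ : ∀ {m} {f g : Fin m → ℕ} → (∀ i → f i ℕ.≤ g i) → ℕSum.sum f ℕ.≤ ℕSum.sum g
sum-mono-≤ {ℕ.zero}  f≤g = ℕ.z≤n
sum-mono-≤ {ℕ.suc m} f≤g = ℕ.+-mono-≤ (f≤g zero) (sum-mono-≤ (f≤g ∘ suc))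

sum-mono-< : ∀ {m} {f g : Fin m → ℕ} → (∀ i → f i ℕ.≤ g i) → ∀ i → f i ℕ.< g i → ℕSum.sum f ℕ.< ℕSum.sum g
sum-mono-< f≤g zero    f<g = ℕ.+-mono-<-≤ f<g (sum-mono-≤ (f≤g ∘ suc))
sum-mono-< f≤g (suc i) f<g = ℕ.+-mono-≤-< (f≤g zero) (sum-mono-< (f≤g ∘ suc) i f<g)

weight : ∀ {m} → (Fin m → Bool) → ℕ
weight o = ℕSum.sum λ i → if o i then toℕ i else 0

-- The weights are compared arc by arc: the chosen end is never smaller than the opener.
module Transversal (M : Matching n) (o : Fin (2 * n) → Bool) (flips : ∀ i → o (partner M i) ≡ not (o i)) where

  private
    p = partner M

    chosen : (Fin (2 * n) → Bool) → Fin (2 * n) → ℕ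
    chosen o i = if o i then toℕ i else toℕ (p i)

  -- Each arc is visited from both ends and contributes its chosen end each time; counting twice
  -- avoids selecting one visit per arc.
  double-weight : ∀ o → (∀ i → o (p i) ≡ not (o i)) → weight o + weight o ≡ ℕSum.sum (chosen o)
  double-weight o flips = trans (cong (weight o +_) (ℕSum.sum-permute f (permutation p p (involutive M) (involutive M))))
    (trans (sym (ℕSum.∑-distrib-+ f (f ∘ p))) (ℕSum.sum-cong-≗ both))
    where
    f : Fin (2 * n) → ℕ
    f i = if o i then toℕ i else 0
    both : ∀ i → f i + f (p i) ≡ chosen o i
    both i rewrite flips i with o i
    ... | true  = ℕ.+-identityʳ _
    ... | false = refl

  opener-chosen : ∀ i → chosen (isOpener M) i ℕ.≤ chosen o i
  opener-chosen i with Fin.<-cmp i (p i)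
  ... | tri≈ _ eq _ = contradiction (sym eq) (no-fixpoint M i)
  ... | tri< lt _ _ rewrite <⇒isOpener M lt with o i
  ...   | true  = ℕ.≤-refl
  ...   | false = ℕ.<⇒≤ lt
  opener-chosen i | tri> ≮ _ gt rewrite dec-false (i <? p i) ≮ with o i
  ...   | true  = ℕ.<⇒≤ gt
  ...   | false = ℕ.≤-refl

  opener-chosen-strict : ∀ i → isOpener M i ≢ o i → chosen (isOpener M) i ≢ chosen o i
  opener-chosen-strict i differ eq with isOpener M i | o i
  ... | true  | true  = differ refl
  ... | false | false = differ refl
  ... | true  | false = no-fixpoint M i (sym (Fin.toℕ-injective eq))
  ... | false | true  = no-fixpoint M i (Fin.toℕ-injective eq)

  weight-< : weight (isOpener M) ℕ.< weight o ⊎ isOpener M ≗ o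
  weight-< with all? (λ i → isOpener M i Bool.≟ o i)
  ... | yes same = inj₂ same
  ... | no ¬same = let (i , differ) = Fin.¬∀⟶∃¬ _ _ (λ i → isOpener M i Bool.≟ o i) ¬same in
    inj₁ (ℕ.≰⇒> λ w≤ → ℕ.<⇒≱
      (sum-mono-< opener-chosen i (ℕ.≤∧≢⇒< (opener-chosen i) (opener-chosen-strict i differ)))
      (subst₂ ℕ._≤_ (double-weight o flips) (double-weight (isOpener M) (isOpener-partner M)) (ℕ.+-mono-≤ w≤ w≤)))

-- Linear independence of the products over noncrossing matchings

module Independence {c ℓ} (R : CommutativeRing c ℓ) (n : ℕ) where

  open CommutativeRing R using (Carrier; _≈_; 0#; 1#) renaming (_+_ to infixl 6 _+ᴿ_; _*_ to infixl 7 _*ᴿ_; -_ to infix 8 -ᴿ_)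
  private
    module R = CommutativeRing R
    module P = CommutativeRing (Webs.polyRing R n)
  open Webs R n
  open Sum P.+-commutativeMonoid using () renaming (sum to sumᴾ)
  open Sum P.*-commutativeMonoid using () renaming (sum to productᴾ)
  open Sum R.+-commutativeMonoid using (sum; sum-cong-≋)
  open Sum R.*-commutativeMonoid using () renaming (sum to product)

  module _ (z : Fin 2 × Fin (2 * n) → Carrier) where

    evaluate : Poly → Carrier
    evaluate (con a) = a
    evaluate (var x) = z x
    evaluate (p ⊕ q) = evaluate p +ᴿ evaluate q
    evaluate (p ⊗ q) = evaluate p *ᴿ evaluate q
    evaluate (⊝ p)   = -ᴿ evaluate p

    evaluate-cong : ∀ {p q} → p ≃ q → evaluate p ≈ evaluate q
    evaluate-cong ≃-refl             = R.refl
    evaluate-cong (≃-sym e)          = R.sym (evaluate-cong e)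
    evaluate-cong (≃-trans d e)      = R.trans (evaluate-cong d) (evaluate-cong e)
    evaluate-cong (⊕-cong d e)       = R.+-cong (evaluate-cong d) (evaluate-cong e)
    evaluate-cong (⊗-cong d e)       = R.*-cong (evaluate-cong d) (evaluate-cong e)
    evaluate-cong (⊝-cong e)         = R.-‿cong (evaluate-cong e)
    evaluate-cong (⊕-assoc _ _ _)    = R.+-assoc _ _ _
    evaluate-cong (⊕-comm _ _)       = R.+-comm _ _
    evaluate-cong (⊕-identityˡ _)    = R.+-identityˡ _
    evaluate-cong (⊝-inverseˡ _)     = R.-‿inverseˡ _
    evaluate-cong (⊗-assoc _ _ _)    = R.*-assoc _ _ _
    evaluate-cong (⊗-comm _ _)       = R.*-comm _ _
    evaluate-cong (⊗-identityˡ _)    = R.*-identityˡ _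
    evaluate-cong (⊗-distribˡ _ _ _) = R.distribˡ _ _ _
    evaluate-cong (con-cong e)       = e
    evaluate-cong (con-⊕ a b)        = R.refl
    evaluate-cong (con-⊗ a b)        = R.refl

    evaluate-sum : ∀ {m} (f : Fin m → Poly) → evaluate (sumᴾ f) ≡ sum (evaluate ∘ f)
    evaluate-sum {ℕ.zero}  f = refl
    evaluate-sum {ℕ.suc m} f = cong (evaluate (f zero) +ᴿ_) (evaluate-sum (f ∘ suc))

    evaluate-product : ∀ {m} (f : Fin m → Poly) → evaluate (productᴾ f) ≡ product (evaluate ∘ f)
    evaluate-product {ℕ.zero}  f = refl
    evaluate-product {ℕ.suc m} f = cong (evaluate (f zero) *ᴿ_) (evaluate-product (f ∘ suc))

  product-zero : ∀ {m} (f : Fin m → Carrier) i → f i ≈ 0# → product f ≈ 0#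
  product-zero f zero    f≈0 = R.trans (R.*-congʳ f≈0) (R.zeroˡ _)
  product-zero f (suc i) f≈0 = R.trans (R.*-congˡ (product-zero (f ∘ suc) i f≈0)) (R.zeroʳ _)

  bit : Bool → Carrier
  bit b = if b then 1# else 0#

  -- Evaluation at point o reads off the coefficient of the monomial with z₁ᵢ for
  -- i ∈ o and z₂ᵢ for i ∉ o.
  point : (Fin (2 * n) → Bool) → Fin 2 × Fin (2 * n) → Carrier
  point o (0F , i) = bit (o i)
  point o (1F , i) = bit (not (o i))

  coefficient : (Fin (2 * n) → Bool) → Matching n → Carrier
  coefficient o M = evaluate (point o) (Δ M)

  private
    factor : (Fin (2 * n) → Bool) → Matching n → Fin (2 * n) → Poly
    factor o M i = if does (i <? partner M i) then det i (partner M i) else con 1#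

  det-point : ∀ o {i j} → o i ≡ true → o j ≡ false → evaluate (point o) (det i j) ≈ 1#
  det-point o oi oj rewrite oi | oj = R.trans (R.+-cong (R.*-identityˡ 1#) (R.-‿cong (R.zeroˡ _)))
    (R.trans (R.+-congˡ (RingProperties.-0#≈0# R.ring)) (R.+-identityʳ 1#))

  coefficient-openers : ∀ M → coefficient (isOpener M) M ≈ 1#
  coefficient-openers M = R.trans (R.reflexive (evaluate-product (point o) (factor o M)))
    (Sums.sum-zero R.*-commutativeMonoid factor≈1)
    where
    o = isOpener M
    factor≈1 : ∀ i → evaluate (point o) (factor o M i) ≈ 1#
    factor≈1 i = split (i <? partner M i)
      where
      split : Dec (i < partner M i) → evaluate (point o) (factor o M i) ≈ 1#
      split (no ≮) rewrite dec-false (i <? partner M i) ≮ = R.refl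
      split (yes lt) rewrite dec-true (i <? partner M i) lt =
        det-point o (<⇒isOpener M lt) (trans (isOpener-partner M i) (cong not (<⇒isOpener M lt)))

  -- The columns of i and its partner coincide in the evaluated matrix, so their minor is zero.
  coefficient-vanishes-at : ∀ o M i → i < partner M i → o (partner M i) ≡ o i → coefficient o M ≈ 0#
  coefficient-vanishes-at o M i lt same = R.trans (R.reflexive (evaluate-product (point o) (factor o M)))
    (product-zero _ i factor≈0)
    where
    factor≈0 : evaluate (point o) (factor o M i) ≈ 0#
    factor≈0 rewrite dec-true (i <? partner M i) lt | same = R.-‿inverseʳ _

  coefficient-vanishes : ∀ o M i → o (partner M i) ≡ o i → coefficient o M ≈ 0#
  coefficient-vanishes o M i same with Fin.<-cmp i (partner M i)
  ... | tri≈ _ eq _ = contradiction (sym eq) (no-fixpoint M i)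
  ... | tri< lt _ _ = coefficient-vanishes-at o M i lt same
  ... | tri> _ _ gt = coefficient-vanishes-at o M (partner M i)
    (subst (partner M i <_) (sym (involutive M i)) gt) (trans (cong o (involutive M i)) (sym same))

  module _ {N} (m : Fin N → NC n) (distinct : ∀ k l → partner (proj₁ (m k)) ≗ partner (proj₁ (m l)) → k ≡ l)
           (b : Fin N → Carrier) (relation : sumᴾ (λ k → con (b k) ⊗ Δ (proj₁ (m k))) ≃ con 0#) where

    private
      M : Fin N → Matching n
      M = proj₁ ∘ m

      openers : Fin N → Fin (2 * n) → Bool
      openers = isOpener ∘ M

    -- If the openers of `M k` contain both ends or neither end of an arc of `M l`, the coefficient
    -- vanishes. Otherwise they pick one end of each arc of `M l`, and the openers of `M l` are the
    -- lightest such choice; equality would make the two noncrossing matchings equal.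
    coefficient-triangular : ∀ k l → l ≢ k → coefficient (openers k) (M l) ≈ 0# ⊎ weight (openers l) ℕ.< weight (openers k)
    coefficient-triangular k l l≢k with any? (λ i → openers k (partner (M l) i) Bool.≟ openers k i)
    ... | yes (i , same) = inj₁ (coefficient-vanishes (openers k) (M l) i same)
    ... | no ¬same with Transversal.weight-< (M l) (openers k) (λ i → Bool.¬-not (λ eq → ¬same (i , eq)))
    ...   | inj₁ lt = inj₂ lt
    ...   | inj₂ eq = contradiction (distinct l k (noncrossing-determined (M l) (M k) (proj₂ (m l)) (proj₂ (m k)) eq)) l≢k

    -- Evaluated at the openers of `M k`, the relation loses the lighter terms by induction and the
    -- other terms by triangularity, and the remaining coefficient is 1.
    independent : ∀ k → b k ≈ 0#
    independent k = <-rec (λ w → ∀ k → weight (openers k) ≡ w → b k ≈ 0#) step _ k refl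
      where
      step : ∀ w → (∀ {v} → v ℕ.< w → ∀ k → weight (openers k) ≡ v → b k ≈ 0#) →
             ∀ k → weight (openers k) ≡ w → b k ≈ 0#
      step _ ih k refl = begin
        b k                                        ≈⟨ R.*-identityʳ _ ⟨
        b k *ᴿ 1#                                  ≈⟨ R.*-congˡ (coefficient-openers (M k)) ⟨
        term k                                     ≈⟨ Sums.sum-single R.+-commutativeMonoid term k others ⟨
        sum term                                   ≡⟨ evaluate-sum z (λ k → con (b k) ⊗ Δ (M k)) ⟨
        evaluate z (sumᴾ λ k → con (b k) ⊗ Δ (M k)) ≈⟨ evaluate-cong z relation ⟩
        0#                                         ∎
        where
        open import Relation.Binary.Reasoning.Setoid R.setoid
        z = point (openers k)
        term : Fin N → Carrier
        term l = b l *ᴿ coefficient (openers k) (M l)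
        others : ∀ l → l ≢ k → term l ≈ 0#
        others l l≢k with coefficient-triangular k l l≢k
        ... | inj₁ vanishes = R.trans (R.*-congˡ vanishes) (R.zeroʳ _)
        ... | inj₂ lighter  = R.trans (R.*-congʳ (ih lighter l refl)) (R.zeroˡ _)

-- Enumerations

All-mapMaybe : {P : B → Set ℓ₁} {Q : A → Set ℓ₂} (f : A → Maybe B) →
               (∀ {x y} → Q x → f x ≡ just y → P y) → ∀ {xs} → All Q xs → All P (mapMaybe f xs)
All-mapMaybe f Q⇒P [] = []
All-mapMaybe f Q⇒P {x ∷ _} (q ∷ qs) with f x in eq
... | nothing = All-mapMaybe f Q⇒P qs
... | just y  = Q⇒P q eq ∷ All-mapMaybe f Q⇒P qs

AllPairs-mapMaybe : {R : A → A → Set ℓ₁} {S : B → B → Set ℓ₂} (f : A → Maybe B) →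
                    (∀ {x y a b} → R x y → f x ≡ just a → f y ≡ just b → S a b) →
                    ∀ {xs} → AllPairs R xs → AllPairs S (mapMaybe f xs)
AllPairs-mapMaybe f R⇒S [] = []
AllPairs-mapMaybe f R⇒S {x ∷ _} (r ∷ rs) with f x in eq
... | nothing = AllPairs-mapMaybe f R⇒S rs
... | just a  = All-mapMaybe f (λ Rxy → R⇒S Rxy eq) r ∷ AllPairs-mapMaybe f R⇒S rs

Any-mapMaybe : {P : A → Set ℓ₁} {Q : B → Set ℓ₂} (f : A → Maybe B) →
               (∀ {x} → P x → ∃[ y ] f x ≡ just y × Q y) → ∀ {xs} → Any P xs → Any Q (mapMaybe f xs)
Any-mapMaybe f P⇒Q {x ∷ _} (here p) with f x | P⇒Q p
... | _ | y , refl , q = here q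
Any-mapMaybe f P⇒Q {x ∷ _} (there ps) with f x
... | nothing = Any-mapMaybe f P⇒Q ps
... | just _  = there (Any-mapMaybe f P⇒Q ps)

lookup-unique : {R : A → A → Set ℓ₂} → (∀ {x y} → R x y → R y x) → ∀ {xs} → AllPairs (λ x y → ¬ R x y) xs →
                ∀ k l → R (lookup xs k) (lookup xs l) → k ≡ l
lookup-unique sym′ (_ ∷ _)  zero    zero    r = refl
lookup-unique sym′ (x ∷ _)  zero    (suc l) r = contradiction r (All.lookup x (∈-lookup l))
lookup-unique sym′ (x ∷ _)  (suc k) zero    r = contradiction (sym′ r) (All.lookup x (∈-lookup k))
lookup-unique sym′ (_ ∷ xs) (suc k) (suc l) r = cong suc (lookup-unique sym′ xs k l r)

list-cardinality : ∀ {a ℓ p} (S : Setoid a ℓ) (P : Pred (Setoid.Carrier S) p) xs → All P xs →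
                   AllPairs (λ x y → ¬ Setoid._≈_ S x y) xs → (∀ x → P x → Any (Setoid._≈_ S x) xs) →
                   HasCardinality (subsetoid S P) (length xs)
list-cardinality S P xs all unique complete = record
  { to = index
  ; from = λ k → lookup xs k , All.lookup all (∈-lookup k)
  ; to-cong = λ {x} {y} x≈y → same (Setoid.trans S (Setoid.sym S (found x)) (Setoid.trans S x≈y (found y)))
  ; from-cong = λ { refl → Setoid.refl S }
  ; inverse = (λ { {k} {x} x≈k → same (Setoid.trans S (Setoid.sym S (found x)) x≈k) })
            , (λ { {x} refl → Setoid.sym S (found x) })
  }
  where
  open Setoid S using (Carrier; _≈_)
  index : ∃[ x ] P x → Fin (length xs)
  index (x , p) = Any.index (complete x p)
  found : ∀ x → proj₁ x ≈ lookup xs (index x)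
  found (x , p) = Any.lookup-index (complete x p)
  same : ∀ {k l} → lookup xs k ≈ lookup xs l → k ≡ l
  same = lookup-unique (Setoid.sym S) unique _ _

_≗ᴹ_ : Matching n → Matching n → Set
M ≗ᴹ M′ = partner M ≗ partner M′

_≗ᴹ?_ : (M M′ : Matching n) → Dec (M ≗ᴹ M′)
M ≗ᴹ? M′ = all? λ i → partner M i ≟ partner M′ i

toMatching-partner : ∀ {f : Fin (2 * n) → Fin (2 * n)} {M} → toMatching {n} f ≡ just M → partner M ≡ f
toMatching-partner {f = f} eq with all? (λ i → f (f i) ≟ i) | all? (λ i → ¬? (f i ≟ i))
toMatching-partner refl | yes _ | yes _ = refl

-- Stated up to pointwise equality, since encoding and decoding a map by `funToFin` and `finToFun`
-- recovers it only pointwise.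
toMatching-complete : ∀ (M : Matching n) f → f ≗ partner M → ∃[ M′ ] toMatching f ≡ just M′ × M′ ≗ᴹ M
toMatching-complete M f f≗ with all? (λ i → f (f i) ≟ i) | all? (λ i → ¬? (f i ≟ i))
... | yes _ | yes _ = _ , refl , f≗
... | no ¬p | _ = contradiction (λ i → trans (cong f (f≗ i)) (trans (f≗ _) (involutive M i))) ¬p
... | yes _ | no ¬p = contradiction (λ i eq → no-fixpoint M i (trans (sym (f≗ i)) eq)) ¬p

noncrossing-maybe : Matching n → Maybe (NC n)
noncrossing-maybe M = Maybe.map (M ,_) (dec⇒maybe (noncrossing? M))

Noncrossing-resp : {M M′ : Matching n} → M ≗ᴹ M′ → Noncrossing M → Noncrossing M′
Noncrossing-resp eq nc a b c d a<b b<c c<d pa pb = nc a b c d a<b b<c c<d (trans (eq a) pa) (trans (eq b) pb)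

finToFun-injective : ∀ {m n} {k l : Fin (m ^ n)} → finToFun {m} {n} k ≗ finToFun l → k ≡ l
finToFun-injective {m} {n} {k} {l} eq = trans (sym (funToFin-finToFin {n} {m} k))
  (trans (funToFin-cong eq) (funToFin-finToFin {n} {m} l))
  where
  funToFin-cong : ∀ {m n} {f g : Fin m → Fin n} → f ≗ g → funToFin f ≡ funToFin g
  funToFin-cong {ℕ.zero}  f≗g = refl
  funToFin-cong {ℕ.suc m} f≗g = cong₂ combine (f≗g zero) (funToFin-cong (f≗g ∘ suc))

noncrossings-distinct : ∀ n → AllPairs (λ M M′ → ¬ (proj₁ M ≗ᴹ proj₁ M′)) (noncrossings n)
noncrossings-distinct n = AllPairs-mapMaybe noncrossing-maybe keep
  (AllPairs-mapMaybe toMatching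
    (λ f≢g eq eq′ M≗M′ → f≢g (subst₂ _≗_ (toMatching-partner eq) (toMatching-partner eq′) M≗M′)) maps)
  where
  keep : ∀ {M M′ : Matching n} {N N′ : NC n} → ¬ M ≗ᴹ M′ → noncrossing-maybe M ≡ just N → noncrossing-maybe M′ ≡ just N′ →
         ¬ (proj₁ N ≗ᴹ proj₁ N′)
  maps : AllPairs (λ f g → ¬ (f ≗ g)) (List.map (finToFun {2 * n} {2 * n}) (allFin ((2 * n) ^ (2 * n))))
  maps = AllPairs.map⁺ (AllPairs.tabulate⁺ λ k≢l eq → k≢l (finToFun-injective {2 * n} {2 * n} eq))
  keep {M} {M′} M≢M′ eq eq′ with noncrossing? M | noncrossing? M′
  keep M≢M′ refl refl | yes _ | yes _ = M≢M′

noncrossings-unique : ∀ n k l → proj₁ (lookup (noncrossings n) k) ≗ᴹ proj₁ (lookup (noncrossings n) l) → k ≡ l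
noncrossings-unique n = lookup-unique {R = λ M M′ → proj₁ M ≗ᴹ proj₁ M′} (λ eq i → sym (eq i)) (noncrossings-distinct n)

noncrossings-complete : (M : NC n) → Any (λ N → proj₁ N ≗ᴹ proj₁ M) (noncrossings n)
noncrossings-complete {n} (M , nc) = Any-mapMaybe noncrossing-maybe keep
  (Any-mapMaybe toMatching (toMatching-complete M _)
    (Any.map⁺ (lose (∈-allFin (funToFin (partner M))) (finToFun-funToFin (partner M)))))
  where
  keep : ∀ {M′ : Matching n} → M′ ≗ᴹ M → ∃[ N ] noncrossing-maybe M′ ≡ just N × (proj₁ N ≗ᴹ M)
  keep {M′} eq with noncrossing? M′
  ... | yes _ = _ , refl , eq
  ... | no ¬nc = contradiction (Noncrossing-resp {M = M} {M′} (λ i → sym (eq i)) nc) ¬nc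

-- The expansion of Δ_M over the web permutations below the path of M

module WebExpansion {n} (M : Matching n) (T : Tableau n) (standard : Standard T)
                    (joins : partner (columnMatching T) ≗ partner M) where

  open Region M T standard joins
  open StandardPath M T standard joins using (opener; closer; opener<closer)
  open Leaves I?

  webs : List (Permutation′ n)
  webs = leaves (cells n) Perm.id

  private
    ∅-upClosed : UpClosed {n} ∅
    ∅-upClosed ()

  webs-unique : AllPairs (λ σ τ → ¬ (σ Perm.≈ τ)) webs
  webs-unique = leaves-unique (cells-queue n) ∅-upClosed Perm.id

  webs-inside : All Inside webs
  webs-inside = leaves-inside I-downClosed (cells n) {Perm.id} opener<closer

  webs-web : All WebPermutation webs
  webs-web = leaves-web (cells-queue n) ∅-upClosed (start (λ _ → refl)) (mk⇔ (λ ()) (λ ()))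

  web-complete : ∀ {σ} → WebPermutation σ → Inside σ → Any (σ Perm.≈_) webs
  web-complete {σ} web = leaves-complete {σ} (web⇒ascending {σ = σ} web)

  module _ {c ℓ} (R : CommutativeRing c ℓ) where

    open Webs R n
    open Sum (CommutativeRing.*-commutativeMonoid polyRing) renaming (sum-cong-≋ to product-cong) using ()
    open WebAlgebra R n
    open Expansion polyRing {d = det} (Determinant.three-term polyRing (λ i → var (0F , i)) (λ i → var (1F , i)))
      using (expand; value)
    open ListSum polyRing using (total; total-cong)

    -- At the root the identity pairs the k-th opener with the k-th closer, which is M itself; at a
    -- leaf the labels are the two ends of each strand of the full grid.
    web-expansion : Δ M ≃ total (Δ ∘ Grid.strandMatching) webs
    web-expansion = ≃-trans (Δ-tableau M T joins opener<closer)
      (≃-trans (expand I? (cells-queue n) ∅-upClosed Perm.id (opener , closer))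
        (total-cong (All.map (λ {σ} → at-leaf σ) webs-inside)))
      where
      at-leaf : ∀ σ (inside : Inside σ) →
        value σ (run (λ c → Cr? σ c ×-dec I? c) (cells n) (opener , closer)) ≃ Δ (Grid.strandMatching σ)
      at-leaf σ inside = ≃-trans
        (product-cong λ k → CommutativeRing.reflexive polyRing (cong₂ det (starts-agree k) (ends-agree k)))
        (≃-sym (Δ-tableau (Grid.strandMatching σ) (Grid.strandTableau σ) (λ _ → refl) (Grid.start<end σ)))
        where open Compare σ inside

-- The transition from W to the Specht module

module SpechtTransition {c ℓ} (R : CommutativeRing c ℓ) (n : ℕ) where

  open Transition R n
  private
    module R = CommutativeRing R
    module S = LeftModule S⁽ⁿⁿ⁾
    module W = LeftModule W
  open Webs R n using (Poly; _≃_; ≃-sym; ≃-trans; rename; rename-cong; permuteColumns;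
                          polyRing; Δ; det; con; _⊗_; _⊕_)
  open Specht R n using (polytabloid; swapColumns; _∼?_; sgn; permuteTabloids-polytabloid)
  open WebAlgebra R n
  open Sum (CommutativeRing.*-commutativeMonoid polyRing) renaming (sum to product; sum-cong-≋ to product-cong) using ()

  rename-product : ∀ f {m} (t : Fin m → Poly) → rename f (product t) ≡ product (rename f ∘ t)
  rename-product f {ℕ.zero}  t = refl
  rename-product f {ℕ.suc m} t = cong (rename f (t zero) ⊗_) (rename-product f (t ∘ suc))

  polytabloid-cong : ∀ T T′ → (∀ i → Inverse.from T i ≡ Inverse.from T′ i) →
                     ∀ S → Func.to (polytabloid T) S R.≈ Func.to (polytabloid T′) S
  polytabloid-cong T T′ eq S = Sum.sum-cong-≋ R.+-commutativeMonoid {2 ^ n} λ e →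
    R.*-congˡ {sgn (finToFun e)} (R.reflexive (cong (λ b → if b then R.1# else R.0#) (does-⇔
      (mk⇔ (λ h i → trans (sym (same e i)) (h i)) (λ h i → trans (same e i) (h i)))
      (swapColumns (finToFun e) T ∼? S) (swapColumns (finToFun e) T′ ∼? S))))
    where
    same : ∀ (e : Fin (2 ^ n)) i → rowOf (swapColumns (finToFun e) T) i ≡ rowOf (swapColumns (finToFun e) T′) i
    same e i rewrite eq i = refl

  module _ (φ : W.Carrierᴹ → S.Carrierᴹ) (φ-normalized : IsNormalizedIsomorphism φ) where

    open IsNormalizedIsomorphism φ-normalized
    open ModuleMorphism.LeftModuleMorphisms W.rawLeftModule S.rawLeftModule using (module IsLeftModuleIsomorphism)
    open IsLeftModuleIsomorphism isomorphism using (⟦⟧-cong; injective; +ᴹ-homo; 0ᴹ-homo; *ₗ-homo)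

    open import Relation.Binary.Reasoning.Setoid S.≈ᴹ-setoid

    -- v_M and Δ_M are the images of v_{M₀} and Δ_{M₀} under any permutation that
    -- takes the tableau of M₀ to the tableau of M.
    φ-web : ∀ M → φ (web (proj₁ M)) S.≈ᴹ v M
    φ-web (M , nonnesting) = begin
      φ (web M)                           ≈⟨ ⟦⟧-cong {σ •ᵂ web (proj₁ (M₀ n))} {web M} permute-web ⟨
      φ (σ •ᵂ web (proj₁ (M₀ n)))         ≈⟨ equivariant σ (web (proj₁ (M₀ n))) ⟩
      σ •ˢ φ (web (proj₁ (M₀ n)))         ≈⟨ (λ S → moved (permuteEntries (Perm.flip σ) S)) ⟩
      σ •ˢ v (M₀ n)                       ≈⟨ permute-tabloid ⟩
      v (M , nonnesting)                  ∎
      where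
      standard₀ = standardTableau (proj₁ (M₀ n)) (proj₂ (M₀ n))
      standard₁ = standardTableau M nonnesting
      T₀ = proj₁ standard₀
      T = proj₁ standard₁
      σ : Permutation′ (2 * n)
      σ = T ↔-∘ ↔-sym T₀
      moved : φ (web (proj₁ (M₀ n))) S.≈ᴹ v (M₀ n)
      moved = normalized
      permute-tabloid : ∀ S → Func.to (polytabloid T₀) (permuteEntries (Perm.flip σ) S) R.≈ Func.to (polytabloid T) S
      permute-tabloid S = R.trans (R.sym (permuteTabloids-polytabloid σ T₀ S))
        (polytabloid-cong (permuteEntries σ T₀) T (λ i → Inverse.strictlyInverseʳ T₀ _) S)
      -- Both tableaux have the opener above the closer in every column, so σ carries minors to
      -- minors in the right orientation.
      permute-web : permuteColumns σ (Δ (proj₁ (M₀ n))) ≃ Δ M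
      permute-web = ≃-trans
        (rename-cong _ (Δ-tableau (proj₁ (M₀ n)) T₀ (proj₂ (proj₂ standard₀)) (proj₂ (proj₁ (proj₂ standard₀)))))
        (≃-trans (CommutativeRing.reflexive polyRing (rename-product _ {n} _))
        (≃-trans (product-cong λ k → CommutativeRing.reflexive polyRing (cong₂ det
            (cong (Inverse.to T) (Inverse.strictlyInverseʳ T₀ (0F , k)))
            (cong (Inverse.to T) (Inverse.strictlyInverseʳ T₀ (1F , k)))))
          (≃-sym (Δ-tableau M T (proj₂ (proj₂ standard₁)) (proj₂ (proj₁ (proj₂ standard₁)))))))

    open Sum S.+ᴹ-commutativeMonoid using () renaming (sum to sumˢ; sum-cong-≋ to sumˢ-cong)
    open Sum W.+ᴹ-commutativeMonoid using () renaming (sum to sumᵂ)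
    open Sum (CommutativeRing.+-commutativeMonoid polyRing) using () renaming (sum to sumᴾ)

    φ-sum : ∀ {m} (x : Fin m → W.Carrierᴹ) → φ (sumᵂ x) S.≈ᴹ sumˢ (φ ∘ x)
    φ-sum {ℕ.zero}  x = 0ᴹ-homo
    φ-sum {ℕ.suc m} x = begin
      φ (sumᵂ x)                                    ≈⟨ +ᴹ-homo (x zero) (sumᵂ (x ∘ suc)) ⟩
      φ (x zero) S.+ᴹ φ (sumᵂ (x ∘ suc))            ≈⟨ S.+ᴹ-cong {φ (x zero)} {φ (x zero)} {φ (sumᵂ (x ∘ suc))} {sumˢ (φ ∘ x ∘ suc)}
                                                           (λ _ → R.refl) (φ-sum (x ∘ suc)) ⟩
      sumˢ (φ ∘ x)                                  ∎

    sumᵂ-proj₁ : ∀ {m} (x : Fin m → W.Carrierᴹ) → proj₁ (sumᵂ x) ≡ sumᴾ (proj₁ ∘ x)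
    sumᵂ-proj₁ {ℕ.zero}  x = refl
    sumᵂ-proj₁ {ℕ.suc m} x = cong (proj₁ (x zero) ⊕_) (sumᵂ-proj₁ (x ∘ suc))

    -- As φ is linear and injective, the relation defining the entries pulls back to polynomials,
    -- with v_M replaced by Δ_M through `φ-web`.
    transition-web : ∀ a → IsTransitionMatrix φ a → ∀ M → Δ (proj₁ M) ≃
      sumᴾ (λ k → con (Func.to (a M) (lookup (noncrossings n) k)) ⊗ Δ (proj₁ (lookup (noncrossings n) k)))
    transition-web a transition M = ≃-trans (injective {web (proj₁ M)} {sumᵂ summand} (begin
        φ (web (proj₁ M))     ≈⟨ φ-web M ⟩
        v M                   ≈⟨ transition M ⟩
        sumˢ (λ k → coefficient k S.*ₗ φ (generator k))
          ≈⟨ sumˢ-cong {x = φ ∘ summand} {λ k → coefficient k S.*ₗ φ (generator k)} (λ k → *ₗ-homo (coefficient k) (generator k)) ⟨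
        sumˢ (φ ∘ summand)    ≈⟨ φ-sum summand ⟨
        φ (sumᵂ summand)      ∎))
      (CommutativeRing.reflexive polyRing (sumᵂ-proj₁ summand))
      where
      coefficient : Fin (length (noncrossings n)) → R.Carrier
      coefficient k = Func.to (a M) (lookup (noncrossings n) k)
      generator : Fin (length (noncrossings n)) → W.Carrierᴹ
      generator k = web (proj₁ (lookup (noncrossings n) k))
      summand : Fin (length (noncrossings n)) → W.Carrierᴹ
      summand k = coefficient k W.*ₗ generator k

count : Matching n → List (Permutation′ n) → ℕ
count M σs = length (filter (λ σ → Grid.strandMatching σ ≗ᴹ? M) σs)

module Grouping {c ℓ} (R : CommutativeRing c ℓ) (n : ℕ) where

  open Transition R n using (_·1)
  private
    module R = CommutativeRing R
    module P = CommutativeRing (Webs.polyRing R n)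
  open Webs R n
  open WebAlgebra R n using (Δ-cong)
  open ListSum polyRing using (total)
  open Sum P.+-commutativeMonoid using () renaming (sum to sumᴾ; sum-cong-≋ to sumᴾ-cong; ∑-distrib-+ to sumᴾ-⊕)
  open import Relation.Binary.Reasoning.Setoid P.setoid

  nc : Fin (length (noncrossings n)) → Matching n
  nc k = proj₁ (lookup (noncrossings n) k)

  nc-index : (M : NC n) → ∃[ k ] nc k ≗ᴹ proj₁ M
  nc-index M = Any.index (noncrossings-complete M) , Any.lookup-index (noncrossings-complete M)

  -- Each σ adds 1 at exactly one index, the place of its strand matching in the enumeration; there
  -- is one because strand matchings are noncrossing.
  total-by-matching : ∀ σs → total (Δ ∘ Grid.strandMatching) σs ≃
                      sumᴾ (λ k → con (count (nc k) σs ·1) ⊗ Δ (nc k))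
  total-by-matching []       = ≃-sym (Sums.sum-zero P.+-commutativeMonoid {f = λ k → con R.0# ⊗ Δ (nc k)} λ k → P.zeroˡ (Δ (nc k)))
  total-by-matching (σ ∷ σs) = begin
    Δ M ⊕ total (Δ ∘ Grid.strandMatching) σs
      ≈⟨ ⊕-cong (≃-sym single) (total-by-matching σs) ⟩
    sumᴾ (λ k → con (hit k) ⊗ Δ (nc k)) ⊕ sumᴾ (λ k → con (count (nc k) σs ·1) ⊗ Δ (nc k))
      ≈⟨ sumᴾ-⊕ (λ k → con (hit k) ⊗ Δ (nc k)) (λ k → con (count (nc k) σs ·1) ⊗ Δ (nc k)) ⟨
    sumᴾ (λ k → con (hit k) ⊗ Δ (nc k) ⊕ con (count (nc k) σs ·1) ⊗ Δ (nc k))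
      ≈⟨ sumᴾ-cong (λ k → ≃-trans (≃-sym (P.distribʳ _ _ _)) 
           (⊗-cong (≃-trans (≃-sym (con-⊕ _ _)) (con-cong (count-∷ k))) ≃-refl)) ⟩
    sumᴾ (λ k → con (count (nc k) (σ ∷ σs) ·1) ⊗ Δ (nc k)) ∎
    where
    M = Grid.strandMatching σ
    hit : Fin (length (noncrossings n)) → R.Carrier
    hit k = if does (M ≗ᴹ? nc k) then R.1# else R.0#
    count-∷ : ∀ k → hit k R.+ (count (nc k) σs ·1) R.≈ (count (nc k) (σ ∷ σs) ·1)
    count-∷ k with does (M ≗ᴹ? nc k)
    ... | true  = R.refl
    ... | false = R.+-identityˡ _
    index = nc-index (M , Grid.strand-noncrossing σ)
    k₀ = proj₁ index
    single : sumᴾ (λ k → con (hit k) ⊗ Δ (nc k)) ≃ Δ M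
    single = ≃-trans (Sums.sum-single P.+-commutativeMonoid _ k₀ others)
      (≃-trans (⊗-cong (con-cong (R.reflexive hit-k₀)) ≃-refl)
        (≃-trans (⊗-identityˡ _) (Δ-cong (nc k₀) M (proj₂ index))))
      where
      hit-k₀ : hit k₀ ≡ R.1#
      hit-k₀ rewrite dec-true (M ≗ᴹ? nc k₀) (λ i → sym (proj₂ index i)) = refl
      others : ∀ k → k ≢ k₀ → con (hit k) ⊗ Δ (nc k) ≃ con R.0#
      others k k≢k₀ rewrite dec-false (M ≗ᴹ? nc k)
        (λ eq → k≢k₀ (noncrossings-unique n k k₀ (λ i → trans (sym (eq i)) (sym (proj₂ index i))))) = P.zeroˡ _

module Count {n} (M : NN n) (M′ : NC n) where

  private
    standardised = standardTableau (proj₁ M) (proj₂ M)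

  open WebExpansion (proj₁ M) (proj₁ standardised) (proj₁ (proj₂ standardised)) (proj₂ (proj₂ standardised)) public
  open Region (proj₁ M) (proj₁ standardised) (proj₁ (proj₂ standardised)) (proj₂ (proj₂ standardised)) using (I?)
  open StandardPath (proj₁ M) (proj₁ standardised) (proj₁ (proj₂ standardised)) (proj₂ (proj₂ standardised)) using (inside⇔)

  -- M″ is meant to be the copy of M′ in the enumeration, which indexes the coefficients and agrees
  -- with M′ only pointwise.
  contributing-webs : (M″ : Matching n) → M″ ≗ᴹ proj₁ M′ →
                      HasCardinality (subsetoid (permutationSetoid n) (Contributes M M′)) (count M″ webs)
  contributing-webs M″ same = list-cardinality (permutationSetoid n) (Contributes M M′) _
    (All.zipWith (λ {σ} ((web , inside) , matches) → web , Equivalence.to (inside⇔ σ) inside ,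
        gridMatching-resp {σ = σ} (Grid.strandMatching σ) (proj₁ M′) (λ i → trans (matches i) (same i))
          (Grid.strandMatching-isGridMatching σ))
      ( All.filter⁺ match? (All.zip (webs-web , webs-inside))
      , All.all-filter match? webs))
    (AllPairs.filter⁺ match? webs-unique)
    complete
    where
    match? : Decidable (λ σ → Grid.strandMatching σ ≗ᴹ M″)
    match? σ = Grid.strandMatching σ ≗ᴹ? M″
    complete : ∀ σ → Contributes M M′ σ → Any (σ Perm.≈_) (filter match? webs)
    complete σ (web , path , grid) =
      let (τ , τ∈ , σ≈τ) = find (web-complete {σ} web (Equivalence.from (inside⇔ σ) path))
      in lose (∈-filter⁺ match? τ∈ (λ i → trans (sym (strandMatching-cong {σ = σ} {τ} σ≈τ i))
           (trans (gridMatching-unique {σ = σ} (Grid.strandMatching σ) (proj₁ M′) (Grid.strandMatching-isGridMatching σ) grid i)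
             (sym (same i))))) σ≈τ

module Coefficients {c ℓ} (R : CommutativeRing c ℓ) (n : ℕ) where

  open Transition R n
  open SpechtTransition R n using (transition-web)
  open Grouping R n
  open Independence R n using (independent)
  private
    module R = CommutativeRing R
    module P = CommutativeRing (Webs.polyRing R n)
  open Webs R n using (_≃_; con; _⊗_; _⊕_; ≃-refl; ≃-sym; ≃-trans; ⊗-cong; con-⊕; con-cong; Δ)
  open Sum P.+-commutativeMonoid using () renaming (sum to sumᴾ; sum-cong-≋ to sumᴾ-cong; ∑-distrib-+ to sumᴾ-⊕)

  transition-counts : (φ : LeftModule.Carrierᴹ W → LeftModule.Carrierᴹ S⁽ⁿⁿ⁾) → IsNormalizedIsomorphism φ →
    (a : NN n → Func (NC-setoid n) scalars) → IsTransitionMatrix φ a →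
    (M : NN n) (M′ : NC n) →
    ∃[ k ] HasCardinality (subsetoid (permutationSetoid n) (Contributes M M′)) k
         × Func.to (a M) M′ ≈ (k ·1)
  transition-counts φ normal a transition M M′ = count (nc k₀) webs , contributing-webs (nc k₀) (proj₂ index) ,
    -- A row of the matrix respects equality of matchings, so M′ may be replaced by its copy in the
    -- enumeration, where independence applies to the difference of the two expansions of Δ_M.
    R.trans (Func.cong (a M) (λ i → sym (proj₂ index i)))
      (GroupProperties.x∙y⁻¹≈ε⇒x≈y R.+-group _ _ (independent (lookup (noncrossings n)) (noncrossings-unique n) difference vanishes k₀))
    where
    open Count M M′
    index = nc-index M′
    k₀ = proj₁ index
    entry′ counted difference : Fin (length (noncrossings n)) → R.Carrier
    entry′ k = Func.to (a M) (lookup (noncrossings n) k)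
    counted k = count (nc k) webs ·1
    difference k = entry′ k R.- counted k
    combination : (Fin (length (noncrossings n)) → R.Carrier) → Webs.Poly R n
    combination b = sumᴾ λ k → con (b k) ⊗ Δ (nc k)
    same : combination entry′ ≃ combination counted
    same = ≃-trans (≃-sym (transition-web φ normal a transition M))
      (≃-trans (web-expansion R) (total-by-matching webs))
    restored : combination difference ⊕ combination counted ≃ combination counted
    restored = begin
      combination difference ⊕ combination counted
        ≈⟨ sumᴾ-⊕ (λ k → con (difference k) ⊗ Δ (nc k)) (λ k → con (counted k) ⊗ Δ (nc k)) ⟨
      sumᴾ (λ k → con (difference k) ⊗ Δ (nc k) ⊕ con (counted k) ⊗ Δ (nc k))
        ≈⟨ sumᴾ-cong (λ k → ≃-trans (≃-sym (P.distribʳ (Δ (nc k)) _ _)) (⊗-cong (≃-sym (con-⊕ _ _)) ≃-refl)) ⟩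
      combination (λ k → difference k R.+ counted k)
        ≈⟨ sumᴾ-cong (λ k → ⊗-cong (con-cong (cancelled k)) ≃-refl) ⟩
      combination entry′
        ≈⟨ same ⟩
      combination counted ∎
      where
      open import Relation.Binary.Reasoning.Setoid P.setoid
      cancelled : ∀ k → difference k R.+ counted k R.≈ entry′ k
      cancelled k = R.trans (R.+-assoc _ _ _) (R.trans (R.+-congˡ (R.-‿inverseˡ _)) (R.+-identityʳ _))
    vanishes : combination difference ≃ con R.0#
    vanishes = RingProperties.+-cancelʳ P.ring (combination counted) _ _
      (≃-trans restored (≃-sym (P.+-identityˡ _)))

theorem1p2 : ∀ {c ℓ₁ ℓ₂} (K : HeytingField c ℓ₁ ℓ₂) → CharacteristicZero K →
    (n : ℕ) → 1 ≤ n →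
    let open Transition (fieldRing K) n
    in
    (φ : LeftModule.Carrierᴹ W → LeftModule.Carrierᴹ S⁽ⁿⁿ⁾) → IsNormalizedIsomorphism φ →
    (a : NN n → Func (NC-setoid n) scalars) → IsTransitionMatrix φ a →
    (M : NN n) (M′ : NC n) →
    ∃[ k ] HasCardinality (subsetoid (permutationSetoid n) (Contributes M M′)) k
    × Func.to (a M) M′ ≈ (k ·1)
theorem1p2 K _ n _ = Coefficients.transition-counts (fieldRing K) n
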